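{- Let $q$ be a prime power and let $L$ be a line of $\mathrm{PG}(5,q)$ in the $K$-orbit $o_{13,1}$. Then the hyperplane-orbit distribution $OD_4(L)$ is $\left[3,\,\frac{q^2+3q-2}{2},\,\frac{q^2+q-2}{2},\,q^3-q\right]$ if $q$ is odd, and $\left[q+1,\,\frac{q^2}{2}+q,\,\frac{q^2}{2},\,q^3-q\right]$ if $q$ is even.
   Context: A point $(y_0,\dots,y_5)$ of $\mathrm{PG}(5,q)$ is identified with the nonzero symmetric matrix $\begin{bmatrix} y_0&y_1&y_2\\ y_1&y_3&y_4\\ y_2&y_4&y_5\end{bmatrix}$ up to scalar. $K\cong\mathrm{PGL}(3,q)$ acts by $M\mapsto AMA^T$, $A\in\mathrm{GL}(3,q)$. The orbit $o_{13,1}$ is the $K$-orbit of the line $\left\{\begin{bmatrix} 0&x&0\\ x&y&0\\ 0&0&-y\end{bmatrix}:(x,y)\in\mathrm{PG}(1,q)\right\}$. Hyperplanes correspond to conics of $\mathrm{PG}(2,q)$ (nonzero quadratic forms up to scalar): $\sum_{0\le i\le j\le2}a_{ij}X_iX_j$ corresponds to $a_{00}Y_0+a_{01}Y_1+a_{02}Y_2+a_{11}Y_3+a_{12}Y_4+a_{22}Y_5=0$. $\mathcal H_1,\mathcal H_{2,r},\mathcal H_{2,i},\mathcal H_3$ are the sets of hyperplanes corresponding respectively to double lines (scalar multiples of squares of linear forms), pairs of distinct real lines (products of two non-proportional linear forms over $\mathbb F_q$), pairs of conjugate imaginary lines (scalar multiples of products of two non-proportional linear forms conjugate over $\mathbb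 F_{q^2}$), and non-singular conics (those with $4a_{00}a_{11}a_{22}+a_{01}a_{02}a_{12}-a_{00}a_{12}^2-a_{11}a_{02}^2-a_{22}a_{01}^2\ne0$). $OD_4(L)=[h_1,h_{2,r},h_{2,i},h_3]$ lists the numbers of hyperplanes in $\mathcal H_1,\mathcal H_{2,r},\mathcal H_{2,i},\mathcal H_3$ containing $L$. -}

module Defs where

open import Level using (0ℓ)
open import Algebra.Bundles using (CommutativeRing)
open import Algebra.Structures using (IsCommutativeRing)
open import Algebra.Morphism.Structures using (module RingMorphisms)
open import Data.Fin using (Fin; zero; suc)
open import Data.Nat using (ℕ; suc; _^_)
open import Data.Nat.Primality using (Prime)
open import Data.Product using (Σ; ∃; ∃₂; _×_; _,_; proj₁; proj₂)
open import Data.Vec using (Vec; []; _∷_; map; zipWith; replicate; lookup)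
open import Data.Vec.Properties using (map-cong; map-id; map-∘)
open import Function using (_∘_)
open import Function.Bundles using (Inverse; _↔_)
open import Relation.Binary.Bundles using (Setoid)
import Relation.Binary.Construct.On as On
open import Relation.Binary.PropositionalEquality
open import Relation.Nullary using (¬_; contradiction)
open import Relation.Unary using (Pred; _∈_; _⊆_; _≐_)

PrimePower : ℕ → Set
PrimePower q = ∃₂ λ p k → Prime p × q ≡ p ^ suc k

record Field : Set₁ where
  infixl 6 _+_
  infixl 7 _*_
  infix  8 -_
  field
    Carrier           : Set
    _+_ _*_           : Carrier → Carrier → Carrier
    -_                : Carrier → Carrier
    0# 1#             : Carrier
    isCommutativeRing : IsCommutativeRing _≡_ _+_ _*_ -_ 0# 1#
    0≢1               : 0# ≢ 1#
    inverse           : ∀ x → x ≢ 0# → ∃ λ y → x * y ≡ 1#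

  commutativeRing : CommutativeRing 0ℓ 0ℓ
  commutativeRing = record { isCommutativeRing = isCommutativeRing }

  open CommutativeRing commutativeRing public
    using (rawRing; *-assoc; *-comm; *-identityˡ; zeroˡ; zeroʳ)

HasOrder : Field → ℕ → Set
HasOrder F n = Field.Carrier F ↔ Fin n

record Extension (F : Field) : Set₁ where
  field
    big   : Field
    embed : Field.Carrier F → Field.Carrier big
    isRingHomomorphism :
      RingMorphisms.IsRingHomomorphism (Field.rawRing F) (Field.rawRing big) embed

  record IsAutomorphism (σ : Field.Carrier big → Field.Carrier big) : Set where
    field
      isRingIsomorphism :
        RingMorphisms.IsRingIsomorphism (Field.rawRing big) (Field.rawRing big) σ
      fixes : ∀ x → σ (embed x) ≡ embed x

module Projective (F : Field) where
  open Field F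

  infixr 7 _·_
  infix  4 _∼_

  _·_ : ∀ {n} → Carrier → Vec Carrier n → Vec Carrier n
  c · v = map (c *_) v

  _∼_ : ∀ {n} → Vec Carrier n → Vec Carrier n → Set
  u ∼ v = ∃ λ c → c ≢ 0# × u ≡ c · v

  private
    unit≢0 : ∀ {x y} → x * y ≡ 1# → y ≢ 0#
    unit≢0 {x} xy≡1 refl = 0≢1 (trans (sym (zeroʳ x)) xy≡1)

    ·-one : ∀ {n} (v : Vec Carrier n) → 1# · v ≡ v
    ·-one v = trans (map-cong *-identityˡ v) (map-id v)

    ·-· : ∀ {n} c d (v : Vec Carrier n) → c · d · v ≡ (c * d) · v
    ·-· c d v = trans (sym (map-∘ (c *_) (d *_) v))
                      (map-cong (λ x → sym (*-assoc c d x)) v)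

  ∼-refl : ∀ {n} {u : Vec Carrier n} → u ∼ u
  ∼-refl {u = u} = 1# , 0≢1 ∘ sym , sym (·-one u)

  ∼-sym : ∀ {n} {u v : Vec Carrier n} → u ∼ v → v ∼ u
  ∼-sym {v = v} (c , c≢0 , refl) with inverse c c≢0
  ... | d , cd≡1 = d , unit≢0 cd≡1 ,
    sym (trans (·-· d c v) (trans (cong (_· v) (trans (*-comm d c) cd≡1)) (·-one v)))

  ∼-trans : ∀ {n} {u v w : Vec Carrier n} → u ∼ v → v ∼ w → u ∼ w
  ∼-trans {w = w} (c , c≢0 , refl) (d , d≢0 , refl) = c * d , cd≢0 , ·-· c d w
    where
    cd≢0 : c * d ≢ 0#
    cd≢0 cd≡0 with inverse c c≢0
    ... | e , ce≡1 = d≢0 (begin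
      d            ≡⟨ *-identityˡ d ⟨
      1# * d       ≡⟨ cong (_* d) (trans (*-comm e c) ce≡1) ⟨
      e * c * d    ≡⟨ *-assoc e c d ⟩
      e * (c * d)  ≡⟨ cong (e *_) cd≡0 ⟩
      e * 0#       ≡⟨ zeroʳ e ⟩
      0#           ∎)
      where open ≡-Reasoning

  -- Homogeneous coordinates; n is the vector-space dimension, so the points of
  -- PG(n - 1, q) are the elements of NonZeroVec n up to ∼.
  NonZeroVec : ℕ → Set
  NonZeroVec n = Σ (Vec Carrier n) λ v → v ≢ replicate n 0#

  PG : ℕ → Setoid 0ℓ 0ℓ
  PG n = record
    { Carrier       = NonZeroVec n
    ; _≈_           = λ P Q → proj₁ P ∼ proj₁ Q
    ; isEquivalence = On.isEquivalence proj₁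
        (record { refl = ∼-refl ; sym = ∼-sym ; trans = ∼-trans })
    }

  Point Hyperplane : Set
  Point      = NonZeroVec 6
  Hyperplane = NonZeroVec 6

  record Line : Set where
    field
      P₁ P₂    : Point
      distinct : ¬ (proj₁ P₁ ∼ proj₁ P₂)

    points : Pred Point 0ℓ
    points R = ∃₂ λ x y → proj₁ R ≡ zipWith _+_ (x · proj₁ P₁) (y · proj₁ P₂)

  -- A hyperplane has coefficient vector (a₀₀ , a₀₁ , a₀₂ , a₁₁ , a₁₂ , a₂₂), which
  -- is also that of the quadratic form Σ aᵢⱼ Xᵢ Xⱼ (i ≤ j) of the associated conic.
  onHyperplane : Hyperplane → Pred Point 0ℓ
  onHyperplane
    (a₀₀ ∷ a₀₁ ∷ a₀₂ ∷ a₁₁ ∷ a₁₂ ∷ a₂₂ ∷ [] , _)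
    (y₀ ∷ y₁ ∷ y₂ ∷ y₃ ∷ y₄ ∷ y₅ ∷ [] , _) =
    a₀₀ * y₀ + a₀₁ * y₁ + a₀₂ * y₂ + a₁₁ * y₃ + a₁₂ * y₄ + a₂₂ * y₅ ≡ 0#

  Matrix : Set
  Matrix = Fin 3 → Fin 3 → Carrier

  infixl 7 _⊗_
  _⊗_ : Matrix → Matrix → Matrix
  (A ⊗ B) i j = A i zero * B zero j + A i (suc zero) * B (suc zero) j
              + A i (suc (suc zero)) * B (suc (suc zero)) j

  _ᵀ : Matrix → Matrix
  (A ᵀ) i j = A j i

  fromRows : Vec (Vec Carrier 3) 3 → Matrix
  fromRows rows i j = lookup (lookup rows i) j

  identity : Matrix
  identity = fromRows ((1# ∷ 0# ∷ 0# ∷ []) ∷ (0# ∷ 1# ∷ 0# ∷ []) ∷ (0# ∷ 0# ∷ 1# ∷ []) ∷ [])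

  Invertible : Matrix → Set
  Invertible A = ∃ λ B → (∀ i j → (A ⊗ B) i j ≡ identity i j)
                       × (∀ i j → (B ⊗ A) i j ≡ identity i j)

  toMatrix : Vec Carrier 6 → Matrix
  toMatrix (y₀ ∷ y₁ ∷ y₂ ∷ y₃ ∷ y₄ ∷ y₅ ∷ []) = fromRows
    ( (y₀ ∷ y₁ ∷ y₂ ∷ [])
    ∷ (y₁ ∷ y₃ ∷ y₄ ∷ [])
    ∷ (y₂ ∷ y₄ ∷ y₅ ∷ []) ∷ [])

  -- Image of a set of points under M ↦ A M Aᵀ.
  image : Matrix → Pred Point 0ℓ → Pred Point 0ℓ
  image A S R = ∃ λ Q → Q ∈ S × ∃ λ c → c ≢ 0# ×
    (∀ i j → toMatrix (proj₁ R) i j ≡ c * (A ⊗ toMatrix (proj₁ Q) ⊗ A ᵀ) i j)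

  line₁₃,₁ : Pred Point 0ℓ
  line₁₃,₁ R = ∃₂ λ x y → ¬ (x ≡ 0# × y ≡ 0#) ×
    proj₁ R ∼ (0# ∷ x ∷ 0# ∷ y ∷ 0# ∷ - y ∷ [])

  o₁₃,₁ : Pred Line 0ℓ
  o₁₃,₁ L = ∃ λ A → Invertible A × Line.points L ≐ image A line₁₃,₁

  LinearForm : Set
  LinearForm = Vec Carrier 3

  formProduct : LinearForm → LinearForm → Vec Carrier 6
  formProduct (l₀ ∷ l₁ ∷ l₂ ∷ []) (m₀ ∷ m₁ ∷ m₂ ∷ []) =
      l₀ * m₀ ∷ l₀ * m₁ + l₁ * m₀ ∷ l₀ * m₂ + l₂ * m₀
    ∷ l₁ * m₁ ∷ l₁ * m₂ + l₂ * m₁ ∷ l₂ * m₂ ∷ []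

  H₁ H₂ᵣ H₃ : Pred Hyperplane 0ℓ
  H₁ (a , _) = ∃ λ l → a ∼ formProduct l l
  H₂ᵣ (a , _) = ∃₂ λ l m → ¬ (l ∼ m) × a ≡ formProduct l m
  H₃ (a₀₀ ∷ a₀₁ ∷ a₀₂ ∷ a₁₁ ∷ a₁₂ ∷ a₂₂ ∷ [] , _) =
    (1# + 1# + 1# + 1#) * a₀₀ * a₁₁ * a₂₂ + a₀₁ * a₀₂ * a₁₂
      + - (a₀₀ * a₁₂ * a₁₂) + - (a₁₁ * a₀₂ * a₀₂) + - (a₂₂ * a₀₁ * a₀₁) ≢ 0#

  -- S, taken up to proportionality, has exactly n elements.
  Count : Pred Hyperplane 0ℓ → ℕ → Set
  Count S n = Inverse S-setoid (setoid (Fin n))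
    where
    S-setoid : Setoid 0ℓ 0ℓ
    S-setoid = record
      { Carrier       = Σ Hyperplane S
      ; _≈_           = λ H H′ → Setoid._≈_ (PG 6) (proj₁ H) (proj₁ H′)
      ; isEquivalence = On.isEquivalence proj₁ (Setoid.isEquivalence (PG 6))
      }

module OrbitDistribution (F : Field) (E : Extension F) where
  open Projective F public
  open Extension E
  private module PE = Projective big

  -- When E is quadratic, its only automorphisms over F are the identity and
  -- x ↦ x ^ q; a form that is not proportional to its conjugate excludes the identity.
  Conjugate : PE.LinearForm → PE.LinearForm → Set
  Conjugate l m = ∃ λ σ → IsAutomorphism σ × m ≡ map σ l

  H₂ᵢ : Pred Hyperplane 0ℓ
  H₂ᵢ (a , _) = ∃ λ b → a ∼ b × ∃₂ λ l m →
    ¬ (l PE.∼ m) × Conjugate l m × map embed b ≡ PE.formProduct l m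

  OD₄ : Line → Vec ℕ 4 → Set
  OD₄ L (h₁ ∷ h₂ᵣ ∷ h₂ᵢ ∷ h₃ ∷ []) =
    through H₁ h₁ × through H₂ᵣ h₂ᵣ × through H₂ᵢ h₂ᵢ × through H₃ h₃
    where
    through : Pred Hyperplane 0ℓ → ℕ → Set
    through S = Count λ H → H ∈ S × Line.points L ⊆ onHyperplane H

{-# OPTIONS --safe #-}
module Submission where

-- Pulling forms back along A reduces the theorem to the standard line, the hyperplanes
-- through which correspond to the forms a X₀² + b X₀X₂ + c (X₁² + X₂²) + d X₁X₂.  The
-- singular ones are brought to normal form.  In odd characteristic, with U = X₁ + X₂ and
-- V = X₁ − X₂, they are X₀², U², V², the products X₀ (a X₀ + U − V), and the forms
-- (V + k r X₀)² − r (U + k X₀)², X₀² − r U², X₀² − r V² with r ≠ 0, which split over F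
-- exactly when r is a square.  In even characteristic they are the double lines
-- X₀² + c (X₁² + X₂²) and X₁² + X₂², the products X₀ (a X₀ + X₂), and the forms
-- u (Y² + X₂²) + Y X₂ with Y = b X₀ + X₁, which split over F exactly when u is of the form
-- v² + v.  The quadratic extension contains an element ω with conjugate −ω (or ω + 1) and
-- ω² (or ω² + ω) in F, over which the remaining forms split into conjugate factors.  Since
-- a form has essentially one factorization, the classes are disjoint, so counting normal
-- forms counts hyperplanes; the (q + 1)² singular ones leave q³ − q non-singular ones.

open import Defs
open import Algebra.Bundles using (RawMonoid; RawRing; CommutativeRing)
import Algebra.Definitions.RawMonoid as RawMonoidDefs
open import Algebra.Morphism.Structures using (module RingMorphisms)
open import Data.Bool using (Bool; true; false; T; _∧_; _xor_; not; if_then_else_)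
open import Data.Bool.Properties using (T-∧)
open import Data.Empty using (⊥)
open import Data.Fin as Fin using (Fin; zero; suc; punchOut)
open import Data.Fin.Patterns using (0F; 1F; 2F; 3F; 4F; 5F)
open import Data.Fin.Permutation using (↔⇒≡)
import Data.Fin.Properties as Finₚ
open import Data.Integer as ℤ using (ℤ; +0; +[1+_]; -[1+_]) renaming (+_ to fromℕ)
import Data.Integer.Properties as ℤₚ
open import Data.List as List using (List; _∷_; filter; allFin; length)
open import Data.List.Membership.Propositional.Properties
  using (∈-filter⁺; ∈-filter⁻; ∈-lookup; ∈-allFin)
open import Data.List.Relation.Unary.All as All using ()
open import Data.List.Relation.Unary.AllPairs using (_∷_)
open import Data.List.Relation.Unary.Any using (index)
open import Data.List.Relation.Unary.Any.Properties using (lookup-index)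
open import Data.List.Relation.Unary.Unique.Propositional using (Unique)
import Data.List.Relation.Unary.Unique.Propositional.Properties as Uniqueₚ
open import Data.Maybe using (nothing)
open import Data.Nat as ℕ using (ℕ; zero; suc; _^_; _∸_; s≤s; z≤n)
open import Data.Nat.DivMod using (_/_; m*n/n≡m)
open import Data.Nat.Divisibility using (_∣_; divides; ∣m+n∣m⇒∣n; ∣1⇒≡1)
import Data.Nat.Properties as ℕₚ
open import Data.Nat.Solver using (module +-*-Solver)
open import Data.Product using (_×_; _,_; proj₁; proj₂; ∃; ∃₂)
open import Data.Product.Function.NonDependent.Propositional using (_×-↔_)
open import Data.Sum as Sum using (_⊎_; inj₁; inj₂)
open import Data.Sum.Function.Propositional using (_⊎-↔_)
open import Data.Unit using (⊤; tt)
open import Data.Vec as Vec using (Vec; []; _∷_; map; zipWith; replicate; lookup; head; tail)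
open import Data.Vec.N-ary using (N-ary; Eq; curryⁿ; _$ⁿ_; curryⁿ-cong)
open import Data.Vec.Properties
  using (≡-dec; lookup-map; tabulate∘lookup; tabulate-cong; map-∘; map-cong)
open import Function using (_∘_; id)
open import Function.Bundles using (_↔_; Inverse; Equivalence; mk↔ₛ′)
open import Function.Construct.Composition using (_↔-∘_)
open import Function.Construct.Identity using (↔-id)
open import Function.Construct.Symmetry using (↔-sym)
open import Function.Properties.Inverse using (↔⇒↣; ↔-refl)
open import Level using (0ℓ)
open import Relation.Binary.Definitions using (DecidableEquality; tri<; tri≈; tri>)
open import Relation.Binary.PropositionalEquality
open import Relation.Nullary using (¬_; Dec; yes; no; contradiction; ¬?)
open import Relation.Unary using (Pred; Decidable; _∈_; _⊆_; _≐_)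
open import Tactic.RingSolver.Core.AlmostCommutativeRing
  using (AlmostCommutativeRing; fromCommutativeRing; _-Raw-AlmostCommutative⟶_)
open import Tactic.RingSolver.Core.Expression using (Expr; Κ; Ι; _⊕_; _⊗_; _⊛_; ⊝_; module Eval)
import Tactic.RingSolver.Core.Polynomial.Base as Base
import Tactic.RingSolver.Core.Polynomial.Homomorphism as Hom
open import Tactic.RingSolver.Core.Polynomial.Parameters using (Homomorphism)
import Tactic.RingSolver.Core.Polynomial.Semantics as Semantics

-- The extension is known only through its order, so conjugation has to be constructed: some θ
-- outside the ground field is found by counting, `{1, θ}` is a basis, again by counting, and σ
-- exchanges the roots of the quadratic equation of θ. The same equation supplies the nonsquare, or
-- the element not of the form v² + v, that separates split from non-split forms. The forms U and V
-- are chosen because every c (X₁² + X₂²) + d X₁X₂ becomes m U² + n V², so squares can be completed.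
-- In characteristic two U and V coincide, which forces the different normal form with a mixed term.
-- Non-singular forms are never described. The discriminant cuts the singular ones out by a single
-- equation, one covering statement for these serves all three singular classes, and the last number
-- is a complement in projective 3-space. Halves are counted by representatives of the orbits of x ↦
-- -x or x ↦ x + 1: with h orbits of two elements, q is 2h + 1 or 2h, and the fractions of the
-- statement become polynomials in h.

almostRing : Field → AlmostCommutativeRing 0ℓ 0ℓ
almostRing F = fromCommutativeRing (Field.commutativeRing F) (λ _ → nothing)

-- Polynomial identities over an abstract field

-- The library's solvers take coefficients in the target ring or in ℕ; an abstract
-- field does not compute, so cancellation needs coefficients in ℤ (or 𝔽₂).
module IdentitySolver
  (F : Field) {C : RawRing 0ℓ 0ℓ} (isZero : RawRing.Carrier C → Bool)
  (morphism : C -Raw-AlmostCommutative⟶ almostRing F)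
  (isZero-sound : ∀ c → T (isZero c) →
    Field.0# F ≡ _-Raw-AlmostCommutative⟶_.⟦_⟧ morphism c)
  where

  open Field F

  private
    homo : Homomorphism 0ℓ 0ℓ 0ℓ 0ℓ
    homo = record
      { from = record { rawRing = C ; isZero = isZero }
      ; to = almostRing F
      ; morphism = morphism
      ; Zero-C⟶Zero-R = isZero-sound
      }

  module H = Homomorphism homo
  open Base H.from
  open Hom homo
  private module S = Semantics homo

  open AlmostCommutativeRing (almostRing F) using (+-cong; *-cong; -‿cong)
  open import Algebra.Properties.Semiring.Exp.TCOptimised
    (AlmostCommutativeRing.semiring (almostRing F)) using (^-congˡ)
  open Eval (Field.rawRing F) (_-Raw-AlmostCommutative⟶_.⟦_⟧ morphism) public

  Term : ℕ → Set
  Term = Expr (RawRing.Carrier C)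

  private
    norm : ∀ {n} → Term n → Poly n
    norm (Κ x)   = κ x
    norm (Ι x)   = ι x
    norm (x ⊕ y) = norm x ⊞ norm y
    norm (x ⊗ y) = norm x ⊠ norm y
    norm (⊝ x)   = ⊟ norm x
    norm (x ⊛ i) = norm x ⊡ i

    norm-correct : ∀ {n} (e : Term n) ρ → S.⟦ norm e ⟧ ρ ≡ ⟦ e ⟧ ρ
    norm-correct (Κ x)   ρ = κ-hom x ρ
    norm-correct (Ι x)   ρ = ι-hom x ρ
    norm-correct (x ⊕ y) ρ =
      trans (⊞-hom (norm x) (norm y) ρ) (+-cong (norm-correct x ρ) (norm-correct y ρ))
    norm-correct (x ⊗ y) ρ =
      trans (⊠-hom (norm x) (norm y) ρ) (*-cong (norm-correct x ρ) (norm-correct y ρ))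
    norm-correct (⊝ x)   ρ = trans (⊟-hom (norm x) ρ) (-‿cong (norm-correct x ρ))
    norm-correct (x ⊛ i) ρ = trans (⊡-hom (norm x) i ρ) (^-congˡ i (norm-correct x ρ))

    -- Normalization collapses a polynomial whose coefficients all cancel to a constant, so only
    -- constants are tested; a wrong `false` could merely reject a true identity.
    isZeroPoly : ∀ {n} → Poly n → Bool
    isZeroPoly (Κ x ⊐ _) = isZero x
    isZeroPoly (⅀ _ ⊐ _) = false

    isZeroPoly-sound : ∀ {n} (p : Poly n) → T (isZeroPoly p) → ∀ ρ → S.⟦ p ⟧ ρ ≡ 0#
    isZeroPoly-sound (Κ x ⊐ _) z ρ = sym (isZero-sound x z)

    x-y≡0⇒x≡y : ∀ {x y} → x + - y ≡ 0# → x ≡ y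
    x-y≡0⇒x≡y {x} {y} = x∙y⁻¹≈ε⇒x≈y x y
      where open import Algebra.Properties.Group (CommutativeRing.+-group commutativeRing)

  close : ∀ {A : Set} n → N-ary n (Term n) A → A
  close n f = f $ⁿ map Ι (Vec.allFin n)

  𝟘 𝟙 : ∀ {n} → Term n
  𝟘 = Κ (RawRing.0# C)
  𝟙 = Κ (RawRing.1# C)

  exprRing : ℕ → RawRing 0ℓ 0ℓ
  exprRing n = record
    { Carrier = Term n ; _≈_ = _≡_ ; _+_ = _⊕_ ; _*_ = _⊗_ ; -_ = ⊝_ ; 0# = 𝟘 ; 1# = 𝟙 }

  infix 4 _⊜_
  _⊜_ : ∀ {A : Set} → A → A → A × A
  _⊜_ = _,_

  -- The implicit argument computes to the unit type for a true identity, so each call is checked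
  -- during elaboration. Testing the difference for zero requires no equality on polynomials.
  equation : ∀ n (f : N-ary n (Term n) (Term n × Term n)) → let l , r = close n f in
    {T (isZeroPoly (norm (l ⊕ ⊝ r)))} →
    Eq n _≡_ (curryⁿ ⟦ l ⟧) (curryⁿ ⟦ r ⟧)
  equation n f {z} = let l , r = close n f in
    curryⁿ-cong _≡_ ⟦ l ⟧ ⟦ r ⟧ λ ρ →
      x-y≡0⇒x≡y (trans (sym (norm-correct (l ⊕ ⊝ r) ρ))
                       (isZeroPoly-sound (norm (l ⊕ ⊝ r)) z ρ))

  ⟦_⟧ᵥ : ∀ {n k} → Vec (Term n) k → Vec Carrier n → Vec Carrier k
  ⟦ es ⟧ᵥ ρ = map (λ e → ⟦ e ⟧ ρ) es

  private
    identical : ∀ {n k} → Vec (Term n) k → Vec (Term n) k → Bool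
    identical []       []       = true
    identical (l ∷ ls) (r ∷ rs) = isZeroPoly (norm (l ⊕ ⊝ r)) ∧ identical ls rs

    identical-sound : ∀ {n k} (ls rs : Vec (Term n) k) → T (identical ls rs) →
      ∀ ρ → ⟦ ls ⟧ᵥ ρ ≡ ⟦ rs ⟧ᵥ ρ
    identical-sound []       []       _ ρ = refl
    identical-sound (l ∷ ls) (r ∷ rs) z ρ = let z₁ , z₂ = Equivalence.to T-∧ z in cong₂ _∷_
      (x-y≡0⇒x≡y (trans (sym (norm-correct (l ⊕ ⊝ r) ρ))
                        (isZeroPoly-sound (norm (l ⊕ ⊝ r)) z₁ ρ)))
      (identical-sound ls rs z₂ ρ)

  equations : ∀ n {k} (f : N-ary n (Term n) (Vec (Term n) k × Vec (Term n) k)) →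
    let ls , rs = close n f in {T (identical ls rs)} →
    Eq n _≡_ (curryⁿ ⟦ ls ⟧ᵥ) (curryⁿ ⟦ rs ⟧ᵥ)
  equations n f {z} = let ls , rs = close n f in
    curryⁿ-cong _≡_ ⟦ ls ⟧ᵥ ⟦ rs ⟧ᵥ (identical-sound ls rs z)

module IntegerCoefficients (F : Field) where
  open Field F
  private module R = CommutativeRing commutativeRing
  open import Algebra.Properties.Ring R.ring
  open import Algebra.Properties.AbelianGroup R.+-abelianGroup using (⁻¹-∙-comm)
  -- With the optimised multiple, `1 ⋆ 1#` reduces to `1#`, so the constants of solver terms
  -- evaluate to the field's own constants and solved equations match the goals by computation.
  open import Algebra.Properties.Semiring.Mult.TCOptimised R.semiring
    renaming (_×_ to _⋆_)

  private
    isZero : ℤ → Bool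
    isZero +0 = true
    isZero _  = false

    fromℤ : ℤ → Carrier
    fromℤ (fromℕ n)    = n ⋆ 1#
    fromℤ -[1+ n ] = - (suc n ⋆ 1#)

    fromℤ-⊖ : ∀ m n → fromℤ (m ℤ.⊖ n) ≡ m ⋆ 1# + - (n ⋆ 1#)
    fromℤ-⊖ m zero = sym (trans (cong (m ⋆ 1# +_) -0#≈0#) (R.+-identityʳ _))
    fromℤ-⊖ zero (suc n) = sym (R.+-identityˡ _)
    fromℤ-⊖ (suc m) (suc n) = begin
      fromℤ (suc m ℤ.⊖ suc n)                    ≡⟨ cong fromℤ (ℤₚ.[1+m]⊖[1+n]≡m⊖n m n) ⟩
      fromℤ (m ℤ.⊖ n)                            ≡⟨ fromℤ-⊖ m n ⟩
      m ⋆ 1# + - (n ⋆ 1#)                        ≡⟨ cong (_+ - (n ⋆ 1#)) (R.+-identityʳ _) ⟨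
      m ⋆ 1# + 0# + - (n ⋆ 1#)                   ≡⟨ cong (λ x → m ⋆ 1# + x + - (n ⋆ 1#)) (R.-‿inverseʳ 1#) ⟨
      m ⋆ 1# + (1# + - 1#) + - (n ⋆ 1#)          ≡⟨ cong (_+ - (n ⋆ 1#)) (R.+-assoc _ _ _) ⟨
      m ⋆ 1# + 1# + - 1# + - (n ⋆ 1#)            ≡⟨ R.+-assoc _ _ _ ⟩
      m ⋆ 1# + 1# + (- 1# + - (n ⋆ 1#))          ≡⟨ cong₂ _+_ (trans (R.+-comm _ _) (sym (1+× m 1#)))
                                                      (trans (⁻¹-∙-comm _ _) (cong -_ (sym (1+× n 1#)))) ⟩
      suc m ⋆ 1# + - (suc n ⋆ 1#)                ∎
      where open ≡-Reasoning

    fromℤ-neg : ∀ i → fromℤ (ℤ.- i) ≡ - fromℤ i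
    fromℤ-neg +0       = sym -0#≈0#
    fromℤ-neg +[1+ n ] = refl
    fromℤ-neg -[1+ n ] = sym (-‿involutive _)

    fromℤ-+ : ∀ i j → fromℤ (i ℤ.+ j) ≡ fromℤ i + fromℤ j
    fromℤ-+ (fromℕ m)    (fromℕ n)    = ×-homo-+ 1# m n
    fromℤ-+ (fromℕ m)    -[1+ n ] = fromℤ-⊖ m (suc n)
    fromℤ-+ -[1+ m ] (fromℕ n)    = trans (fromℤ-⊖ n (suc m)) (R.+-comm _ _)
    fromℤ-+ -[1+ m ] -[1+ n ] = begin
      - (suc (suc (m ℕ.+ n)) ⋆ 1#)      ≡⟨ cong (λ k → - (suc k ⋆ 1#)) (ℕₚ.+-suc m n) ⟨
      - ((suc m ℕ.+ suc n) ⋆ 1#)        ≡⟨ cong -_ (×-homo-+ 1# (suc m) (suc n)) ⟩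
      - (suc m ⋆ 1# + suc n ⋆ 1#)       ≡⟨ ⁻¹-∙-comm _ _ ⟨
      - (suc m ⋆ 1#) + - (suc n ⋆ 1#)   ∎
      where open ≡-Reasoning

    fromℤ-*ˡ : ∀ m j → fromℤ (fromℕ m ℤ.* j) ≡ fromℤ (fromℕ m) * fromℤ j
    fromℤ-*ˡ m (fromℕ n) = trans (cong fromℤ (sym (ℤₚ.pos-* m n))) (×1-homo-* m n)
    fromℤ-*ˡ m -[1+ n ] = begin
      fromℤ (fromℕ m ℤ.* -[1+ n ])          ≡⟨ cong fromℤ (ℤₚ.neg-distribʳ-* (fromℕ m) +[1+ n ]) ⟨
      fromℤ (ℤ.- (fromℕ m ℤ.* +[1+ n ]))    ≡⟨ fromℤ-neg (fromℕ m ℤ.* +[1+ n ]) ⟩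
      - fromℤ (fromℕ m ℤ.* +[1+ n ])        ≡⟨ cong -_ (fromℤ-*ˡ m +[1+ n ]) ⟩
      - (m ⋆ 1# * (suc n ⋆ 1#))         ≡⟨ -‿distribʳ-* _ _ ⟩
      m ⋆ 1# * - (suc n ⋆ 1#)           ∎
      where open ≡-Reasoning

    fromℤ-* : ∀ i j → fromℤ (i ℤ.* j) ≡ fromℤ i * fromℤ j
    fromℤ-* (fromℕ m) j = fromℤ-*ˡ m j
    fromℤ-* -[1+ m ] j = begin
      fromℤ (-[1+ m ] ℤ.* j)            ≡⟨ cong fromℤ (ℤₚ.neg-distribˡ-* +[1+ m ] j) ⟨
      fromℤ (ℤ.- (+[1+ m ] ℤ.* j))      ≡⟨ fromℤ-neg (+[1+ m ] ℤ.* j) ⟩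
      - fromℤ (+[1+ m ] ℤ.* j)          ≡⟨ cong -_ (fromℤ-*ˡ (suc m) j) ⟩
      - (suc m ⋆ 1# * fromℤ j)          ≡⟨ -‿distribˡ-* _ _ ⟩
      - (suc m ⋆ 1#) * fromℤ j          ∎
      where open ≡-Reasoning

    morphism : ℤ.+-*-rawRing -Raw-AlmostCommutative⟶ almostRing F
    morphism = record
      { ⟦_⟧ = fromℤ ; +-homo = fromℤ-+ ; *-homo = fromℤ-* ; -‿homo = fromℤ-neg
      ; 0-homo = refl ; 1-homo = refl }

    isZero-sound : ∀ i → T (isZero i) → 0# ≡ fromℤ i
    isZero-sound +0 _ = refl

  open IdentitySolver F isZero morphism isZero-sound public

module Naturality (F G : Field) {φ : Field.Carrier F → Field.Carrier G}
  (φ-hom : RingMorphisms.IsRingHomomorphism (Field.rawRing F) (Field.rawRing G) φ)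
  where

  private
    module F = IntegerCoefficients F
    module G = IntegerCoefficients G
    module FF = CommutativeRing (Field.commutativeRing F)
    module GG = CommutativeRing (Field.commutativeRing G)

    _×[_]_ : ℕ → (M : RawMonoid 0ℓ 0ℓ) → RawMonoid.Carrier M → RawMonoid.Carrier M
    n ×[ M ] x = RawMonoidDefs._×′_ M n x
  open RingMorphisms.IsRingHomomorphism φ-hom

  private
    -- Needed for both monoids of a ring: additively for integer constants, multiplicatively for
    -- powers.
    ×′-homo : ∀ (M N : RawMonoid 0ℓ 0ℓ) {f : RawMonoid.Carrier M → RawMonoid.Carrier N} →
      f (RawMonoid.ε M) ≡ RawMonoid.ε N →
      (∀ x y → f (RawMonoid._∙_ M x y) ≡ RawMonoid._∙_ N (f x) (f y)) →
      ∀ n x → f (n ×[ M ] x) ≡ n ×[ N ] f x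
    ×′-homo M N f-ε f-∙ 0             x = f-ε
    ×′-homo M N f-ε f-∙ 1             x = refl
    ×′-homo M N f-ε f-∙ (suc (suc n)) x =
      trans (f-∙ _ x) (cong (λ y → RawMonoid._∙_ N y _) (×′-homo M N f-ε f-∙ (suc n) x))

    fromℕ-homo : ∀ n → φ (n ×[ FF.+-rawMonoid ] FF.1#) ≡ n ×[ GG.+-rawMonoid ] GG.1#
    fromℕ-homo n = trans (×′-homo FF.+-rawMonoid GG.+-rawMonoid 0#-homo +-homo n FF.1#)
                         (cong (n ×[ GG.+-rawMonoid ]_) 1#-homo)

  -- One induction over expressions replaces separate compatibility proofs for products,
  -- discriminants and pullbacks, under the embedding as well as under conjugation.
  natural : ∀ {n} (e : Expr ℤ n) ρ → φ (F.⟦ e ⟧ ρ) ≡ G.⟦ e ⟧ (map φ ρ)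
  natural (Κ (fromℕ n))    ρ = fromℕ-homo n
  natural (Κ -[1+ n ])   ρ = trans (-‿homo _) (cong GG.-_ (fromℕ-homo (suc n)))
  natural (Ι i)     ρ = sym (lookup-map i φ ρ)
  natural (d ⊕ e)   ρ = trans (+-homo _ _) (cong₂ GG._+_ (natural d ρ) (natural e ρ))
  natural (d ⊗ e)   ρ = trans (*-homo _ _) (cong₂ GG._*_ (natural d ρ) (natural e ρ))
  natural (⊝ e)     ρ = trans (-‿homo _) (cong GG.-_ (natural e ρ))
  natural (e ⊛ n)   ρ = trans (×′-homo FF.*-rawMonoid GG.*-rawMonoid 1#-homo *-homo n (F.⟦ e ⟧ ρ))
                            (cong (n ×[ GG.*-rawMonoid ]_) (natural e ρ))

  naturalᵥ : ∀ {n k} (es : Vec (Expr ℤ n) k) ρ → map φ (F.⟦ es ⟧ᵥ ρ) ≡ G.⟦ es ⟧ᵥ (map φ ρ)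
  naturalᵥ []       ρ = refl
  naturalᵥ (e ∷ es) ρ = cong₂ _∷_ (natural e ρ) (naturalᵥ es ρ)

CharTwo : Field → Set
CharTwo F = 1# + 1# ≡ 0#
  where open Field F

module CharacteristicTwo (F : Field) (1+1≡0 : CharTwo F) where
  open Field F
  private module R = CommutativeRing commutativeRing
  open import Algebra.Properties.Ring R.ring

  private
    𝔽₂ : RawRing 0ℓ 0ℓ
    𝔽₂ = record
      { Carrier = Bool ; _≈_ = _≡_ ; _+_ = _xor_ ; _*_ = _∧_ ; -_ = λ b → b
      ; 0# = false ; 1# = true }

    from𝔽₂ : Bool → Carrier
    from𝔽₂ b = if b then 1# else 0#

    from𝔽₂-+ : ∀ a b → from𝔽₂ (a xor b) ≡ from𝔽₂ a + from𝔽₂ b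
    from𝔽₂-+ true true   = sym 1+1≡0
    from𝔽₂-+ true false  = sym (R.+-identityʳ 1#)
    from𝔽₂-+ false b     = sym (R.+-identityˡ _)

    from𝔽₂-* : ∀ a b → from𝔽₂ (a ∧ b) ≡ from𝔽₂ a * from𝔽₂ b
    from𝔽₂-* true  b = sym (R.*-identityˡ _)
    from𝔽₂-* false b = sym (R.zeroˡ _)

    from𝔽₂-neg : ∀ a → from𝔽₂ a ≡ - from𝔽₂ a
    from𝔽₂-neg false = sym -0#≈0#
    from𝔽₂-neg true  = +-inverseʳ-unique 1# 1# 1+1≡0

    morphism : 𝔽₂ -Raw-AlmostCommutative⟶ almostRing F
    morphism = record
      { ⟦_⟧ = from𝔽₂ ; +-homo = from𝔽₂-+ ; *-homo = from𝔽₂-* ; -‿homo = from𝔽₂-neg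
      ; 0-homo = refl ; 1-homo = refl }

    isZero-sound : ∀ b → T (not b) → 0# ≡ from𝔽₂ b
    isZero-sound false _ = refl

  open IdentitySolver F not morphism isZero-sound public

-- Counting in finite types

Injective : ∀ {a b} {A : Set a} {B : Set b} → (A → B) → Set _
Injective f = ∀ {x y} → f x ≡ f y → x ≡ y

Surjective : ∀ {a b} {A : Set a} {B : Set b} → (A → B) → Set _
Surjective f = ∀ y → ∃ λ x → f x ≡ y

↔-fromBijection : ∀ {A B : Set} (f : A → B) → Injective f → Surjective f → A ↔ B
↔-fromBijection f inj surj =
  mk↔ₛ′ f (proj₁ ∘ surj) (proj₂ ∘ surj) (λ x → inj (proj₂ (surj (f x))))

module Finite {X : Set} {N : ℕ} (X↔Fin : X ↔ Fin N) where

  open Inverse X↔Fin using (to; from)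

  from-to : ∀ x → from (to x) ≡ x
  from-to = Inverse.strictlyInverseʳ X↔Fin

  to-from : ∀ i → to (from i) ≡ i
  to-from = Inverse.strictlyInverseˡ X↔Fin

  to-injective : Injective to
  to-injective eq = trans (sym (from-to _)) (trans (cong from eq) (from-to _))

  from-injective : Injective from
  from-injective eq = trans (sym (to-from _)) (trans (cong to eq) (to-from _))

  infix 4 _≟_
  _≟_ : DecidableEquality X
  _≟_ = Finₚ.inj⇒≟ (↔⇒↣ X↔Fin)

  search : {P : X → Set} → Decidable P → Dec (∃ P)
  search {P} P? with Finₚ.any? (P? ∘ from)
  ... | yes (i , p) = yes (from i , p)
  ... | no none = no λ (x , p) → none (to x , subst P (sym (from-to x)) p)

  record Enumeration (P : X → Set) (n : ℕ) : Set where
    field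
      element   : Fin n → X
      injective : Injective element
      sound     : ∀ i → P (element i)
      complete  : ∀ x → P x → ∃ λ i → element i ≡ x

  enumerate : {P : X → Set} → Decidable P → ∃ (Enumeration P)
  enumerate {P} P? = length xs , record
    { element   = from ∘ List.lookup xs
    ; injective = λ {i} {j} eq → lookup-injective xs unique i j (from-injective eq)
    ; sound     = λ i → proj₂ (∈-filter⁻ (P? ∘ from) {xs = allFin N} (∈-lookup {xs = xs} i))
    ; complete  = λ x p → let x∈xs = ∈-filter⁺ (P? ∘ from) (∈-allFin (to x)) (subst P (sym (from-to x)) p) in
        index x∈xs , trans (cong from (sym (lookup-index x∈xs))) (from-to x)
    }
    where
    xs : List (Fin N)
    xs = filter (P? ∘ from) (allFin N)

    unique : Unique xs
    unique = Uniqueₚ.filter⁺ (P? ∘ from) (Uniqueₚ.allFin⁺ N)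

    lookup-injective : ∀ ys → Unique ys → ∀ i j → List.lookup ys i ≡ List.lookup ys j → i ≡ j
    lookup-injective (y ∷ ys) _         zero    zero    _  = refl
    lookup-injective (y ∷ ys) (y∉ ∷ _)  zero    (suc j) eq = contradiction eq (All.lookup y∉ (∈-lookup j))
    lookup-injective (y ∷ ys) (y∉ ∷ _)  (suc i) zero    eq = contradiction (sym eq) (All.lookup y∉ (∈-lookup i))
    lookup-injective (y ∷ ys) (_ ∷ uys) (suc i) (suc j) eq = cong suc (lookup-injective ys uys i j eq)

  -- This yields the number of non-singular forms once the singular ones are enumerated.
  complement : ∀ {P : X → Set} {m n} → Decidable P →
    Enumeration P m → Enumeration (¬_ ∘ P) n → m ℕ.+ n ≡ N
  complement {P} {m} {n} P? A B =
    ↔⇒≡ (X↔Fin ↔-∘ (↔-fromBijection f f-injective f-surjective ↔-∘ Finₚ.+↔⊎))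
    where
    module A = Enumeration A
    module B = Enumeration B

    f : Fin m ⊎ Fin n → X
    f = Sum.[ A.element , B.element ]

    f-injective : Injective f
    f-injective {inj₁ _} {inj₁ _} eq = cong inj₁ (A.injective eq)
    f-injective {inj₂ _} {inj₂ _} eq = cong inj₂ (B.injective eq)
    f-injective {inj₁ i} {inj₂ j} eq = contradiction (subst P eq (A.sound i)) (B.sound j)
    f-injective {inj₂ i} {inj₁ j} eq = contradiction (subst P (sym eq) (A.sound j)) (B.sound i)

    f-surjective : Surjective f
    f-surjective x with P? x
    ... | yes p = let i , eq = A.complete x p in inj₁ i , eq
    ... | no ¬p = let i , eq = B.complete x ¬p in inj₂ i , eq

  -- Representatives of the two-element orbits of an involution. Fixed points are left aside:
  -- negation has the fixed point 0 in odd characteristic, and x ↦ x + 1 has none.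
  record Halving (f : X → X) (h : ℕ) : Set where
    field
      half      : Fin h → X
      injective : Injective half
      disjoint  : ∀ i j → half i ≢ f (half j)
      cover     : ∀ x → x ≢ f x → ∃ λ i → x ≡ half i ⊎ x ≡ f (half i)

  -- The order borrowed from `Fin N` makes the choice: each orbit contributes the element that is
  -- smaller than its image.
  halve : ∀ f → (∀ x → f (f x) ≡ x) → ∃ (Halving f)
  halve f involutive = h , record
    { half      = element
    ; injective = injective
    ; disjoint  = λ i j eq → ℕₚ.<-asym (sound j)
        (subst₂ Fin._<_ (cong to eq) (cong to (trans (cong f eq) (involutive (element j)))) (sound i))
    ; cover     = λ x x≢fx → case x x≢fx
    }
    where
    h = proj₁ (enumerate λ x → to x Finₚ.<? to (f x))
    open Enumeration (proj₂ (enumerate λ x → to x Finₚ.<? to (f x)))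

    case : ∀ x → x ≢ f x → ∃ λ i → x ≡ element i ⊎ x ≡ f (element i)
    case x x≢fx with Finₚ.<-cmp (to x) (to (f x))
    ... | tri< x<fx _ _ = let i , eq = complete x x<fx in i , inj₁ (sym eq)
    ... | tri≈ _ eq _ = contradiction (to-injective eq) x≢fx
    ... | tri> _ _ fx<x =
      let i , eq = complete (f x) (subst (λ y → to (f x) Fin.< to y) (sym (involutive x)) fx<x) in
      i , inj₂ (trans (sym (involutive x)) (cong f (sym eq)))

-- Pigeonhole principle: a missed value could be punched out, which would leave an injection from
-- `Fin (suc n)` to `Fin n`.
injective⇒surjective : ∀ {A B : Set} {n} → A ↔ Fin n → B ↔ Fin n →
  (f : A → B) → Injective f → Surjective f
injective⇒surjective {n = zero} _ B↔ f inj y = contradiction (Inverse.to B↔ y) Finₚ.¬Fin0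
injective⇒surjective {n = suc n} A↔ B↔ f inj y with Finite.search A↔ (λ x → Finite._≟_ B↔ (f x) y)
... | yes found = found
... | no none = contradiction (Finₚ.injective⇒≤ g-injective) ℕₚ.1+n≰n
  where
  g : Fin (suc n) → Fin (suc n)
  g i = Inverse.to B↔ (f (Inverse.from A↔ i))

  y≢g : ∀ i → Inverse.to B↔ y ≢ g i
  y≢g i eq = none (_ , sym (Finite.to-injective B↔ eq))

  g-injective : Injective λ i → punchOut (y≢g i)
  g-injective {i} {j} eq = Finite.from-injective A↔
    (inj (Finite.to-injective B↔ (Finₚ.punchOut-injective (y≢g i) (y≢g j) eq)))

-- Field arithmetic

module FieldProperties (F : Field) where
  open Field F
  open IntegerCoefficients F

  1≢0 : 1# ≢ 0#
  1≢0 = 0≢1 ∘ sym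

  *-cancelˡ : ∀ {c x y} → c ≢ 0# → c * x ≡ c * y → x ≡ y
  *-cancelˡ {c} {x} {y} c≢0 eq = let d , cd≡1 = inverse c c≢0 in begin
    x            ≡⟨ *-identityˡ x ⟨
    1# * x       ≡⟨ cong (_* x) cd≡1 ⟨
    c * d * x    ≡⟨ equation 3 (λ c d x → c ⊗ d ⊗ x ⊜ d ⊗ (c ⊗ x)) c d x ⟩
    d * (c * x)  ≡⟨ cong (d *_) eq ⟩
    d * (c * y)  ≡⟨ equation 3 (λ c d x → d ⊗ (c ⊗ x) ⊜ c ⊗ d ⊗ x) c d y ⟩
    c * d * y    ≡⟨ cong (_* y) cd≡1 ⟩
    1# * y       ≡⟨ *-identityˡ y ⟩
    y            ∎
    where open ≡-Reasoning

  *-zero-cancelˡ : ∀ {c x} → c ≢ 0# → c * x ≡ 0# → x ≡ 0#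
  *-zero-cancelˡ {c} c≢0 cx≡0 = *-cancelˡ c≢0 (trans cx≡0 (sym (zeroʳ c)))

  *-nonzero : ∀ {x y} → x ≢ 0# → y ≢ 0# → x * y ≢ 0#
  *-nonzero x≢0 y≢0 xy≡0 = y≢0 (*-zero-cancelˡ x≢0 xy≡0)

  x≡y⇒x-y≡0 : ∀ {x y} → x ≡ y → x + - y ≡ 0#
  x≡y⇒x-y≡0 {x} refl = CommutativeRing.-‿inverseʳ commutativeRing x

  x-y≡0⇒x≡y : ∀ {x y} → x + - y ≡ 0# → x ≡ y
  x-y≡0⇒x≡y {x} {y} = x∙y⁻¹≈ε⇒x≈y x y
    where open import Algebra.Properties.Group (CommutativeRing.+-group commutativeRing)

  neg-injective : ∀ {x y} → - x ≡ - y → x ≡ y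
  neg-injective = ⁻¹-injective
    where open import Algebra.Properties.Group (CommutativeRing.+-group commutativeRing)

  double-neg : ∀ x → x ≡ - - x
  double-neg = equation 1 λ x → x ⊜ ⊝ ⊝ x

  *-one : ∀ c → c ≡ c * 1#
  *-one = equation 1 λ c → c ⊜ c ⊗ 𝟙

  scale : ∀ {c d x} → c * d ≡ 1# → x ≡ c * (d * x)
  scale {c} {d} {x} cd≡1 = trans (sym (*-identityˡ x)) (trans (cong (_* x) (sym cd≡1)) (*-assoc c d x))

  -- Deriving one equation from another becomes a polynomial identity for the solver; k is the
  -- cofactor.
  by-multiple : ∀ {a b u v} k → a + - b ≡ k * (u + - v) → u ≡ v → a ≡ b
  by-multiple k eq u≡v = x-y≡0⇒x≡y
    (trans eq (trans (cong (k *_) (x≡y⇒x-y≡0 u≡v)) (zeroʳ k)))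

  -‿nonzero : ∀ {x} → x ≢ 0# → - x ≢ 0#
  -‿nonzero {x} x≢0 -x≡0 = x≢0 (by-multiple (- 1#)
    (equation 1 (λ x → x ⊕ ⊝ 𝟘 ⊜ ⊝ 𝟙 ⊗ (⊝ x ⊕ ⊝ 𝟘)) x) -x≡0)

  module Decidable (_≟_ : DecidableEquality Carrier) where

    zero-product : ∀ {x y} → x * y ≡ 0# → x ≡ 0# ⊎ y ≡ 0#
    zero-product {x} xy≡0 with x ≟ 0#
    ... | yes x≡0 = inj₁ x≡0
    ... | no x≢0  = inj₂ (*-zero-cancelˡ x≢0 xy≡0)

    square-roots : ∀ {x y} → x * x ≡ y * y → x ≡ y ⊎ x ≡ - y
    square-roots {x} {y} eq = Sum.map x-y≡0⇒x≡y
      (λ x+y≡0 → by-multiple 1# (equation 2 (λ x y → x ⊕ ⊝ ⊝ y ⊜ 𝟙 ⊗ (x ⊕ y ⊕ ⊝ 𝟘)) x y) x+y≡0)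
      (zero-product (trans (equation 2 (λ x y → (x ⊕ ⊝ y) ⊗ (x ⊕ y) ⊜ x ⊗ x ⊕ ⊝ (y ⊗ y)) x y)
                           (x≡y⇒x-y≡0 eq)))

-- Squares, and values of x² + x, in a finite field

module FiniteField (F : Field) {q : ℕ} (F↔Fin : HasOrder F q) where
  open Field F
  open FieldProperties F
  open Finite F↔Fin using (_≟_; halve; Halving) public
  open Decidable _≟_ public

  module Odd (2≢0 : ¬ CharTwo F) where
    open IntegerCoefficients F

    abstract
      -- Opaque, so that the enumeration behind the chosen half does not unfold in later goals.
      halving : ∃ (Halving -_)
      halving = halve -_ (equation 1 (λ x → ⊝ ⊝ x ⊜ x))

    h : ℕ
    h = proj₁ halving

    open Halving (proj₂ halving) renaming (half to pos; injective to pos-injective) public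

    x≡-x⇒x≡0 : ∀ {x} → x ≡ - x → x ≡ 0#
    x≡-x⇒x≡0 {x} eq = *-zero-cancelˡ 2≢0
      (by-multiple 1# (equation 1 (λ x → (𝟙 ⊕ 𝟙) ⊗ x ⊕ ⊝ 𝟘 ⊜ 𝟙 ⊗ (x ⊕ ⊝ ⊝ x)) x) eq)

    pos≢0 : ∀ i → pos i ≢ 0#
    pos≢0 i eq = disjoint i i (trans eq (trans (equation 0 (𝟘 ⊜ ⊝ 𝟘)) (cong -_ (sym eq))))

    -- Squaring identifies only equal or opposite elements, and no two of the `pos i` are opposite.
    pos²-injective : Injective λ i → pos i * pos i
    pos²-injective {i} {j} eq with square-roots eq
    ... | inj₁ same = pos-injective same
    ... | inj₂ opp  = contradiction opp (disjoint i j)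

    order : (Fin h ⊎ Fin h ⊎ ⊤) ↔ Carrier
    order = ↔-fromBijection f inj surj
      where
      f : Fin h ⊎ Fin h ⊎ ⊤ → Carrier
      f (inj₁ i)        = pos i
      f (inj₂ (inj₁ i)) = - pos i
      f (inj₂ (inj₂ _)) = 0#

      inj : Injective f
      inj {inj₁ i}        {inj₁ j}        eq = cong inj₁ (pos-injective eq)
      inj {inj₁ i}        {inj₂ (inj₁ j)} eq = contradiction eq (disjoint i j)
      inj {inj₁ i}        {inj₂ (inj₂ _)} eq = contradiction eq (pos≢0 i)
      inj {inj₂ (inj₁ i)} {inj₁ j}        eq = contradiction (sym eq) (disjoint j i)
      inj {inj₂ (inj₁ i)} {inj₂ (inj₁ j)} eq = cong (inj₂ ∘ inj₁) (pos-injective (neg-injective eq))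
      inj {inj₂ (inj₁ i)} {inj₂ (inj₂ _)} eq = contradiction eq (-‿nonzero (pos≢0 i))
      inj {inj₂ (inj₂ _)} {inj₁ j}        eq = contradiction (sym eq) (pos≢0 j)
      inj {inj₂ (inj₂ _)} {inj₂ (inj₁ j)} eq = contradiction (sym eq) (-‿nonzero (pos≢0 j))
      inj {inj₂ (inj₂ _)} {inj₂ (inj₂ _)} eq = refl

      surj : Surjective f
      surj x with x ≟ 0#
      ... | yes x≡0 = inj₂ (inj₂ tt) , sym x≡0
      ... | no x≢0 with cover x (x≢0 ∘ x≡-x⇒x≡0)
      ...   | i , inj₁ eq = inj₁ i , sym eq
      ...   | i , inj₂ eq = inj₂ (inj₁ i) , sym eq

    q≡2h+1 : q ≡ h ℕ.+ (h ℕ.+ 1)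
    q≡2h+1 = sym (↔⇒≡ (F↔Fin ↔-∘ (order ↔-∘
      ((↔-id (Fin h) ⊎-↔ ((↔-id (Fin h) ⊎-↔ Finₚ.1↔⊤) ↔-∘ Finₚ.+↔⊎)) ↔-∘ Finₚ.+↔⊎))))

    module _ {δ} (δ-nonsquare : ∀ x → x * x ≢ δ) where

      δ≢0 : δ ≢ 0#
      δ≢0 δ≡0 = δ-nonsquare 0# (trans (zeroʳ 0#) (sym δ≡0))

      -- pos i ² and δ · pos i ² take 2h = q − 1 distinct nonzero values, hence every one.
      square-classes : ∀ r → r ≢ 0# →
        ∃ λ i → r ≡ pos i * pos i ⊎ r ≡ δ * (pos i * pos i)
      square-classes r r≢0 = classify (injective⇒surjective (F↔Fin ↔-∘ order) F↔Fin f inj r)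
        where
        f : Fin h ⊎ Fin h ⊎ ⊤ → Carrier
        f (inj₁ i)        = pos i * pos i
        f (inj₂ (inj₁ i)) = δ * (pos i * pos i)
        f (inj₂ (inj₂ _)) = 0#

        pos²≢0 : ∀ i → pos i * pos i ≢ 0#
        pos²≢0 i = *-nonzero (pos≢0 i) (pos≢0 i)

        mixed : ∀ i j → pos i * pos i ≢ δ * (pos j * pos j)
        mixed i j eq = let e , je≡1 = inverse (pos j) (pos≢0 j) in
          δ-nonsquare (pos i * e) (begin
            pos i * e * (pos i * e)              ≡⟨ equation 2 (λ p e → p ⊗ e ⊗ (p ⊗ e) ⊜ p ⊗ p ⊗ (e ⊗ e)) (pos i) e ⟩
            pos i * pos i * (e * e)              ≡⟨ cong (_* (e * e)) eq ⟩
            δ * (pos j * pos j) * (e * e)        ≡⟨ equation 3 (λ d p e → d ⊗ (p ⊗ p) ⊗ (e ⊗ e) ⊜ d ⊗ ((p ⊗ e) ⊗ (p ⊗ e))) δ (pos j) e ⟩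
            δ * ((pos j * e) * (pos j * e))      ≡⟨ cong (λ x → δ * (x * x)) je≡1 ⟩
            δ * (1# * 1#)                        ≡⟨ equation 1 (λ d → d ⊗ (𝟙 ⊗ 𝟙) ⊜ d) δ ⟩
            δ                                    ∎)
          where open ≡-Reasoning

        inj : Injective f
        inj {inj₁ i}        {inj₁ j}        eq = cong inj₁ (pos²-injective eq)
        inj {inj₁ i}        {inj₂ (inj₁ j)} eq = contradiction eq (mixed i j)
        inj {inj₁ i}        {inj₂ (inj₂ _)} eq = contradiction eq (pos²≢0 i)
        inj {inj₂ (inj₁ i)} {inj₁ j}        eq = contradiction (sym eq) (mixed j i)
        inj {inj₂ (inj₁ i)} {inj₂ (inj₁ j)} eq = cong (inj₂ ∘ inj₁) (pos²-injective (*-cancelˡ δ≢0 eq))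
        inj {inj₂ (inj₁ i)} {inj₂ (inj₂ _)} eq = contradiction eq (*-nonzero δ≢0 (pos²≢0 i))
        inj {inj₂ (inj₂ _)} {inj₁ j}        eq = contradiction (sym eq) (pos²≢0 j)
        inj {inj₂ (inj₂ _)} {inj₂ (inj₁ j)} eq = contradiction (sym eq) (*-nonzero δ≢0 (pos²≢0 j))
        inj {inj₂ (inj₂ _)} {inj₂ (inj₂ _)} eq = refl

        classify : (∃ λ i → f i ≡ r) → ∃ λ i → r ≡ pos i * pos i ⊎ r ≡ δ * (pos i * pos i)
        classify (inj₁ i , eq)        = i , inj₁ (sym eq)
        classify (inj₂ (inj₁ i) , eq) = i , inj₂ (sym eq)
        classify (inj₂ (inj₂ _) , eq) = contradiction (sym eq) r≢0

  module Even (1+1≡0 : CharTwo F) where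
    open CharacteristicTwo F 1+1≡0

    abstract
      halving : ∃ (Halving (_+ 1#))
      halving = halve (_+ 1#) (equation 1 (λ x → x ⊕ 𝟙 ⊕ 𝟙 ⊜ x))

    h : ℕ
    h = proj₁ halving

    open Halving (proj₂ halving) renaming (injective to half-injective) public

    -- The Artin-Schreier map, additive with kernel `{0, 1}`. Its image plays the part that the
    -- squares play in odd characteristic.
    ℘ : Carrier → Carrier
    ℘ x = x * x + x

    ℘-fibres : ∀ {x y} → ℘ x ≡ ℘ y → x ≡ y ⊎ x ≡ y + 1#
    ℘-fibres {x} {y} eq = Sum.map x-y≡0⇒x≡y x-y≡0⇒x≡y
      (zero-product (trans (equation 2 (λ x y → (x ⊕ ⊝ y) ⊗ (x ⊕ ⊝ (y ⊕ 𝟙)) ⊜ x ⊗ x ⊕ x ⊕ ⊝ (y ⊗ y ⊕ y)) x y)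
                           (x≡y⇒x-y≡0 eq)))

    ℘-half-injective : Injective (℘ ∘ half)
    ℘-half-injective {i} {j} eq with ℘-fibres eq
    ... | inj₁ same = half-injective same
    ... | inj₂ opp  = contradiction opp (disjoint i j)

    order : (Fin h ⊎ Fin h) ↔ Carrier
    order = ↔-fromBijection f inj surj
      where
      f : Fin h ⊎ Fin h → Carrier
      f (inj₁ i) = half i
      f (inj₂ i) = half i + 1#

      inj : Injective f
      inj {inj₁ i} {inj₁ j} eq = cong inj₁ (half-injective eq)
      inj {inj₁ i} {inj₂ j} eq = contradiction eq (disjoint i j)
      inj {inj₂ i} {inj₁ j} eq = contradiction (sym eq) (disjoint j i)
      inj {inj₂ i} {inj₂ j} eq = cong inj₂ (half-injective (by-multiple 1#
        (equation 2 (λ x y → x ⊕ ⊝ y ⊜ 𝟙 ⊗ (x ⊕ 𝟙 ⊕ ⊝ (y ⊕ 𝟙))) (half i) (half j)) eq))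

      surj : Surjective f
      surj x with cover x (λ eq → 1≢0 (by-multiple 1#
        (equation 1 (λ x → 𝟙 ⊕ ⊝ 𝟘 ⊜ 𝟙 ⊗ (x ⊕ ⊝ (x ⊕ 𝟙))) x) eq))
      ... | i , inj₁ eq = inj₁ i , sym eq
      ... | i , inj₂ eq = inj₂ i , sym eq

    q≡2h : q ≡ h ℕ.+ h
    q≡2h = sym (↔⇒≡ (F↔Fin ↔-∘ (order ↔-∘ Finₚ.+↔⊎)))

    -- In characteristic two x² = y² forces x = y, so squaring is injective and hence onto.
    square-root : Surjective λ x → x * x
    square-root = injective⇒surjective F↔Fin F↔Fin (λ x → x * x) λ {x} {y} eq →
      Sum.[ (λ same → same) , (λ opp → trans opp (equation 1 (λ y → ⊝ y ⊜ y) y)) ] (square-roots eq)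

    -- The values `℘ (half i)` and `℘ (half i) + δ` number 2h = q. They are distinct, since by
    -- additivity a coincidence between the two lists would put δ into the image of `℘`, and so they
    -- exhaust the field.
    ℘-classes : ∀ {δ} → (∀ x → ℘ x ≢ δ) →
      ∀ u → ∃ λ i → u ≡ ℘ (half i) ⊎ u ≡ ℘ (half i) + δ
    ℘-classes {δ} δ∉℘ u = classify (injective⇒surjective (F↔Fin ↔-∘ order) F↔Fin f inj u)
      where
      f : Fin h ⊎ Fin h → Carrier
      f (inj₁ i) = ℘ (half i)
      f (inj₂ i) = ℘ (half i) + δ

      mixed : ∀ i j → ℘ (half i) ≢ ℘ (half j) + δ
      mixed i j eq = δ∉℘ (half i + half j) (by-multiple 1#
        (equation 3 (λ x y d → (x ⊕ y) ⊗ (x ⊕ y) ⊕ (x ⊕ y) ⊕ ⊝ d ⊜ 𝟙 ⊗ (x ⊗ x ⊕ x ⊕ ⊝ (y ⊗ y ⊕ y ⊕ d)))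
          (half i) (half j) δ) eq)

      inj : Injective f
      inj {inj₁ i} {inj₁ j} eq = cong inj₁ (℘-half-injective eq)
      inj {inj₁ i} {inj₂ j} eq = contradiction eq (mixed i j)
      inj {inj₂ i} {inj₁ j} eq = contradiction (sym eq) (mixed j i)
      inj {inj₂ i} {inj₂ j} eq = cong inj₂ (℘-half-injective (by-multiple 1#
        (equation 3 (λ x y d → x ⊕ ⊝ y ⊜ 𝟙 ⊗ (x ⊕ d ⊕ ⊝ (y ⊕ d))) (℘ (half i)) (℘ (half j)) δ) eq))

      classify : (∃ λ i → f i ≡ u) → ∃ λ i → u ≡ ℘ (half i) ⊎ u ≡ ℘ (half i) + δ
      classify (inj₁ i , eq) = i , inj₁ (sym eq)
      classify (inj₂ i , eq) = i , inj₂ (sym eq)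

-- Quadratic forms, linear forms and their pullbacks

-- Over an arbitrary raw ring, so as to serve for field elements and for the
-- expressions of the equation solver alike.
module Forms (R : RawRing 0ℓ 0ℓ) where
  open RawRing R

  Mat : Set
  Mat = Fin 3 → Fin 3 → Carrier

  matrix : (a₀₀ a₀₁ a₀₂ a₁₀ a₁₁ a₁₂ a₂₀ a₂₁ a₂₂ : Carrier) → Mat
  matrix a₀₀ a₀₁ a₀₂ a₁₀ a₁₁ a₁₂ a₂₀ a₂₁ a₂₂ = λ
    { 0F 0F → a₀₀ ; 0F 1F → a₀₁ ; 0F 2F → a₀₂
    ; 1F 0F → a₁₀ ; 1F 1F → a₁₁ ; 1F 2F → a₁₂
    ; 2F 0F → a₂₀ ; 2F 1F → a₂₁ ; 2F 2F → a₂₂ }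

  column : Mat → Fin 3 → Vec Carrier 3
  column A j = A 0F j ∷ A 1F j ∷ A 2F j ∷ []

  row : Mat → Fin 3 → Vec Carrier 3
  row A i = A i 0F ∷ A i 1F ∷ A i 2F ∷ []

  infixl 6 _+ᵥ_
  _+ᵥ_ : ∀ {n} → Vec Carrier n → Vec Carrier n → Vec Carrier n
  _+ᵥ_ = zipWith _+_

  infixr 7 _·ᵥ_
  _·ᵥ_ : ∀ {n} → Carrier → Vec Carrier n → Vec Carrier n
  c ·ᵥ v = map (c *_) v

  dot : Vec Carrier 3 → Vec Carrier 3 → Carrier
  dot (l₀ ∷ l₁ ∷ l₂ ∷ []) (x₀ ∷ x₁ ∷ x₂ ∷ []) = l₀ * x₀ + l₁ * x₁ + l₂ * x₂

  apply : Mat → Vec Carrier 3 → Vec Carrier 3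
  apply A x = dot (row A 0F) x ∷ dot (row A 1F) x ∷ dot (row A 2F) x ∷ []

  quadratic : Vec Carrier 6 → Vec Carrier 3 → Carrier
  quadratic (a₀₀ ∷ a₀₁ ∷ a₀₂ ∷ a₁₁ ∷ a₁₂ ∷ a₂₂ ∷ []) (x₀ ∷ x₁ ∷ x₂ ∷ []) =
    a₀₀ * (x₀ * x₀) + a₀₁ * (x₀ * x₁) + a₀₂ * (x₀ * x₂)
      + a₁₁ * (x₁ * x₁) + a₁₂ * (x₁ * x₂) + a₂₂ * (x₂ * x₂)

  polar : Vec Carrier 6 → Vec Carrier 3 → Vec Carrier 3 → Carrier
  polar a x y = quadratic a (x +ᵥ y) + - quadratic a x + - quadratic a y

  -- A quadratic form is determined in every characteristic by its values and its polarization on a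
  -- basis. Pullbacks written this way can be composed by evaluating at points.
  coefficients : (Vec Carrier 3 → Carrier) → (Vec Carrier 3 → Vec Carrier 3 → Carrier) →
    (Fin 3 → Vec Carrier 3) → Vec Carrier 6
  coefficients Q B e = Q (e 0F) ∷ B (e 0F) (e 1F) ∷ B (e 0F) (e 2F)
    ∷ Q (e 1F) ∷ B (e 1F) (e 2F) ∷ Q (e 2F) ∷ []

  pullback : Mat → Vec Carrier 6 → Vec Carrier 6
  pullback A a = coefficients (quadratic a) (polar a) (column A)

  pullbackₗ : Mat → Vec Carrier 3 → Vec Carrier 3
  pullbackₗ A l = dot l (column A 0F) ∷ dot l (column A 1F) ∷ dot l (column A 2F) ∷ []

  product : Vec Carrier 3 → Vec Carrier 3 → Vec Carrier 6
  product (l₀ ∷ l₁ ∷ l₂ ∷ []) (m₀ ∷ m₁ ∷ m₂ ∷ []) =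
      l₀ * m₀ ∷ l₀ * m₁ + l₁ * m₀ ∷ l₀ * m₂ + l₂ * m₀
    ∷ l₁ * m₁ ∷ l₁ * m₂ + l₂ * m₁ ∷ l₂ * m₂ ∷ []

  discriminant : Vec Carrier 6 → Carrier
  discriminant (a₀₀ ∷ a₀₁ ∷ a₀₂ ∷ a₁₁ ∷ a₁₂ ∷ a₂₂ ∷ []) =
    (1# + 1# + 1# + 1#) * a₀₀ * a₁₁ * a₂₂ + a₀₁ * a₀₂ * a₁₂
      + - (a₀₀ * a₁₂ * a₁₂) + - (a₁₁ * a₀₂ * a₀₂) + - (a₂₂ * a₀₁ * a₀₁)

  determinant : Mat → Carrier
  determinant A =
      A 0F 0F * (A 1F 1F * A 2F 2F + - (A 1F 2F * A 2F 1F))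
    + A 0F 1F * (A 1F 2F * A 2F 0F + - (A 1F 0F * A 2F 2F))
    + A 0F 2F * (A 1F 0F * A 2F 1F + - (A 1F 1F * A 2F 0F))

  -- The hyperplanes through the representative of the orbit correspond to the forms
  -- a X₀² + b X₀X₂ + c (X₁² + X₂²) + d X₁X₂.
  solid : Vec Carrier 4 → Vec Carrier 6
  solid (a ∷ b ∷ c ∷ d ∷ []) = a ∷ 0# ∷ b ∷ c ∷ d ∷ c ∷ []

  pairing : Vec Carrier 6 → Vec Carrier 6 → Carrier
  pairing (a₀₀ ∷ a₀₁ ∷ a₀₂ ∷ a₁₁ ∷ a₁₂ ∷ a₂₂ ∷ []) (y₀ ∷ y₁ ∷ y₂ ∷ y₃ ∷ y₄ ∷ y₅ ∷ []) =
    a₀₀ * y₀ + a₀₁ * y₁ + a₀₂ * y₂ + a₁₁ * y₃ + a₁₂ * y₄ + a₂₂ * y₅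

  congruence : Mat → Vec Carrier 6 → Vec Carrier 6
  congruence A y = M 0F 0F ∷ M 0F 1F ∷ M 0F 2F ∷ M 1F 1F ∷ M 1F 2F ∷ M 2F 2F ∷ []
    where
    times : Mat → Mat → Mat
    times A B i j = A i 0F * B 0F j + A i 1F * B 1F j + A i 2F * B 2F j

    symmetric : Vec Carrier 6 → Mat
    symmetric (y₀ ∷ y₁ ∷ y₂ ∷ y₃ ∷ y₄ ∷ y₅ ∷ []) = matrix y₀ y₁ y₂ y₁ y₃ y₄ y₂ y₄ y₅

    M : Mat
    M = times (times A (symmetric y)) (λ i j → A j i)

  cross : Vec Carrier 3 → Vec Carrier 3 → Vec Carrier 3
  cross (l₀ ∷ l₁ ∷ l₂ ∷ []) (m₀ ∷ m₁ ∷ m₂ ∷ []) =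
    l₁ * m₂ + - (l₂ * m₁) ∷ l₂ * m₀ + - (l₀ * m₂) ∷ l₀ * m₁ + - (l₁ * m₀) ∷ []

  -- The quadratic form x ↦ a (n × x).
  crossPullback : Vec Carrier 3 → Vec Carrier 6 → Vec Carrier 6
  crossPullback (n₀ ∷ n₁ ∷ n₂ ∷ []) = pullback λ
    { 0F 0F → 0#   ; 0F 1F → - n₂ ; 0F 2F → n₁
    ; 1F 0F → n₂   ; 1F 1F → 0#   ; 1F 2F → - n₀
    ; 2F 0F → - n₁ ; 2F 1F → n₀   ; 2F 2F → 0#   }

module FormProperties (F : Field) where
  open Field F
  open FieldProperties F
  open Projective F renaming (_⊗_ to infixl 7 _⊠_)
  open IntegerCoefficients F
  open Forms rawRing public hiding (product)
  private module X {n} = Forms (exprRing n)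

  0ᵥ : ∀ {n} → Vec Carrier n
  0ᵥ = replicate _ 0#

  ·-zeroᵥ : ∀ {n} c → c · 0ᵥ {n} ≡ 0ᵥ
  ·-zeroᵥ {zero} c = refl
  ·-zeroᵥ {suc n} c = cong₂ _∷_ (zeroʳ c) (·-zeroᵥ c)

  ∼-nonzero : ∀ {n} {u v : Vec Carrier n} → u ∼ v → u ≢ 0ᵥ → v ≢ 0ᵥ
  ∼-nonzero (c , _ , refl) u≢0 refl = u≢0 (·-zeroᵥ c)

  product-comm : ∀ l m → formProduct l m ≡ formProduct m l
  product-comm (l₀ ∷ l₁ ∷ l₂ ∷ []) (m₀ ∷ m₁ ∷ m₂ ∷ []) =
    equations 6 (λ l₀ l₁ l₂ m₀ m₁ m₂ → let l = l₀ ∷ l₁ ∷ l₂ ∷ [] ; m = m₀ ∷ m₁ ∷ m₂ ∷ [] in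
      X.product l m ⊜ X.product m l) l₀ l₁ l₂ m₀ m₁ m₂

  product-·ˡ : ∀ c l m → formProduct (c · l) m ≡ c · formProduct l m
  product-·ˡ c (l₀ ∷ l₁ ∷ l₂ ∷ []) (m₀ ∷ m₁ ∷ m₂ ∷ []) =
    equations 7 (λ c l₀ l₁ l₂ m₀ m₁ m₂ → let l = l₀ ∷ l₁ ∷ l₂ ∷ [] ; m = m₀ ∷ m₁ ∷ m₂ ∷ [] in
      X.product (c X.·ᵥ l) m ⊜ c X.·ᵥ X.product l m) c l₀ l₁ l₂ m₀ m₁ m₂

  discriminant-product : ∀ l m → discriminant (formProduct l m) ≡ 0#
  discriminant-product (l₀ ∷ l₁ ∷ l₂ ∷ []) (m₀ ∷ m₁ ∷ m₂ ∷ []) =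
    equation 6 (λ l₀ l₁ l₂ m₀ m₁ m₂ → let l = l₀ ∷ l₁ ∷ l₂ ∷ [] ; m = m₀ ∷ m₁ ∷ m₂ ∷ [] in
      X.discriminant (X.product l m) ⊜ 𝟘) l₀ l₁ l₂ m₀ m₁ m₂

  discriminant-· : ∀ c a → discriminant (c · a) ≡ c * c * c * discriminant a
  discriminant-· c (a ∷ b ∷ d ∷ e ∷ f ∷ g ∷ []) =
    equation 7 (λ c a b d e f g → let v = a ∷ b ∷ d ∷ e ∷ f ∷ g ∷ [] in
      X.discriminant (c X.·ᵥ v) ⊜ c ⊗ c ⊗ c ⊗ X.discriminant v) c a b d e f g

  quadratic-pullback : ∀ A a x → quadratic (pullback A a) x ≡ quadratic a (apply A x)
  quadratic-pullback A (a ∷ b ∷ d ∷ e ∷ f ∷ g ∷ []) (x₀ ∷ x₁ ∷ x₂ ∷ []) =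
    equation 18 (λ a b d e f g x₀ x₁ x₂ a₀₀ a₀₁ a₀₂ a₁₀ a₁₁ a₁₂ a₂₀ a₂₁ a₂₂ →
      let v = a ∷ b ∷ d ∷ e ∷ f ∷ g ∷ []
          x = x₀ ∷ x₁ ∷ x₂ ∷ []
          A = X.matrix a₀₀ a₀₁ a₀₂ a₁₀ a₁₁ a₁₂ a₂₀ a₂₁ a₂₂
      in X.quadratic (X.pullback A v) x ⊜ X.quadratic v (X.apply A x))
      a b d e f g x₀ x₁ x₂ (A 0F 0F) (A 0F 1F) (A 0F 2F) (A 1F 0F) (A 1F 1F) (A 1F 2F) (A 2F 0F) (A 2F 1F) (A 2F 2F)

  discriminant-pullback : ∀ A a →
    discriminant (pullback A a) ≡ determinant A * determinant A * discriminant a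
  discriminant-pullback A (a ∷ b ∷ d ∷ e ∷ f ∷ g ∷ []) =
    equation 15 (λ a b d e f g a₀₀ a₀₁ a₀₂ a₁₀ a₁₁ a₁₂ a₂₀ a₂₁ a₂₂ →
      let v = a ∷ b ∷ d ∷ e ∷ f ∷ g ∷ []
          A = X.matrix a₀₀ a₀₁ a₀₂ a₁₀ a₁₁ a₁₂ a₂₀ a₂₁ a₂₂
      in X.discriminant (X.pullback A v) ⊜ X.determinant A ⊗ X.determinant A ⊗ X.discriminant v)
      a b d e f g (A 0F 0F) (A 0F 1F) (A 0F 2F) (A 1F 0F) (A 1F 1F) (A 1F 2F) (A 2F 0F) (A 2F 1F) (A 2F 2F)

  pullback-product : ∀ A l m →
    pullback A (formProduct l m) ≡ formProduct (pullbackₗ A l) (pullbackₗ A m)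
  pullback-product A (l₀ ∷ l₁ ∷ l₂ ∷ []) (m₀ ∷ m₁ ∷ m₂ ∷ []) =
    equations 15 (λ l₀ l₁ l₂ m₀ m₁ m₂ a₀₀ a₀₁ a₀₂ a₁₀ a₁₁ a₁₂ a₂₀ a₂₁ a₂₂ →
      let l = l₀ ∷ l₁ ∷ l₂ ∷ [] ; m = m₀ ∷ m₁ ∷ m₂ ∷ []
          A = X.matrix a₀₀ a₀₁ a₀₂ a₁₀ a₁₁ a₁₂ a₂₀ a₂₁ a₂₂
      in X.pullback A (X.product l m) ⊜ X.product (X.pullbackₗ A l) (X.pullbackₗ A m))
      l₀ l₁ l₂ m₀ m₁ m₂ (A 0F 0F) (A 0F 1F) (A 0F 2F) (A 1F 0F) (A 1F 1F) (A 1F 2F) (A 2F 0F) (A 2F 1F) (A 2F 2F)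

  pairing-· : ∀ a c y → pairing a (c · y) ≡ c * pairing a y
  pairing-· (a ∷ b ∷ d ∷ e ∷ f ∷ g ∷ []) c (y₀ ∷ y₁ ∷ y₂ ∷ y₃ ∷ y₄ ∷ y₅ ∷ []) =
    equation 13 (λ a b d e f g c y₀ y₁ y₂ y₃ y₄ y₅ →
      let v = a ∷ b ∷ d ∷ e ∷ f ∷ g ∷ [] ; y = y₀ ∷ y₁ ∷ y₂ ∷ y₃ ∷ y₄ ∷ y₅ ∷ []
      in X.pairing v (c X.·ᵥ y) ⊜ c ⊗ X.pairing v y)
      a b d e f g c y₀ y₁ y₂ y₃ y₄ y₅

  -- This adjunction between the action on points and the pullback of forms is what replaces an
  -- arbitrary line of the orbit by its representative.
  pairing-congruence : ∀ A a y → pairing a (congruence A y) ≡ pairing (pullback A a) y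
  pairing-congruence A (a ∷ b ∷ d ∷ e ∷ f ∷ g ∷ []) (y₀ ∷ y₁ ∷ y₂ ∷ y₃ ∷ y₄ ∷ y₅ ∷ []) =
    equation 21 (λ a b d e f g y₀ y₁ y₂ y₃ y₄ y₅ a₀₀ a₀₁ a₀₂ a₁₀ a₁₁ a₁₂ a₂₀ a₂₁ a₂₂ →
      let v = a ∷ b ∷ d ∷ e ∷ f ∷ g ∷ [] ; y = y₀ ∷ y₁ ∷ y₂ ∷ y₃ ∷ y₄ ∷ y₅ ∷ []
          A = X.matrix a₀₀ a₀₁ a₀₂ a₁₀ a₁₁ a₁₂ a₂₀ a₂₁ a₂₂
      in X.pairing v (X.congruence A y) ⊜ X.pairing (X.pullback A v) y)
      a b d e f g y₀ y₁ y₂ y₃ y₄ y₅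
      (A 0F 0F) (A 0F 1F) (A 0F 2F) (A 1F 0F) (A 1F 1F) (A 1F 2F) (A 2F 0F) (A 2F 1F) (A 2F 2F)

  pullback-· : ∀ A c a → pullback A (c · a) ≡ c · pullback A a
  pullback-· A c (a ∷ b ∷ d ∷ e ∷ f ∷ g ∷ []) =
    equations 16 (λ a b d e f g c a₀₀ a₀₁ a₀₂ a₁₀ a₁₁ a₁₂ a₂₀ a₂₁ a₂₂ →
      let v = a ∷ b ∷ d ∷ e ∷ f ∷ g ∷ []
          A = X.matrix a₀₀ a₀₁ a₀₂ a₁₀ a₁₁ a₁₂ a₂₀ a₂₁ a₂₂
      in X.pullback A (c X.·ᵥ v) ⊜ c X.·ᵥ X.pullback A v)
      a b d e f g c (A 0F 0F) (A 0F 1F) (A 0F 2F) (A 1F 0F) (A 1F 1F) (A 1F 2F) (A 2F 0F) (A 2F 1F) (A 2F 2F)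

  pullbackₗ-· : ∀ A c l → pullbackₗ A (c · l) ≡ c · pullbackₗ A l
  pullbackₗ-· A c (l₀ ∷ l₁ ∷ l₂ ∷ []) =
    equations 13 (λ l₀ l₁ l₂ c a₀₀ a₀₁ a₀₂ a₁₀ a₁₁ a₁₂ a₂₀ a₂₁ a₂₂ →
      let l = l₀ ∷ l₁ ∷ l₂ ∷ []
          A = X.matrix a₀₀ a₀₁ a₀₂ a₁₀ a₁₁ a₁₂ a₂₀ a₂₁ a₂₂
      in X.pullbackₗ A (c X.·ᵥ l) ⊜ c X.·ᵥ X.pullbackₗ A l)
      l₀ l₁ l₂ c (A 0F 0F) (A 0F 1F) (A 0F 2F) (A 1F 0F) (A 1F 1F) (A 1F 2F) (A 2F 0F) (A 2F 1F) (A 2F 2F)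

  apply-+ : ∀ A x y → apply A (x +ᵥ y) ≡ apply A x +ᵥ apply A y
  apply-+ A (x₀ ∷ x₁ ∷ x₂ ∷ []) (y₀ ∷ y₁ ∷ y₂ ∷ []) =
    equations 15 (λ x₀ x₁ x₂ y₀ y₁ y₂ a₀₀ a₀₁ a₀₂ a₁₀ a₁₁ a₁₂ a₂₀ a₂₁ a₂₂ →
      let x = x₀ ∷ x₁ ∷ x₂ ∷ [] ; y = y₀ ∷ y₁ ∷ y₂ ∷ []
          A = X.matrix a₀₀ a₀₁ a₀₂ a₁₀ a₁₁ a₁₂ a₂₀ a₂₁ a₂₂
      in X.apply A (x X.+ᵥ y) ⊜ X.apply A x X.+ᵥ X.apply A y)
      x₀ x₁ x₂ y₀ y₁ y₂ (A 0F 0F) (A 0F 1F) (A 0F 2F) (A 1F 0F) (A 1F 1F) (A 1F 2F) (A 2F 0F) (A 2F 1F) (A 2F 2F)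

  dot-pullbackₗ : ∀ A l x → dot (pullbackₗ A l) x ≡ dot l (apply A x)
  dot-pullbackₗ A (x₀ ∷ x₁ ∷ x₂ ∷ []) (y₀ ∷ y₁ ∷ y₂ ∷ []) =
    equation 15 (λ x₀ x₁ x₂ y₀ y₁ y₂ a₀₀ a₀₁ a₀₂ a₁₀ a₁₁ a₁₂ a₂₀ a₂₁ a₂₂ →
      let l = x₀ ∷ x₁ ∷ x₂ ∷ [] ; y = y₀ ∷ y₁ ∷ y₂ ∷ []
          A = X.matrix a₀₀ a₀₁ a₀₂ a₁₀ a₁₁ a₁₂ a₂₀ a₂₁ a₂₂
      in X.dot (X.pullbackₗ A l) y ⊜ X.dot l (X.apply A y))
      x₀ x₁ x₂ y₀ y₁ y₂ (A 0F 0F) (A 0F 1F) (A 0F 2F) (A 1F 0F) (A 1F 1F) (A 1F 2F) (A 2F 0F) (A 2F 1F) (A 2F 2F)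

  module _ {A B : Matrix} (AB≡I : ∀ i j → (A ⊠ B) i j ≡ identity i j) where

    apply-column : ∀ j → apply A (column B j) ≡ column identity j
    apply-column j = cong₂ _∷_ (AB≡I 0F j) (cong₂ _∷_ (AB≡I 1F j) (cong (_∷ []) (AB≡I 2F j)))

    -- Since AB = I enters as a hypothesis, this is no polynomial identity. Instead A sends the
    -- columns of B to the standard basis, and a form is recovered from its values and polarization
    -- there.
    pullback-inverse : ∀ a → pullback B (pullback A a) ≡ a
    pullback-inverse a = begin
      pullback B (pullback A a)                                 ≡⟨ step₀ ⟩
      coefficients (quadratic a) (polar a) (λ j → apply A (column B j)) ≡⟨ step₁ ⟩
      coefficients (quadratic a) (polar a) (column identity)    ≡⟨ standard a ⟩
      a                                                         ∎
      where
      open ≡-Reasoning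

      polar-pullback : ∀ x y → polar (pullback A a) x y ≡ polar a (apply A x) (apply A y)
      polar-pullback x y = cong₂ _+_
        (cong₂ (λ s t → s + - t)
          (trans (quadratic-pullback A a (x +ᵥ y)) (cong (quadratic a) (apply-+ A x y)))
          (quadratic-pullback A a x))
        (cong -_ (quadratic-pullback A a y))

      congruent : ∀ {Q Q′ B B′ e e′} → (∀ i → Q (e i) ≡ Q′ (e′ i)) →
        (∀ i j → B (e i) (e j) ≡ B′ (e′ i) (e′ j)) → coefficients Q B e ≡ coefficients Q′ B′ e′
      congruent Q≡ B≡ = cong₂ _∷_ (Q≡ 0F) (cong₂ _∷_ (B≡ 0F 1F) (cong₂ _∷_ (B≡ 0F 2F)
        (cong₂ _∷_ (Q≡ 1F) (cong₂ _∷_ (B≡ 1F 2F) (cong (_∷ []) (Q≡ 2F))))))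

      step₀ = congruent {Q = quadratic (pullback A a)} {quadratic a} {polar (pullback A a)} {polar a}
        {column B} {λ j → apply A (column B j)}
        (λ i → quadratic-pullback A a (column B i)) (λ i j → polar-pullback (column B i) (column B j))

      step₁ = congruent {Q = quadratic a} {quadratic a} {polar a} {polar a} {λ j → apply A (column B j)}
        {column identity}
        (λ i → cong (quadratic a) (apply-column i))
        (λ i j → cong₂ (polar a) (apply-column i) (apply-column j))

      standard : ∀ a → coefficients (quadratic a) (polar a) (column identity) ≡ a
      standard (a ∷ b ∷ d ∷ e ∷ f ∷ g ∷ []) = equations 6 (λ a b d e f g →
        let v = a ∷ b ∷ d ∷ e ∷ f ∷ g ∷ [] in
        X.pullback (X.matrix 𝟙 𝟘 𝟘 𝟘 𝟙 𝟘 𝟘 𝟘 𝟙) v ⊜ v) a b d e f g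

    pullbackₗ-inverse : ∀ l → pullbackₗ B (pullbackₗ A l) ≡ l
    pullbackₗ-inverse l = trans
      (cong₂ _∷_ (component 0F) (cong₂ _∷_ (component 1F) (cong (_∷ []) (component 2F))))
      (standard l)
      where
      component : ∀ j → dot (pullbackₗ A l) (column B j) ≡ dot l (column identity j)
      component j = trans (dot-pullbackₗ A l (column B j)) (cong (dot l) (apply-column j))

      standard : ∀ l → pullbackₗ identity l ≡ l
      standard (l₀ ∷ l₁ ∷ l₂ ∷ []) = equations 3 (λ l₀ l₁ l₂ → let l = l₀ ∷ l₁ ∷ l₂ ∷ [] in
        X.pullbackₗ (X.matrix 𝟙 𝟘 𝟘 𝟘 𝟙 𝟘 𝟘 𝟘 𝟙) l ⊜ l) l₀ l₁ l₂

    pullbackₗ-≁ : ∀ {l m} → ¬ (l ∼ m) → ¬ (pullbackₗ A l ∼ pullbackₗ A m)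
    pullbackₗ-≁ {l} {m} l≁m (c , c≢0 , eq) = l≁m (c , c≢0 , (begin
      l                                  ≡⟨ pullbackₗ-inverse l ⟨
      pullbackₗ B (pullbackₗ A l)        ≡⟨ cong (pullbackₗ B) eq ⟩
      pullbackₗ B (c · pullbackₗ A m)    ≡⟨ pullbackₗ-· B c _ ⟩
      c · pullbackₗ B (pullbackₗ A m)    ≡⟨ cong (c ·_) (pullbackₗ-inverse m) ⟩
      c · m                              ∎))
      where open ≡-Reasoning

  -- Unique factorization of products of linear forms

  cross-∼ : ∀ {l m} → l ∼ m → cross l m ≡ 0ᵥ
  cross-∼ {m = m₀ ∷ m₁ ∷ m₂ ∷ []} (c , _ , refl) = equations 4 (λ c m₀ m₁ m₂ →
    let m = m₀ ∷ m₁ ∷ m₂ ∷ [] in X.cross (c X.·ᵥ m) m ⊜ (𝟘 ∷ 𝟘 ∷ 𝟘 ∷ [])) c m₀ m₁ m₂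

  -- The restriction of l m to the line n = 0 vanishes when n divides l m; in terms of
  -- the parametrization x ↦ n × x of that line, this reads as follows.
  product-cross : ∀ {l m n k} → formProduct l m ≡ formProduct n k → formProduct (cross l n) (cross m n) ≡ 0ᵥ
  product-cross {l} {m} {n} {k} eq = begin
    formProduct (cross l n) (cross m n)  ≡⟨ restrict l m n ⟩
    crossPullback n (formProduct l m)    ≡⟨ cong (crossPullback n) eq ⟩
    crossPullback n (formProduct n k)    ≡⟨ vanish n k ⟩
    0ᵥ                               ∎
    where
    open ≡-Reasoning

    restrict : ∀ l m n → formProduct (cross l n) (cross m n) ≡ crossPullback n (formProduct l m)
    restrict (l₀ ∷ l₁ ∷ l₂ ∷ []) (m₀ ∷ m₁ ∷ m₂ ∷ []) (n₀ ∷ n₁ ∷ n₂ ∷ []) =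
      equations 9 (λ l₀ l₁ l₂ m₀ m₁ m₂ n₀ n₁ n₂ →
        let l = l₀ ∷ l₁ ∷ l₂ ∷ [] ; m = m₀ ∷ m₁ ∷ m₂ ∷ [] ; n = n₀ ∷ n₁ ∷ n₂ ∷ [] in
        X.product (X.cross l n) (X.cross m n) ⊜ X.crossPullback n (X.product l m))
        l₀ l₁ l₂ m₀ m₁ m₂ n₀ n₁ n₂

    vanish : ∀ n k → crossPullback n (formProduct n k) ≡ 0ᵥ
    vanish (m₀ ∷ m₁ ∷ m₂ ∷ []) (n₀ ∷ n₁ ∷ n₂ ∷ []) =
      equations 6 (λ m₀ m₁ m₂ n₀ n₁ n₂ →
        let m = m₀ ∷ m₁ ∷ m₂ ∷ [] ; n = n₀ ∷ n₁ ∷ n₂ ∷ [] in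
        X.crossPullback m (X.product m n) ⊜ (𝟘 ∷ 𝟘 ∷ 𝟘 ∷ 𝟘 ∷ 𝟘 ∷ 𝟘 ∷ []))
        m₀ m₁ m₂ n₀ n₁ n₂

  module Factorization (_≟_ : DecidableEquality Carrier) where
    open Decidable _≟_

    nonzero-entry : ∀ {n} {v : Vec Carrier n} → v ≢ 0ᵥ → ∃ λ i → lookup v i ≢ 0#
    nonzero-entry {v = []} v≢0 = contradiction refl v≢0
    nonzero-entry {v = x ∷ v} v≢0 with x ≟ 0#
    ... | no x≢0 = 0F , x≢0
    ... | yes refl = let i , vᵢ≢0 = nonzero-entry (v≢0 ∘ cong (0# ∷_)) in suc i , vᵢ≢0

    -- If the i-th entry of u is nonzero, the coefficient of the i-th square gives that entry of v
    -- as zero, and then the mixed coefficients with index i give the other two.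
    product-zero : ∀ {u v} → formProduct u v ≡ 0ᵥ → u ≡ 0ᵥ ⊎ v ≡ 0ᵥ
    product-zero {u} {v} eq with ≡-dec _≟_ u 0ᵥ
    ... | yes u≡0 = inj₁ u≡0
    ... | no u≢0 = let i , uᵢ≢0 = nonzero-entry u≢0 in inj₂ (v≡0 u v i uᵢ≢0 λ k → cong (λ w → lookup w k) eq)
      where
      cancel : ∀ {a b x y} → a ≢ 0# → y ≡ 0# → a * x + b * y ≡ 0# → x ≡ 0#
      cancel {a} {b} {x} a≢0 refl eq =
        *-zero-cancelˡ a≢0 (trans (equation 3 (λ a b x → a ⊗ x ⊜ a ⊗ x ⊕ b ⊗ 𝟘) a b x) eq)

      swap : ∀ {a b} → a + b ≡ 0# → b + a ≡ 0#
      swap = trans (CommutativeRing.+-comm commutativeRing _ _)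

      v≡0 : ∀ u v i → lookup u i ≢ 0# → (∀ k → lookup (formProduct u v) k ≡ lookup (0ᵥ {6}) k) → v ≡ 0ᵥ
      v≡0 (u₀ ∷ u₁ ∷ u₂ ∷ []) (v₀ ∷ v₁ ∷ v₂ ∷ []) 0F u₀≢0 eq =
        let v₀≡0 = *-zero-cancelˡ u₀≢0 (eq 0F) in
        cong₂ _∷_ v₀≡0 (cong₂ _∷_ (cancel u₀≢0 v₀≡0 (eq 1F)) (cong (_∷ []) (cancel u₀≢0 v₀≡0 (eq 2F))))
      v≡0 (u₀ ∷ u₁ ∷ u₂ ∷ []) (v₀ ∷ v₁ ∷ v₂ ∷ []) 1F u₁≢0 eq =
        let v₁≡0 = *-zero-cancelˡ u₁≢0 (eq 3F) in
        cong₂ _∷_ (cancel u₁≢0 v₁≡0 (swap (eq 1F))) (cong₂ _∷_ v₁≡0 (cong (_∷ []) (cancel u₁≢0 v₁≡0 (eq 4F))))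
      v≡0 (u₀ ∷ u₁ ∷ u₂ ∷ []) (v₀ ∷ v₁ ∷ v₂ ∷ []) 2F u₂≢0 eq =
        let v₂≡0 = *-zero-cancelˡ u₂≢0 (eq 5F) in
        cong₂ _∷_ (cancel u₂≢0 v₂≡0 (swap (eq 2F))) (cong₂ _∷_ (cancel u₂≢0 v₂≡0 (swap (eq 4F))) (cong (_∷ []) v₂≡0))

    -- All minors vanish, so the ratio of entries at an index where m is nonzero is the ratio at
    -- every index.
    cross-zero : ∀ {l m} → l ≢ 0ᵥ → m ≢ 0ᵥ → cross l m ≡ 0ᵥ → l ∼ m
    cross-zero {l} {m} l≢0 m≢0 eq with nonzero-entry m≢0
    ... | i , mᵢ≢0 = c , c≢0 , l≡cm
      where
      d = proj₁ (inverse (lookup m i) mᵢ≢0)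
      c = lookup l i * d

      minors : ∀ l m → (∀ k → lookup (cross l m) k ≡ lookup (0ᵥ {3}) k) →
        ∀ i j → lookup l i * lookup m j ≡ lookup l j * lookup m i
      minors (l₀ ∷ l₁ ∷ l₂ ∷ []) (m₀ ∷ m₁ ∷ m₂ ∷ []) eq = λ
        { 0F 0F → refl ; 1F 1F → refl ; 2F 2F → refl
        ; 1F 2F → x-y≡0⇒x≡y (eq 0F) ; 2F 1F → sym (x-y≡0⇒x≡y (eq 0F))
        ; 2F 0F → x-y≡0⇒x≡y (eq 1F) ; 0F 2F → sym (x-y≡0⇒x≡y (eq 1F))
        ; 0F 1F → x-y≡0⇒x≡y (eq 2F) ; 1F 0F → sym (x-y≡0⇒x≡y (eq 2F)) }

      entry : ∀ j → lookup l j ≡ lookup (c · m) j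
      entry j = begin
        lookup l j                          ≡⟨ equation 1 (λ x → x ⊜ x ⊗ 𝟙) (lookup l j) ⟩
        lookup l j * 1#                     ≡⟨ cong (lookup l j *_) (proj₂ (inverse (lookup m i) mᵢ≢0)) ⟨
        lookup l j * (lookup m i * d)       ≡⟨ *-assoc _ _ _ ⟨
        lookup l j * lookup m i * d         ≡⟨ cong (_* d) (minors l m (λ k → cong (λ w → lookup w k) eq) i j) ⟨
        lookup l i * lookup m j * d         ≡⟨ equation 3 (λ x y d → x ⊗ y ⊗ d ⊜ x ⊗ d ⊗ y) (lookup l i) (lookup m j) d ⟩
        c * lookup m j                      ≡⟨ lookup-map j (c *_) m ⟨
        lookup (c · m) j                    ∎
        where open ≡-Reasoning

      l≡cm : l ≡ c · m
      l≡cm = trans (sym (tabulate∘lookup l)) (trans (tabulate-cong entry) (tabulate∘lookup (c · m)))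

      c≢0 : c ≢ 0#
      c≢0 c≡0 = l≢0 (trans l≡cm (trans (cong (_· m) c≡0) (zero-· m)))
        where
        zero-· : ∀ {n} (v : Vec Carrier n) → 0# · v ≡ 0ᵥ
        zero-· []      = refl
        zero-· (x ∷ v) = cong₂ _∷_ (zeroˡ x) (zero-· v)

    -- Linear forms are prime: by `product-cross` the product of `cross l n` and `cross m n` is
    -- zero, so one of the two vanishes.
    factor : ∀ {l m n k} → l ≢ 0ᵥ → m ≢ 0ᵥ → n ≢ 0ᵥ → formProduct l m ≡ formProduct n k → l ∼ n ⊎ m ∼ n
    factor l≢0 m≢0 n≢0 eq =
      Sum.map (cross-zero l≢0 n≢0) (cross-zero m≢0 n≢0) (product-zero (product-cross eq))

module Splitting (F : Field) (_≟_ : DecidableEquality (Field.Carrier F)) where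
  open Field F
  open Projective F
  open FormProperties F
  open Factorization _≟_

  product≢0⇒≢0 : ∀ {l m} → formProduct l m ≢ 0ᵥ → l ≢ 0ᵥ × m ≢ 0ᵥ
  product≢0⇒≢0 {l} {m} lm≢0 = (λ { refl → lm≢0 (zero-product m) })
    , (λ { refl → lm≢0 (trans (product-comm l 0ᵥ) (zero-product l)) })
    where
    open IntegerCoefficients F
    module X {n} = Forms (exprRing n)

    zero-product : ∀ m → formProduct 0ᵥ m ≡ 0ᵥ
    zero-product (a ∷ b ∷ c ∷ []) = equations 3
      (λ a b c → X.product (𝟘 ∷ 𝟘 ∷ 𝟘 ∷ []) (a ∷ b ∷ c ∷ []) ⊜ (𝟘 ∷ 𝟘 ∷ 𝟘 ∷ 𝟘 ∷ 𝟘 ∷ 𝟘 ∷ [])) a b c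

  common-factor : ∀ {a l m n k} → a ≢ 0ᵥ → a ∼ formProduct l m → a ∼ formProduct n k → l ∼ n ⊎ m ∼ n
  common-factor {a} {l} {m} {n} {k} a≢0 a∼lm a∼nk =
    let l≢0 , m≢0 = product≢0⇒≢0 (∼-nonzero a∼lm a≢0)
        n≢0 , _   = product≢0⇒≢0 (∼-nonzero a∼nk a≢0)
        c , c≢0 , lm≡cnk = ∼-trans {u = formProduct l m} (∼-sym a∼lm) a∼nk
    in Sum.map (λ l∼cn → ∼-trans l∼cn (c , c≢0 , refl)) (λ m∼cn → ∼-trans m∼cn (c , c≢0 , refl))
      -- The scalar between the two products is absorbed into n.
      (factor l≢0 m≢0 (∼-nonzero (∼-sym {u = c · n} {v = n} (c , c≢0 , refl)) n≢0)
        (trans lm≡cnk (sym (product-·ˡ c n k))))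

  -- Both m and n divide the square of l, so each is proportional to l. Used to refute m and n being
  -- non-proportional.
  square≁product : ∀ {a l m n} → a ≢ 0ᵥ → a ∼ formProduct l l → a ∼ formProduct m n → m ∼ n
  square≁product {l = l} {m} {n} a≢0 a∼ll a∼mn = ∼-trans (∼-sym l∼m) l∼n
    where
    l∼m : l ∼ m
    l∼m = Sum.reduce (common-factor a≢0 a∼ll a∼mn)

    l∼n : l ∼ n
    l∼n = Sum.reduce (common-factor a≢0 a∼ll (subst (_ ∼_) (product-comm m n) a∼mn))

-- The classes of hyperplanes: disjointness and invariance

module Classes (F : Field) (E : Extension F)
  (_≟_ : DecidableEquality (Field.Carrier F))
  (_≟ᴱ_ : DecidableEquality (Field.Carrier (Extension.big E)))
  where

  open Field F
  open Extension E
  open OrbitDistribution F E renaming (_⊗_ to infixl 7 _⊠_)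
  open FieldProperties F
  open FormProperties F
  open Splitting F _≟_
  module K where
    open Field big public
    open FieldProperties big public
    open Projective big public renaming (_⊗_ to infixl 7 _⊠_)
    open FormProperties big public
    open Splitting big _≟ᴱ_ public
  module embed = RingMorphisms.IsRingHomomorphism isRingHomomorphism
  private module X {n} = Forms (IntegerCoefficients.exprRing F n)

  embed-nonzero : ∀ {x} → x ≢ 0# → embed x ≢ K.0#
  embed-nonzero {x} x≢0 ex≡0 = let y , xy≡1 = inverse x x≢0 in K.1≢0 (begin
    K.1#                     ≡⟨ embed.1#-homo ⟨
    embed 1#                 ≡⟨ cong embed xy≡1 ⟨
    embed (x * y)            ≡⟨ embed.*-homo x y ⟩
    embed x K.* embed y      ≡⟨ cong (K._* embed y) ex≡0 ⟩
    K.0# K.* embed y         ≡⟨ K.zeroˡ (embed y) ⟩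
    K.0#                     ∎)
    where open ≡-Reasoning

  embed-zero : ∀ {x} → embed x ≡ K.0# → x ≡ 0#
  embed-zero {x} ex≡0 with x ≟ 0#
  ... | yes x≡0 = x≡0
  ... | no x≢0  = contradiction ex≡0 (embed-nonzero x≢0)

  embed-injective : Injective embed
  embed-injective {x} {y} eq = x-y≡0⇒x≡y (embed-zero
    (trans (embed.+-homo x (- y)) (trans (cong (embed x K.+_) (embed.-‿homo y)) (K.x≡y⇒x-y≡0 eq))))

  embedᵥ : ∀ {n} → Vec Carrier n → Vec K.Carrier n
  embedᵥ = map embed

  embedᵥ-nonzero : ∀ {n} {v : Vec Carrier n} → v ≢ 0ᵥ → embedᵥ v ≢ K.0ᵥ
  embedᵥ-nonzero {v = []} v≢0 _ = v≢0 refl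
  embedᵥ-nonzero {v = x ∷ v} v≢0 eq = embedᵥ-nonzero {v = v}
    (λ v≡0 → v≢0 (cong₂ _∷_ (embed-zero (cong head eq)) v≡0)) (cong tail eq)

  embed-· : ∀ {n} c (v : Vec Carrier n) → embedᵥ (c · v) ≡ embed c K.· embedᵥ v
  embed-· c v = trans (sym (map-∘ embed (c *_) v))
    (trans (map-cong (embed.*-homo c) v) (map-∘ (embed c K.*_) embed v))

  embed-∼ : ∀ {n} {u v : Vec Carrier n} → u ∼ v → embedᵥ u K.∼ embedᵥ v
  embed-∼ {v = v} (c , c≢0 , refl) = embed c , embed-nonzero c≢0 , embed-· c v

  open Naturality F big isRingHomomorphism
  open IntegerCoefficients F using (close)

  embed-product : ∀ l m → embedᵥ (formProduct l m) ≡ K.formProduct (embedᵥ l) (embedᵥ m)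
  embed-product (l₀ ∷ l₁ ∷ l₂ ∷ []) (m₀ ∷ m₁ ∷ m₂ ∷ []) =
    naturalᵥ (close 6 λ l₀ l₁ l₂ m₀ m₁ m₂ → X.product (l₀ ∷ l₁ ∷ l₂ ∷ []) (m₀ ∷ m₁ ∷ m₂ ∷ []))
      (l₀ ∷ l₁ ∷ l₂ ∷ m₀ ∷ m₁ ∷ m₂ ∷ [])

  embed-discriminant : ∀ a → embed (discriminant a) ≡ K.discriminant (embedᵥ a)
  embed-discriminant a@(_ ∷ _ ∷ _ ∷ _ ∷ _ ∷ _ ∷ []) =
    natural (close 6 λ a b c d e f → X.discriminant (a ∷ b ∷ c ∷ d ∷ e ∷ f ∷ [])) a

  embed-pullback : ∀ (A : Matrix) a → embedᵥ (pullback A a) ≡ K.pullback (λ i j → embed (A i j)) (embedᵥ a)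
  embed-pullback A (a ∷ b ∷ c ∷ d ∷ e ∷ f ∷ []) =
    naturalᵥ (close 15 λ a b c d e f a₀₀ a₀₁ a₀₂ a₁₀ a₁₁ a₁₂ a₂₀ a₂₁ a₂₂ →
      X.pullback (X.matrix a₀₀ a₀₁ a₀₂ a₁₀ a₁₁ a₁₂ a₂₀ a₂₁ a₂₂) (a ∷ b ∷ c ∷ d ∷ e ∷ f ∷ []))
      (a ∷ b ∷ c ∷ d ∷ e ∷ f ∷ A 0F 0F ∷ A 0F 1F ∷ A 0F 2F ∷ A 1F 0F ∷ A 1F 1F ∷ A 1F 2F ∷ A 2F 0F ∷ A 2F 1F ∷ A 2F 2F ∷ [])

  -- The entries of A come from the ground field and are fixed by σ, so a substitution over the
  -- ground field keeps conjugate factors conjugate.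
  conjugate-pullbackₗ : ∀ {σ} → IsAutomorphism σ → ∀ (A : Matrix) l →
    map σ (K.pullbackₗ (λ i j → embed (A i j)) l) ≡ K.pullbackₗ (λ i j → embed (A i j)) (map σ l)
  conjugate-pullbackₗ {σ} aut A (l₀ ∷ l₁ ∷ l₂ ∷ []) = trans
    (Naturality.naturalᵥ big big isRingHom
      (close 12 λ l₀ l₁ l₂ a₀₀ a₀₁ a₀₂ a₁₀ a₁₁ a₁₂ a₂₀ a₂₁ a₂₂ →
        X.pullbackₗ (X.matrix a₀₀ a₀₁ a₀₂ a₁₀ a₁₁ a₁₂ a₂₀ a₂₁ a₂₂) (l₀ ∷ l₁ ∷ l₂ ∷ []))
      (l₀ ∷ l₁ ∷ l₂ ∷ e 0F 0F ∷ e 0F 1F ∷ e 0F 2F ∷ e 1F 0F ∷ e 1F 1F ∷ e 1F 2F ∷ e 2F 0F ∷ e 2F 1F ∷ e 2F 2F ∷ []))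
    (cong₂ _∷_ (entry 0F) (cong₂ _∷_ (entry 1F) (cong (_∷ []) (entry 2F))))
    where
    open IsAutomorphism aut
    isRingHom = RingMorphisms.IsRingIsomorphism.isRingHomomorphism isRingIsomorphism
    e : K.Matrix
    e i j = embed (A i j)
    l′ : K.LinearForm
    l′ = map σ (l₀ ∷ l₁ ∷ l₂ ∷ [])

    entry : ∀ j → K.dot l′ (σ (e 0F j) ∷ σ (e 1F j) ∷ σ (e 2F j) ∷ []) ≡ K.dot l′ (e 0F j ∷ e 1F j ∷ e 2F j ∷ [])
    entry j = cong (K.dot l′)
      (cong₂ _∷_ (fixes (A 0F j)) (cong₂ _∷_ (fixes (A 1F j)) (cong (_∷ []) (fixes (A 2F j)))))

  -- Invertibility has to survive the embedding, so that the pullback keeps non-proportional factors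
  -- over the extension non-proportional.
  embed-⊠ : ∀ {A B : Matrix} → (∀ i j → (A ⊠ B) i j ≡ identity i j) →
    ∀ i j → ((λ i j → embed (A i j)) K.⊠ (λ i j → embed (B i j))) i j ≡ K.identity i j
  embed-⊠ {A} {B} AB≡I i j = begin
    embed (A i 0F) K.* embed (B 0F j) K.+ embed (A i 1F) K.* embed (B 1F j)
      K.+ embed (A i 2F) K.* embed (B 2F j)
      ≡⟨ cong₂ K._+_ (cong₂ K._+_ (embed.*-homo _ _) (embed.*-homo _ _)) (embed.*-homo _ _) ⟨
    embed (A i 0F * B 0F j) K.+ embed (A i 1F * B 1F j) K.+ embed (A i 2F * B 2F j)
      ≡⟨ cong (K._+ _) (embed.+-homo _ _) ⟨
    embed (A i 0F * B 0F j + A i 1F * B 1F j) K.+ embed (A i 2F * B 2F j)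
      ≡⟨ embed.+-homo _ _ ⟨
    embed ((A ⊠ B) i j)       ≡⟨ cong embed (AB≡I i j) ⟩
    embed (identity i j)      ≡⟨ embed-identity i j ⟩
    K.identity i j            ∎
    where
    open ≡-Reasoning

    embed-identity : ∀ i j → embed (identity i j) ≡ K.identity i j
    embed-identity = λ
      { 0F 0F → embed.1#-homo ; 0F 1F → embed.0#-homo ; 0F 2F → embed.0#-homo
      ; 1F 0F → embed.0#-homo ; 1F 1F → embed.1#-homo ; 1F 2F → embed.0#-homo
      ; 2F 0F → embed.0#-homo ; 2F 1F → embed.0#-homo ; 2F 2F → embed.1#-homo }

  Singular : Vec Carrier 6 → Set
  Singular a = discriminant a ≡ 0#

  singular-∼ : ∀ {a b} → a ∼ b → Singular b → Singular a
  singular-∼ {b = b} (c , _ , refl) b-sing =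
    trans (discriminant-· c b) (trans (cong (c * c * c *_) b-sing) (zeroʳ _))

  H₃⇒nonsingular : ∀ H → H₃ H → ¬ Singular (proj₁ H)
  H₃⇒nonsingular ((_ ∷ _ ∷ _ ∷ _ ∷ _ ∷ _ ∷ []) , _) H∈H₃ = H∈H₃

  nonsingular⇒H₃ : ∀ H → ¬ Singular (proj₁ H) → H₃ H
  nonsingular⇒H₃ ((_ ∷ _ ∷ _ ∷ _ ∷ _ ∷ _ ∷ []) , _) ns = ns

  H₁⇒singular : ∀ H → H₁ H → Singular (proj₁ H)
  H₁⇒singular _ (l , a∼ll) = singular-∼ a∼ll (discriminant-product l l)

  H₂ᵣ⇒singular : ∀ H → H₂ᵣ H → Singular (proj₁ H)
  H₂ᵣ⇒singular _ (l , m , _ , refl) = discriminant-product l m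

  H₂ᵢ⇒singular : ∀ H → H₂ᵢ H → Singular (proj₁ H)
  H₂ᵢ⇒singular _ (b , a∼b , l , m , _ , _ , eb≡lm) = singular-∼ a∼b (embed-zero (begin
    embed (discriminant b)                 ≡⟨ embed-discriminant b ⟩
    K.discriminant (embedᵥ b)              ≡⟨ cong K.discriminant eb≡lm ⟩
    K.discriminant (K.formProduct l m)         ≡⟨ K.discriminant-product l m ⟩
    K.0#                                   ∎))
    where open ≡-Reasoning

  H₁∩H₂ᵣ≡∅ : ∀ H → H₁ H → ¬ H₂ᵣ H
  H₁∩H₂ᵣ≡∅ (_ , a≢0) (l , a∼ll) (m , n , m≁n , refl) = m≁n (square≁product a≢0 a∼ll ∼-refl)

  H₁∩H₂ᵢ≡∅ : ∀ H → H₁ H → ¬ H₂ᵢ H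
  H₁∩H₂ᵢ≡∅ (a , a≢0) (l , a∼ll) (b , a∼b , m , n , m≁n , _ , eb≡mn) =
    m≁n (K.square≁product (embedᵥ-nonzero a≢0)
      (subst (_ K.∼_) (embed-product l l) (embed-∼ a∼ll))
      (subst (_ K.∼_) eb≡mn (embed-∼ a∼b)))

  -- By unique factorization m would be a multiple of a factor with entries in the ground field.
  -- That factor is fixed by σ, so the conjugate n of m would be a multiple of it too, hence
  -- proportional to m.
  H₂ᵣ∩H₂ᵢ≡∅ : ∀ H → H₂ᵣ H → ¬ H₂ᵢ H
  H₂ᵣ∩H₂ᵢ≡∅ (a , a≢0) (l , l′ , _ , refl) (b , a∼b , m , n , m≁n , (σ , aut , refl) , eb≡mn) =
    Sum.[ refute , refute ] (K.common-factor (embedᵥ-nonzero a≢0)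
      (subst (embedᵥ a K.∼_) (embed-product l l′) K.∼-refl)
      (subst (_ K.∼_) eb≡mn (embed-∼ a∼b)))
    where
    open IsAutomorphism aut
    open RingMorphisms.IsRingIsomorphism isRingIsomorphism using (*-homo; 0#-homo; injective)

    σ-· : ∀ {n} c (v : Vec Carrier n) → map σ (c K.· embedᵥ v) ≡ σ c K.· embedᵥ v
    σ-· c []      = refl
    σ-· c (x ∷ v) = cong₂ _∷_ (trans (*-homo c (embed x)) (cong (σ c K.*_) (fixes x))) (σ-· c v)

    refute : ∀ {l} → ¬ embedᵥ l K.∼ m
    refute {l} l∼m = let c , c≢0 , m≡cl = K.∼-sym l∼m in
      m≁n (K.∼-trans (K.∼-sym l∼m) (K.∼-sym
        (σ c , (λ σc≡0 → c≢0 (injective (trans σc≡0 (sym 0#-homo)))) , trans (cong (map σ) m≡cl) (σ-· c l))))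

  module Invariance {A B : Matrix}
    (AB≡I : ∀ i j → (A ⊠ B) i j ≡ identity i j)
    where

    pullback-∼ : ∀ {a b} → a ∼ b → pullback A a ∼ pullback A b
    pullback-∼ {b = b} (c , c≢0 , refl) = c , c≢0 , pullback-· A c b

    pullback-zero : pullback A 0ᵥ ≡ 0ᵥ
    pullback-zero = equations 9 (λ a₀₀ a₀₁ a₀₂ a₁₀ a₁₁ a₁₂ a₂₀ a₂₁ a₂₂ →
      X.pullback (X.matrix a₀₀ a₀₁ a₀₂ a₁₀ a₁₁ a₁₂ a₂₀ a₂₁ a₂₂) (replicate 6 𝟘) ⊜ replicate 6 𝟘)
      (A 0F 0F) (A 0F 1F) (A 0F 2F) (A 1F 0F) (A 1F 1F) (A 1F 2F) (A 2F 0F) (A 2F 1F) (A 2F 2F)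
      where open IntegerCoefficients F

    singular-pullback : ∀ {a} → Singular a → Singular (pullback A a)
    singular-pullback {a} a-sing = trans (discriminant-pullback A a) (trans (cong (_ *_) a-sing) (zeroʳ _))

    H₁-pullback : ∀ {a a≢0 a′≢0} → H₁ (a , a≢0) → H₁ (pullback A a , a′≢0)
    H₁-pullback {a} (l , a∼ll) = pullbackₗ A l , subst (pullback A a ∼_) (pullback-product A l l) (pullback-∼ a∼ll)

    H₂ᵣ-pullback : ∀ {a a≢0 a′≢0} → H₂ᵣ (a , a≢0) → H₂ᵣ (pullback A a , a′≢0)
    H₂ᵣ-pullback (l , m , l≁m , refl) =
      pullbackₗ A l , pullbackₗ A m , pullbackₗ-≁ {A} {B} AB≡I l≁m , pullback-product A l m

    private
      A′ B′ : K.Matrix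
      A′ i j = embed (A i j)
      B′ i j = embed (B i j)

      A′B′≡I : ∀ i j → (A′ K.⊠ B′) i j ≡ K.identity i j
      A′B′≡I = embed-⊠ {A} {B} AB≡I

      conjugate-≁ : ∀ {l m} → ¬ (l K.∼ m) → ¬ (K.pullbackₗ A′ l K.∼ K.pullbackₗ A′ m)
      conjugate-≁ {l} {m} = K.pullbackₗ-≁ {A′} {B′} A′B′≡I {l} {m}

      embedded : ∀ {b l m} → embedᵥ b ≡ K.formProduct l m →
        embedᵥ (pullback A b) ≡ K.formProduct (K.pullbackₗ A′ l) (K.pullbackₗ A′ m)
      embedded {b} {l} {m} eb≡lm =
        trans (embed-pullback A b) (trans (cong (K.pullback A′) eb≡lm) (K.pullback-product A′ l m))

    H₂ᵢ-pullback : ∀ {a a≢0 a′≢0} → H₂ᵢ (a , a≢0) → H₂ᵢ (pullback A a , a′≢0)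
    H₂ᵢ-pullback (b , a∼b , l , m , l≁m , (σ , aut , m≡σl) , eb≡lm) =
      pullback A b , pullback-∼ a∼b , K.pullbackₗ A′ l , K.pullbackₗ A′ m
      , conjugate-≁ l≁m
      , (σ , aut , trans (cong (K.pullbackₗ A′) m≡σl) (sym (conjugate-pullbackₗ aut A l)))
      , embedded {b} {l} {m} eb≡lm

-- Counting vectors up to proportionality

infixr 1 _⊎-order_
_⊎-order_ : ∀ {A B : Set} {m n} → A ↔ Fin m → B ↔ Fin n → (A ⊎ B) ↔ Fin (m ℕ.+ n)
f ⊎-order g = ↔-sym Finₚ.+↔⊎ ↔-∘ (f ⊎-↔ g)

infixr 2 _×-order_
_×-order_ : ∀ {A B : Set} {m n} → A ↔ Fin m → B ↔ Fin n → (A × B) ↔ Fin (m ℕ.* n)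
f ×-order g = ↔-sym Finₚ.*↔× ↔-∘ (f ×-↔ g)

module Representatives (F : Field) where
  open Field F
  open Projective F

  -- Injectivity and completeness refer to proportionality, so hyperplanes are counted without
  -- forming a quotient or choosing canonical vectors.
  record Represented (S : Pred Hyperplane 0ℓ) (I : Set) : Set where
    field
      rep       : I → Hyperplane
      sound     : ∀ i → S (rep i)
      injective : ∀ {i j} → proj₁ (rep i) ∼ proj₁ (rep j) → i ≡ j
      complete  : ∀ H → S H → ∃ λ i → proj₁ H ∼ proj₁ (rep i)

  count : ∀ {S I n} → Represented S I → I ↔ Fin n → Count S n
  count {S} {I} {n} R I↔Fin = record
    { to        = to
    ; from      = from
    ; to-cong   = λ {H} {H′} → to-cong {H} {H′}
    ; from-cong = λ { refl → ∼-refl }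
    ; inverse   = (λ {i} {H} H∼ → trans (to-cong {H} {from i} H∼) (to-from i))
                , (λ { {H} refl → from-to H })
    }
    where
    open Represented R
    module I = Inverse I↔Fin

    class : ∃ S → I
    class (H , H∈S) = proj₁ (complete H H∈S)

    ∼rep : ∀ H → proj₁ (proj₁ H) ∼ proj₁ (rep (class H))
    ∼rep (H , H∈S) = proj₂ (complete H H∈S)

    to : ∃ S → Fin n
    to H = I.to (class H)

    from : Fin n → ∃ S
    from i = rep (I.from i) , sound (I.from i)

    to-cong : ∀ {H H′} → proj₁ (proj₁ H) ∼ proj₁ (proj₁ H′) → to H ≡ to H′
    to-cong {H} {H′} H∼H′ = cong I.to (injective
      (∼-trans (∼-sym (∼rep H)) (∼-trans H∼H′ (∼rep H′))))

    to-from : ∀ i → to (from i) ≡ i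
    to-from i = trans (cong I.to (injective (∼-sym (∼rep (from i))))) (I.strictlyInverseˡ i)

    from-to : ∀ H → proj₁ (rep (I.from (to H))) ∼ proj₁ (proj₁ H)
    from-to H = subst (λ i → proj₁ (rep i) ∼ proj₁ (proj₁ H)) (sym (I.strictlyInverseʳ (class H)))
      (∼-sym (∼rep H))

module ProjectiveSpace (F : Field) {q} (F↔Fin : HasOrder F q) where
  open Field F
  open FieldProperties F
  open Projective F
  open FormProperties F using (0ᵥ)
  open Finite F↔Fin using (_≟_)

  vectors : ∀ n → Vec Carrier n ↔ Fin (q ^ n)
  vectors zero    = mk↔ₛ′ (λ _ → 0F) (λ _ → []) (λ { 0F → refl ; (suc ()) }) (λ { [] → refl })
  vectors (suc n) = (F↔Fin ×-order vectors n) ↔-∘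
    mk↔ₛ′ (λ { (x ∷ v) → x , v }) (λ (x , v) → x ∷ v) (λ (x , v) → refl) (λ { (x ∷ v) → refl })

  -- The points of projective space, encoded by the position of the first nonzero coordinate, scaled
  -- to 1, and the coordinates after it. The empty base case excludes the zero vector.
  Normal : ℕ → Set
  Normal zero    = ⊥
  Normal (suc n) = Vec Carrier n ⊎ Normal n

  size : ℕ → ℕ
  size zero    = 0
  size (suc n) = q ^ n ℕ.+ size n

  normals : ∀ n → Normal n ↔ Fin (size n)
  normals zero    = mk↔ₛ′ (λ ()) (λ ()) (λ ()) (λ ())
  normals (suc n) = vectors n ⊎-order normals n

  vector : ∀ {n} → Normal n → Vec Carrier n
  vector {suc n} (inj₁ v) = 1# ∷ v
  vector {suc n} (inj₂ p) = 0# ∷ vector p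

  vector≢0 : ∀ {n} (p : Normal n) → vector p ≢ 0ᵥ
  vector≢0 {suc n} (inj₁ v) eq = 1≢0 (cong head eq)
  vector≢0 {suc n} (inj₂ p) eq = vector≢0 p (cong tail eq)

  ·-identity : ∀ {n} (v : Vec Carrier n) → 1# · v ≡ v
  ·-identity []      = refl
  ·-identity (x ∷ v) = cong₂ _∷_ (*-identityˡ x) (·-identity v)

  vector-injective : ∀ {n} {p p′ : Normal n} → vector p ∼ vector p′ → p ≡ p′
  vector-injective {suc n} {inj₁ v} {inj₁ v′} (c , _ , eq) = cong inj₁ (begin
    v       ≡⟨ cong tail eq ⟩
    c · v′  ≡⟨ cong (_· v′) (trans (cong head eq) (sym (*-one c))) ⟨
    1# · v′ ≡⟨ ·-identity v′ ⟩
    v′      ∎)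
    where
    open ≡-Reasoning
  vector-injective {suc n} {inj₁ v} {inj₂ p′} (c , _ , eq) =
    contradiction (trans (cong head eq) (zeroʳ c)) 1≢0
  vector-injective {suc n} {inj₂ p} {inj₁ v′} (c , c≢0 , eq) =
    contradiction (sym (cong head eq)) (*-nonzero c≢0 1≢0)
  vector-injective {suc n} {inj₂ p} {inj₂ p′} (c , c≢0 , eq) =
    cong inj₂ (vector-injective (c , c≢0 , cong tail eq))

  normalize : ∀ {n} (v : Vec Carrier n) → v ≢ 0ᵥ → ∃ λ p → v ∼ vector p
  normalize []      v≢0 = contradiction refl v≢0
  normalize (x ∷ v) v≢0 with x ≟ 0#
  ... | yes refl = let p , c , c≢0 , eq = normalize v (v≢0 ∘ cong (0# ∷_)) in
    inj₂ p , c , c≢0 , cong₂ _∷_ (sym (zeroʳ c)) eq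
  ... | no x≢0 = let y , xy≡1 = inverse x x≢0 in
    inj₁ (y · v) , x , x≢0 , cong₂ _∷_ (*-one x) (begin
      v             ≡⟨ ·-identity v ⟨
      1# · v        ≡⟨ cong (_· v) xy≡1 ⟨
      (x * y) · v   ≡⟨ map-cong (*-assoc x y) v ⟩
      map (λ z → x * (y * z)) v ≡⟨ map-∘ (x *_) (y *_) v ⟩
      x · y · v     ∎)
    where open ≡-Reasoning

-- Hyperplanes through a line of the orbit

module Solid (F : Field) where
  open Field F
  open FieldProperties F
  open Projective F renaming (_⊗_ to infixl 7 _⊠_)
  open FormProperties F

  solid-· : ∀ c w → solid (c · w) ≡ c · solid w
  solid-· c (w ∷ x ∷ y ∷ z ∷ []) = cong (λ o → c * w ∷ o ∷ c * x ∷ c * y ∷ c * z ∷ c * y ∷ []) (sym (zeroʳ c))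

  solid-injective : ∀ {v w} → solid v ≡ solid w → v ≡ w
  solid-injective {_ ∷ _ ∷ _ ∷ _ ∷ []} {_ ∷ _ ∷ _ ∷ _ ∷ []} refl = refl

  solid-nonzero : ∀ {w} → w ≢ 0ᵥ → solid w ≢ 0ᵥ
  solid-nonzero w≢0 = w≢0 ∘ solid-injective

  solid-∼ : ∀ {v w} → v ∼ w → solid v ∼ solid w
  solid-∼ {w = w} (c , c≢0 , refl) = c , c≢0 , solid-· c w

  ∼-solid : ∀ {v w} → solid v ∼ solid w → v ∼ w
  ∼-solid {v} {w} (c , c≢0 , eq) = c , c≢0 , solid-injective (trans eq (sym (solid-· c w)))

  ThroughStandard : Vec Carrier 6 → Set
  ThroughStandard a = ∃ λ w → a ≡ solid w

  pairing-zero : ∀ a → pairing a 0ᵥ ≡ 0#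
  pairing-zero (a ∷ b ∷ c ∷ d ∷ e ∷ f ∷ []) =
    equation 6 (λ a b c d e f → a ⊗ 𝟘 ⊕ b ⊗ 𝟘 ⊕ c ⊗ 𝟘 ⊕ d ⊗ 𝟘 ⊕ e ⊗ 𝟘 ⊕ f ⊗ 𝟘 ⊜ 𝟘) a b c d e f
    where open IntegerCoefficients F

  on⇒pairing : ∀ H R → onHyperplane H R → pairing (proj₁ H) (proj₁ R) ≡ 0#
  on⇒pairing ((_ ∷ _ ∷ _ ∷ _ ∷ _ ∷ _ ∷ []) , _) ((_ ∷ _ ∷ _ ∷ _ ∷ _ ∷ _ ∷ []) , _) on = on

  pairing⇒on : ∀ H R → pairing (proj₁ H) (proj₁ R) ≡ 0# → onHyperplane H R
  pairing⇒on ((_ ∷ _ ∷ _ ∷ _ ∷ _ ∷ _ ∷ []) , _) ((_ ∷ _ ∷ _ ∷ _ ∷ _ ∷ _ ∷ []) , _) on = on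

  image⇒congruence : ∀ A (R Q : Point) c →
    (∀ i j → toMatrix (proj₁ R) i j ≡ c * (A ⊠ toMatrix (proj₁ Q) ⊠ A ᵀ) i j) →
    proj₁ R ≡ c · congruence A (proj₁ Q)
  image⇒congruence A ((_ ∷ _ ∷ _ ∷ _ ∷ _ ∷ _ ∷ []) , _) ((_ ∷ _ ∷ _ ∷ _ ∷ _ ∷ _ ∷ []) , _) c eq =
    cong₂ _∷_ (eq 0F 0F) (cong₂ _∷_ (eq 0F 1F) (cong₂ _∷_ (eq 0F 2F)
      (cong₂ _∷_ (eq 1F 1F) (cong₂ _∷_ (eq 1F 2F) (cong (_∷ []) (eq 2F 2F))))))

  -- `congruence` records only the upper triangle; the entries below the diagonal agree because the
  -- matrix product is again symmetric.
  congruence⇒image : ∀ A (R Q : Point) → proj₁ R ≡ congruence A (proj₁ Q) →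
    ∀ i j → toMatrix (proj₁ R) i j ≡ 1# * (A ⊠ toMatrix (proj₁ Q) ⊠ A ᵀ) i j
  congruence⇒image A (_ , _) (y@(y₀ ∷ y₁ ∷ y₂ ∷ y₃ ∷ y₄ ∷ y₅ ∷ []) , _) refl i j =
    trans (entry i j) (sym (*-identityˡ _))
    where
    open IntegerCoefficients F
    module X {n} = Forms (exprRing n)

    M : Matrix
    M = A ⊠ toMatrix y ⊠ A ᵀ

    symmetric : ∀ i j → M i j ≡ M j i
    symmetric i j = equation 12 (λ y₀ y₁ y₂ y₃ y₄ y₅ a₀ a₁ a₂ b₀ b₁ b₂ →
      let entry = λ a₀ a₁ a₂ b₀ b₁ b₂ →
            (a₀ ⊗ y₀ ⊕ a₁ ⊗ y₁ ⊕ a₂ ⊗ y₂) ⊗ b₀ ⊕ (a₀ ⊗ y₁ ⊕ a₁ ⊗ y₃ ⊕ a₂ ⊗ y₄) ⊗ b₁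
              ⊕ (a₀ ⊗ y₂ ⊕ a₁ ⊗ y₄ ⊕ a₂ ⊗ y₅) ⊗ b₂
      in entry a₀ a₁ a₂ b₀ b₁ b₂ ⊜ entry b₀ b₁ b₂ a₀ a₁ a₂)
      y₀ y₁ y₂ y₃ y₄ y₅ (A i 0F) (A i 1F) (A i 2F) (A j 0F) (A j 1F) (A j 2F)

    entry : ∀ i j → toMatrix (congruence A y) i j ≡ M i j
    entry = λ
      { 0F 0F → refl ; 0F 1F → refl ; 0F 2F → refl
      ; 1F 0F → symmetric 0F 1F ; 1F 1F → refl ; 1F 2F → refl
      ; 2F 0F → symmetric 0F 2F ; 2F 1F → symmetric 1F 2F ; 2F 2F → refl }

  module _ (_≟_ : DecidableEquality Carrier) {L A} (L≐ : Line.points L ≐ image A line₁₃,₁) where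

    -- Two spanning points of the standard line suffice: one forces the coefficient of X₀X₁ to
    -- vanish, the other equates those of X₁² and X₂².
    contains⇒standard : ∀ H → Line.points L ⊆ onHyperplane H → ThroughStandard (pullback A (proj₁ H))
    contains⇒standard H L⊆H = go (pullback A (proj₁ H))
      -- The entry `- 0#` stays unreduced so that membership in the line holds by `∼-refl`.
      (vanishes (0# ∷ 1# ∷ 0# ∷ 0# ∷ 0# ∷ - 0# ∷ []) (λ eq → 1≢0 (cong (head ∘ tail) eq))
        (1# , 0# , (λ (eq , _) → 1≢0 eq) , ∼-refl))
      (vanishes (0# ∷ 0# ∷ 0# ∷ 1# ∷ 0# ∷ - 1# ∷ []) (λ eq → 1≢0 (cong (head ∘ tail ∘ tail ∘ tail) eq))
        (0# , 1# , (λ (_ , eq) → 1≢0 eq) , ∼-refl))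
      where
      open IntegerCoefficients F

      vanishes : ∀ y (y≢0 : y ≢ 0ᵥ) → (y , y≢0) ∈ line₁₃,₁ → pairing (pullback A (proj₁ H)) y ≡ 0#
      vanishes y y≢0 y∈line = trans (sym (pairing-congruence A (proj₁ H) y)) zero-at-image
        where
        zero-at-image : pairing (proj₁ H) (congruence A y) ≡ 0#
        zero-at-image with ≡-dec _≟_ (congruence A y) 0ᵥ
        -- A zero vector is no point, so `L⊆H` says nothing about it, but it pairs to zero anyway.
        ... | yes eq = trans (cong (pairing (proj₁ H)) eq) (pairing-zero (proj₁ H))
        ... | no neq = on⇒pairing H R (L⊆H {R} (proj₂ L≐ {R}
            ((y , y≢0) , y∈line , 1# , 1≢0 , congruence⇒image A R (y , y≢0) refl)))
          where
          R : Point
          R = congruence A y , neq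

      go : ∀ a → pairing a (0# ∷ 1# ∷ 0# ∷ 0# ∷ 0# ∷ - 0# ∷ []) ≡ 0# →
        pairing a (0# ∷ 0# ∷ 0# ∷ 1# ∷ 0# ∷ - 1# ∷ []) ≡ 0# → ThroughStandard a
      go (a ∷ b ∷ c ∷ d ∷ e ∷ f ∷ []) p r = (a ∷ c ∷ d ∷ e ∷ []) ,
        cong₂ (λ b f → a ∷ b ∷ c ∷ d ∷ e ∷ f ∷ [])
          (trans (equation 6 (λ a b c d e f → b ⊜ a ⊗ 𝟘 ⊕ b ⊗ 𝟙 ⊕ c ⊗ 𝟘 ⊕ d ⊗ 𝟘 ⊕ e ⊗ 𝟘 ⊕ f ⊗ ⊝ 𝟘) a b c d e f) p)
          (by-multiple (- 1#) (equation 6 (λ a b c d e f →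
            f ⊕ ⊝ d ⊜ ⊝ 𝟙 ⊗ ((a ⊗ 𝟘 ⊕ b ⊗ 𝟘 ⊕ c ⊗ 𝟘 ⊕ d ⊗ 𝟙 ⊕ e ⊗ 𝟘 ⊕ f ⊗ ⊝ 𝟙) ⊕ ⊝ 𝟘)) a b c d e f) r)

    standard⇒contains : ∀ H → ThroughStandard (pullback A (proj₁ H)) → Line.points L ⊆ onHyperplane H
    standard⇒contains H (w , pb≡) {R} R∈L with proj₁ L≐ {R} R∈L
    ... | Q , (x , y , _ , d , _ , Q≡) , c , _ , R≡ = pairing⇒on H R (begin
      pairing (proj₁ H) (proj₁ R)                           ≡⟨ cong (pairing (proj₁ H)) (image⇒congruence A R Q c R≡) ⟩
      pairing (proj₁ H) (c · congruence A (proj₁ Q))        ≡⟨ pairing-· (proj₁ H) c _ ⟩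
      c * pairing (proj₁ H) (congruence A (proj₁ Q))        ≡⟨ cong (c *_) (pairing-congruence A (proj₁ H) (proj₁ Q)) ⟩
      c * pairing (pullback A (proj₁ H)) (proj₁ Q)          ≡⟨ cong (c *_) (cong₂ pairing pb≡ Q≡) ⟩
      c * pairing (solid w) (d · (0# ∷ x ∷ 0# ∷ y ∷ 0# ∷ - y ∷ [])) ≡⟨ cong (c *_) (orthogonal w) ⟩
      c * 0#                                                ≡⟨ zeroʳ c ⟩
      0#                                                    ∎)
      where
      open ≡-Reasoning
      open IntegerCoefficients F
      orthogonal : ∀ w → pairing (solid w) (d · (0# ∷ x ∷ 0# ∷ y ∷ 0# ∷ - y ∷ [])) ≡ 0#
      orthogonal (a ∷ b ∷ e ∷ f ∷ []) = equation 7 (λ a b e f d x y →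
        let module X = Forms (exprRing _) in
        X.pairing (a ∷ 𝟘 ∷ b ∷ e ∷ f ∷ e ∷ []) (d X.·ᵥ (𝟘 ∷ x ∷ 𝟘 ∷ y ∷ 𝟘 ∷ ⊝ y ∷ [])) ⊜ 𝟘) a b e f d x y

-- From families of normal forms to the distribution

module Distribution {q : ℕ} (F : Field) (F↔Fin : HasOrder F q) (E : Extension F)
  (_≟ᴱ_ : DecidableEquality (Field.Carrier (Extension.big E)))
  where

  open Finite F↔Fin using (_≟_)
  open Field F
  open OrbitDistribution F E renaming (_⊗_ to infixl 7 _⊠_)
  open FieldProperties F
  open FormProperties F
  open Classes F E _≟_ _≟ᴱ_
  open Solid F
  open Representatives F
  open ProjectiveSpace F F↔Fin
  open Represented

  module _ {L : Line} {A B : Matrix}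
    (AB≡I : ∀ i j → (A ⊠ B) i j ≡ identity i j) (BA≡I : ∀ i j → (B ⊠ A) i j ≡ identity i j)
    (L≐ : Line.points L ≐ image A line₁₃,₁) where

    private
      module Pull = Invariance {A} {B} AB≡I
      module Push = Invariance {B} {A} BA≡I

      pullB∘A : ∀ a → pullback B (pullback A a) ≡ a
      pullB∘A = pullback-inverse {A} {B} AB≡I

      pullA∘B : ∀ a → pullback A (pullback B a) ≡ a
      pullA∘B = pullback-inverse {B} {A} BA≡I

      pull : Hyperplane → Hyperplane
      pull (a , a≢0) = pullback A a , λ eq → a≢0
        (trans (sym (pullB∘A a)) (trans (cong (pullback B) eq) Push.pullback-zero))

      push : Hyperplane → Hyperplane
      push (a , a≢0) = pullback B a , λ eq → a≢0
        (trans (sym (pullA∘B a)) (trans (cong (pullback A) eq) Pull.pullback-zero))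

    module _ {S : Pred Hyperplane 0ℓ} {I : Set}
      (pull-S : ∀ H → S H → S (pull H)) (push-S : ∀ H → S H → S (push H))
      (R : Represented (λ H → S H × ThroughStandard (proj₁ H)) I) where

      private
        rep′ : I → Hyperplane
        rep′ i = push (rep R i)

        sound′ : ∀ i → S (rep′ i) × Line.points L ⊆ onHyperplane (rep′ i)
        sound′ i = push-S (rep R i) (proj₁ (sound R i)) , standard⇒contains _≟_ {L} {A} L≐ (rep′ i)
          (subst ThroughStandard (sym (pullA∘B (proj₁ (rep R i)))) (proj₂ (sound R i)))

        injective′ : ∀ {i j} → proj₁ (rep′ i) ∼ proj₁ (rep′ j) → i ≡ j
        injective′ {i} {j} ri∼rj = injective R (subst₂ _∼_ (pullA∘B (proj₁ (rep R i))) (pullA∘B (proj₁ (rep R j)))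
          (Pull.pullback-∼ {pullback B (proj₁ (rep R i))} {pullback B (proj₁ (rep R j))} ri∼rj))

        complete′ : ∀ H → S H × Line.points L ⊆ onHyperplane H → ∃ λ i → proj₁ H ∼ proj₁ (rep′ i)
        complete′ H (H∈S , L⊆H) =
          let i , pullH∼ = complete R (pull H) (pull-S H H∈S , contains⇒standard _≟_ {L} {A} L≐ H L⊆H) in
          i , subst (_∼ proj₁ (rep′ i)) (pullB∘A (proj₁ H))
                (Push.pullback-∼ {pullback A (proj₁ H)} {proj₁ (rep R i)} pullH∼)

      -- The index set is untouched: `pull` and `push` are mutually inverse on coefficient vectors
      -- and preserve both proportionality and the class `S`.
      transfer : Represented (λ H → S H × Line.points L ⊆ onHyperplane H) I
      transfer = record
        { rep = rep′ ; sound = sound′ ; injective = injective′ ; complete = complete′ }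

    transfer₁ : ∀ {I} → Represented (λ H → H₁ H × ThroughStandard (proj₁ H)) I →
      Represented (λ H → H₁ H × Line.points L ⊆ onHyperplane H) I
    transfer₁ = transfer {S = H₁}
      (λ H → Pull.H₁-pullback {proj₁ H} {proj₂ H} {proj₂ (pull H)})
      (λ H → Push.H₁-pullback {proj₁ H} {proj₂ H} {proj₂ (push H)})

    transfer₂ᵣ : ∀ {I} → Represented (λ H → H₂ᵣ H × ThroughStandard (proj₁ H)) I →
      Represented (λ H → H₂ᵣ H × Line.points L ⊆ onHyperplane H) I
    transfer₂ᵣ = transfer {S = H₂ᵣ}
      (λ H → Pull.H₂ᵣ-pullback {proj₁ H} {proj₂ H} {proj₂ (pull H)})
      (λ H → Push.H₂ᵣ-pullback {proj₁ H} {proj₂ H} {proj₂ (push H)})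

    transfer₂ᵢ : ∀ {I} → Represented (λ H → H₂ᵢ H × ThroughStandard (proj₁ H)) I →
      Represented (λ H → H₂ᵢ H × Line.points L ⊆ onHyperplane H) I
    transfer₂ᵢ = transfer {S = H₂ᵢ}
      (λ H → Pull.H₂ᵢ-pullback {proj₁ H} {proj₂ H} {proj₂ (pull H)})
      (λ H → Push.H₂ᵢ-pullback {proj₁ H} {proj₂ H} {proj₂ (push H)})

    transfer₃ : ∀ {I} → Represented (λ H → H₃ H × ThroughStandard (proj₁ H)) I →
      Represented (λ H → H₃ H × Line.points L ⊆ onHyperplane H) I
    transfer₃ = transfer {S = H₃}
      (λ H H∈H₃ → nonsingular⇒H₃ (pull H) λ sing → H₃⇒nonsingular H H∈H₃
        (subst Singular (pullB∘A (proj₁ H)) (Push.singular-pullback {pullback A (proj₁ H)} sing)))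
      (λ H H∈H₃ → nonsingular⇒H₃ (push H) λ sing → H₃⇒nonsingular H H∈H₃
        (subst Singular (pullA∘B (proj₁ H)) (Pull.singular-pullback {pullback B (proj₁ H)} sing)))

  hyperplane : (w : Vec Carrier 4) → w ≢ 0ᵥ → Hyperplane
  hyperplane w w≢0 = solid w , solid-nonzero w≢0

  -- Completeness is absent on purpose: it is supplied for three families at once by a covering of
  -- the singular forms.
  record Family (C : Pred Hyperplane 0ℓ) (I : Set) : Set where
    field
      vec         : I → Vec Carrier 4
      vec≢0       : ∀ i → vec i ≢ 0ᵥ
      member      : ∀ i → C (hyperplane (vec i) (vec≢0 i))
      independent : ∀ {i j} → vec i ∼ vec j → i ≡ j

  module Classification {I₁ I₂ I₃ : Set} (R₁ : Family H₁ I₁) (R₂ : Family H₂ᵣ I₂) (R₃ : Family H₂ᵢ I₃)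
    (cover : ∀ w → w ≢ 0ᵥ → Singular (solid w) → (∃ λ i → w ∼ Family.vec R₁ i)
      ⊎ (∃ λ i → w ∼ Family.vec R₂ i) ⊎ (∃ λ i → w ∼ Family.vec R₃ i)) where

    open Family

    private
      H₁-∼ : ∀ {H H′} → proj₁ H ∼ proj₁ H′ → H₁ H → H₁ H′
      H₁-∼ {a , _} {b , _} a∼b (l , a∼ll) = l , ∼-trans {u = b} {a} (∼-sym {u = a} {b} a∼b) a∼ll

      H₂ᵣ-∼ : ∀ {H H′} → proj₁ H ∼ proj₁ H′ → H₂ᵣ H → H₂ᵣ H′
      H₂ᵣ-∼ {a , _} {b , _} a∼b (l , m , l≁m , a≡lm) with ∼-sym {u = a} {b} a∼b
      ... | c , c≢0 , b≡ca = c · l , m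
        , (λ cl∼m → l≁m (∼-trans {u = l} {c · l} {m} (∼-sym {u = c · l} {l} (c , c≢0 , refl)) cl∼m))
        , trans b≡ca (trans (cong (c ·_) a≡lm) (sym (product-·ˡ c l m)))

      H₂ᵢ-∼ : ∀ {H H′} → proj₁ H ∼ proj₁ H′ → H₂ᵢ H → H₂ᵢ H′
      H₂ᵢ-∼ {a , _} {a′ , _} a∼a′ (b , a∼b , rest) = b , ∼-trans {u = a′} {a} {b} (∼-sym {u = a} {a′} a∼a′) a∼b , rest

      vec-hyperplane : ∀ {C I} → Family C I → I → Hyperplane
      vec-hyperplane R i = hyperplane (vec R i) (vec≢0 R i)

      represented : ∀ {C I} (R : Family C I) →
        (∀ w (a≢0 : solid w ≢ 0ᵥ) → C (solid w , a≢0) → ∃ λ i → w ∼ vec R i) →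
        Represented (λ H → C H × ThroughStandard (proj₁ H)) I
      represented {C} R cov = record
        { rep       = vec-hyperplane R
        ; sound     = λ i → member R i , vec R i , refl
        ; injective = λ {i} {j} r∼ → independent R (∼-solid {vec R i} {vec R j} r∼)
        ; complete  = complete′
        }
        where
        complete′ : ∀ H → C H × ThroughStandard (proj₁ H) → ∃ λ i → proj₁ H ∼ solid (vec R i)
        complete′ (_ , a≢0) (H∈C , w , refl) =
          let i , w∼ = cov w a≢0 H∈C in i , solid-∼ {w} {vec R i} w∼

    -- The covering puts a double line into one of the three families, and disjointness of the
    -- classes leaves only its own. The other two classes are treated alike.
    represented₁ : Represented (λ H → H₁ H × ThroughStandard (proj₁ H)) I₁
    represented₁ = represented R₁ λ w a≢0 H∈ → let H = solid w , a≢0 in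
      Sum.[ id , Sum.[ (λ (i , w∼) → contradiction (member R₂ i)
                         (H₁∩H₂ᵣ≡∅ (vec-hyperplane R₂ i) (H₁-∼ {H} {vec-hyperplane R₂ i} (solid-∼ {w} {vec R₂ i} w∼) H∈)))
                     , (λ (i , w∼) → contradiction (member R₃ i)
                         (H₁∩H₂ᵢ≡∅ (vec-hyperplane R₃ i) (H₁-∼ {H} {vec-hyperplane R₃ i} (solid-∼ {w} {vec R₃ i} w∼) H∈))) ] ]
      (cover w (a≢0 ∘ cong solid) (H₁⇒singular H H∈))

    represented₂ : Represented (λ H → H₂ᵣ H × ThroughStandard (proj₁ H)) I₂
    represented₂ = represented R₂ λ w a≢0 H∈ → let H = solid w , a≢0 in
      Sum.[ (λ (i , w∼) → contradiction (H₂ᵣ-∼ {H} {vec-hyperplane R₁ i} (solid-∼ {w} {vec R₁ i} w∼) H∈)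
              (H₁∩H₂ᵣ≡∅ (vec-hyperplane R₁ i) (member R₁ i)))
          , Sum.[ id
                , (λ (i , w∼) → contradiction (member R₃ i)
                    (H₂ᵣ∩H₂ᵢ≡∅ (vec-hyperplane R₃ i) (H₂ᵣ-∼ {H} {vec-hyperplane R₃ i} (solid-∼ {w} {vec R₃ i} w∼) H∈))) ] ]
      (cover w (a≢0 ∘ cong solid) (H₂ᵣ⇒singular H H∈))

    represented₃ : Represented (λ H → H₂ᵢ H × ThroughStandard (proj₁ H)) I₃
    represented₃ = represented R₃ λ w a≢0 H∈ → let H = solid w , a≢0 in
      Sum.[ (λ (i , w∼) → contradiction (H₂ᵢ-∼ {H} {vec-hyperplane R₁ i} (solid-∼ {w} {vec R₁ i} w∼) H∈)
              (H₁∩H₂ᵢ≡∅ (vec-hyperplane R₁ i) (member R₁ i)))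
          , Sum.[ (λ (i , w∼) → contradiction (H₂ᵢ-∼ {H} {vec-hyperplane R₂ i} (solid-∼ {w} {vec R₂ i} w∼) H∈)
                    (H₂ᵣ∩H₂ᵢ≡∅ (vec-hyperplane R₂ i) (member R₂ i)))
                , id ] ]
      (cover w (a≢0 ∘ cong solid) (H₂ᵢ⇒singular H H∈))

    module _ {n₁ n₂ n₃} (o₁ : I₁ ↔ Fin n₁) (o₂ : I₂ ↔ Fin n₂) (o₃ : I₃ ↔ Fin n₃) where

      private
        module P = Finite (normals 4)

        IsSingular : Normal 4 → Set
        IsSingular p = Singular (solid (vector p))

        singular? : ∀ p → Dec (IsSingular p)
        singular? p = discriminant (solid (vector p)) ≟ 0#

        vec′ : I₁ ⊎ I₂ ⊎ I₃ → Vec Carrier 4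
        vec′ = Sum.[ vec R₁ , Sum.[ vec R₂ , vec R₃ ] ]

        vec′≢0 : ∀ i → vec′ i ≢ 0ᵥ
        vec′≢0 = Sum.[ vec≢0 R₁ , Sum.[ vec≢0 R₂ , vec≢0 R₃ ] ]

        vec′-singular : ∀ i → Singular (solid (vec′ i))
        vec′-singular (inj₁ i)        = H₁⇒singular (vec-hyperplane R₁ i) (member R₁ i)
        vec′-singular (inj₂ (inj₁ i)) = H₂ᵣ⇒singular (vec-hyperplane R₂ i) (member R₂ i)
        vec′-singular (inj₂ (inj₂ i)) = H₂ᵢ⇒singular (vec-hyperplane R₃ i) (member R₃ i)

        vec′-injective : ∀ {i j} → vec′ i ∼ vec′ j → i ≡ j
        vec′-injective {inj₁ i}        {inj₁ j}        v∼ = cong inj₁ (independent R₁ v∼)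
        vec′-injective {inj₂ (inj₁ i)} {inj₂ (inj₁ j)} v∼ = cong (inj₂ ∘ inj₁) (independent R₂ v∼)
        vec′-injective {inj₂ (inj₂ i)} {inj₂ (inj₂ j)} v∼ = cong (inj₂ ∘ inj₂) (independent R₃ v∼)
        vec′-injective {inj₁ i}        {inj₂ (inj₁ j)} v∼ = contradiction (member R₂ j)
          (H₁∩H₂ᵣ≡∅ (vec-hyperplane R₂ j) (H₁-∼ {vec-hyperplane R₁ i} {vec-hyperplane R₂ j} (solid-∼ {vec R₁ i} {vec R₂ j} v∼) (member R₁ i)))
        vec′-injective {inj₁ i}        {inj₂ (inj₂ j)} v∼ = contradiction (member R₃ j)
          (H₁∩H₂ᵢ≡∅ (vec-hyperplane R₃ j) (H₁-∼ {vec-hyperplane R₁ i} {vec-hyperplane R₃ j} (solid-∼ {vec R₁ i} {vec R₃ j} v∼) (member R₁ i)))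
        vec′-injective {inj₂ (inj₁ i)} {inj₂ (inj₂ j)} v∼ = contradiction (member R₃ j)
          (H₂ᵣ∩H₂ᵢ≡∅ (vec-hyperplane R₃ j) (H₂ᵣ-∼ {vec-hyperplane R₂ i} {vec-hyperplane R₃ j} (solid-∼ {vec R₂ i} {vec R₃ j} v∼) (member R₂ i)))
        vec′-injective {inj₂ (inj₁ i)} {inj₁ j}        v∼ = sym (vec′-injective {inj₁ j} {inj₂ (inj₁ i)} (∼-sym {u = vec′ (inj₂ (inj₁ i))} {vec′ (inj₁ j)} v∼))
        vec′-injective {inj₂ (inj₂ i)} {inj₁ j}        v∼ = sym (vec′-injective {inj₁ j} {inj₂ (inj₂ i)} (∼-sym {u = vec′ (inj₂ (inj₂ i))} {vec′ (inj₁ j)} v∼))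
        vec′-injective {inj₂ (inj₂ i)} {inj₂ (inj₁ j)} v∼ = sym (vec′-injective {inj₂ (inj₁ j)} {inj₂ (inj₂ i)} (∼-sym {u = vec′ (inj₂ (inj₂ i))} {vec′ (inj₂ (inj₁ j))} v∼))

        vec′-covers : ∀ w → w ≢ 0ᵥ → Singular (solid w) → ∃ λ i → w ∼ vec′ i
        vec′-covers w w≢0 sing with cover w w≢0 sing
        ... | inj₁ (i , w∼)        = inj₁ i , w∼
        ... | inj₂ (inj₁ (i , w∼)) = inj₂ (inj₁ i) , w∼
        ... | inj₂ (inj₂ (i , w∼)) = inj₂ (inj₂ i) , w∼

        order : (I₁ ⊎ I₂ ⊎ I₃) ↔ Fin (n₁ ℕ.+ (n₂ ℕ.+ n₃))
        order = o₁ ⊎-order o₂ ⊎-order o₃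

        module O = Finite order
        open Inverse order using (to; from)

        normal : I₁ ⊎ I₂ ⊎ I₃ → Normal 4
        normal i = proj₁ (normalize (vec′ i) (vec′≢0 i))

        vec′∼ : ∀ i → vec′ i ∼ vector (normal i)
        vec′∼ i = proj₂ (normalize (vec′ i) (vec′≢0 i))

        ∼vec′ : ∀ i → vector (normal i) ∼ vec′ i
        ∼vec′ i = ∼-sym {u = vec′ i} {vector (normal i)} (vec′∼ i)

        normal-injective : Injective normal
        normal-injective {i} {j} eq = vec′-injective {i} {j}
          (∼-trans {u = vec′ i} {vector (normal i)} {vec′ j} (vec′∼ i)
            (subst (λ p → vector p ∼ vec′ j) (sym eq) (∼vec′ j)))

        -- The normal forms are rescaled to elements of `Normal 4`, where proportional vectors are
        -- equal and a complement can be taken.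
        singulars : P.Enumeration IsSingular (n₁ ℕ.+ (n₂ ℕ.+ n₃))
        singulars = record
          { element   = λ i → normal (from i)
          ; injective = λ {i} {j} eq → O.from-injective (normal-injective {from i} {from j} eq)
          ; sound     = λ i → singular-∼ {solid (vector (normal (from i)))} {solid (vec′ (from i))}
              (solid-∼ {vector (normal (from i))} {vec′ (from i)} (∼vec′ (from i))) (vec′-singular (from i))
          ; complete  = λ p sing → let i , p∼ = vec′-covers (vector p) (vector≢0 p) sing in
              to i , trans (cong normal (O.from-to i)) (sym (vector-injective {4} {p} {normal i}
                (∼-trans {u = vector p} {vec′ i} {vector (normal i)} p∼ (vec′∼ i))))
          }

        nonsingulars : ∃ (P.Enumeration (¬_ ∘ IsSingular))
        nonsingulars = P.enumerate (¬? ∘ singular?)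

        n₄ : ℕ
        n₄ = proj₁ nonsingulars

        open P.Enumeration (proj₂ nonsingulars) renaming
          (element to element₄; injective to injective₄; sound to sound₄; complete to complete₄)

        represented₄ : Represented (λ H → H₃ H × ThroughStandard (proj₁ H)) (Fin n₄)
        represented₄ = record
          { rep       = rep₄
          ; sound     = λ i → nonsingular⇒H₃ (rep₄ i) (sound₄ i) , vector (element₄ i) , refl
          ; injective = λ {i} {j} r∼ → injective₄ (vector-injective {4} {element₄ i} {element₄ j}
              (∼-solid {vector (element₄ i)} {vector (element₄ j)} r∼))
          ; complete  = λ { H@(_ , a≢0) (H∈H₃ , w , refl) →
              let p , w∼p = normalize w (a≢0 ∘ cong solid)
                  i , eq  = complete₄ p (λ sing → H₃⇒nonsingular H H∈H₃ (singular-∼ {solid w} {solid (vector p)} (solid-∼ {w} {vector p} w∼p) sing))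
              in i , solid-∼ {w} {vector (element₄ i)} (subst (λ p → w ∼ vector p) (sym eq) w∼p) }
          }
          where
          rep₄ : Fin n₄ → Hyperplane
          rep₄ i = hyperplane (vector (element₄ i)) (vector≢0 (element₄ i))

        total : n₁ ℕ.+ (n₂ ℕ.+ n₃) ℕ.+ n₄ ≡ size 4
        total = P.complement singular? singulars (proj₂ nonsingulars)

        n₄-formula : n₁ ℕ.+ (n₂ ℕ.+ n₃) ≡ (q ℕ.+ 1) ^ 2 → n₄ ≡ q ^ 3 ∸ q
        n₄-formula eq = begin
          n₄                        ≡⟨ ℕₚ.m+n∸m≡n q n₄ ⟨
          -- Here `size 4` is q³ + q² + q + 1. Cancelling q² + q + 1 against (q + 1)² leaves q + n₄
          -- = q³, so truncated subtraction enters only in the end.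
          q ℕ.+ n₄ ∸ q              ≡⟨ cong (_∸ q) (ℕₚ.+-cancelˡ-≡ (q ℕ.* q ℕ.+ q ℕ.+ 1) (q ℕ.+ n₄) (q ^ 3) (begin
            q ℕ.* q ℕ.+ q ℕ.+ 1 ℕ.+ (q ℕ.+ n₄)
              ≡⟨ solve 2 (λ q n → q :* q :+ q :+ con 1 :+ (q :+ n) := (q :+ con 1) :^ 2 :+ n) refl q n₄ ⟩
            (q ℕ.+ 1) ^ 2 ℕ.+ n₄    ≡⟨ cong (ℕ._+ n₄) eq ⟨
            n₁ ℕ.+ (n₂ ℕ.+ n₃) ℕ.+ n₄ ≡⟨ total ⟩
            size 4                  ≡⟨ solve 1 (λ q → q :^ 3 :+ (q :^ 2 :+ (q :^ 1 :+ (q :^ 0 :+ con 0)))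
                                                   := q :* q :+ q :+ con 1 :+ q :^ 3) refl q ⟩
            q ℕ.* q ℕ.+ q ℕ.+ 1 ℕ.+ q ^ 3 ∎)) ⟩
          q ^ 3 ∸ q                 ∎
          where
          open ≡-Reasoning
          open +-*-Solver

      distribution : n₁ ℕ.+ (n₂ ℕ.+ n₃) ≡ (q ℕ.+ 1) ^ 2 →
        ∀ L → L ∈ o₁₃,₁ → OD₄ L (n₁ ∷ n₂ ∷ n₃ ∷ q ^ 3 ∸ q ∷ [])
      distribution eq L (A , (B , AB≡I , BA≡I) , L≐) =
          count (transfer₁ {L} {A} {B} AB≡I BA≡I L≐ represented₁) o₁
        , count (transfer₂ᵣ {L} {A} {B} AB≡I BA≡I L≐ represented₂) o₂
        , count (transfer₂ᵢ {L} {A} {B} AB≡I BA≡I L≐ represented₃) o₃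
        , subst (Count _) (n₄-formula eq) (count (transfer₃ {L} {A} {B} AB≡I BA≡I L≐ represented₄) ↔-refl)

-- Conjugation in the quadratic extension

module QuadraticExtension {q : ℕ} (F : Field) (F↔Fin : HasOrder F q)
  (E : Extension F) (E↔Fin : HasOrder (Extension.big E) (q ^ 2)) where

  open Extension E
  private
    module F where
      open Field F public
      open FieldProperties F public
      open FiniteField F F↔Fin public
    module FF = Finite F↔Fin
    module EE = Finite E↔Fin
  open Field big
  open FieldProperties big
  open FiniteField big E↔Fin using (_≟_; square-roots)
  open IntegerCoefficients big
  open Classes F E F._≟_ _≟_ using (embed-injective; embed-nonzero; module embed)

  Rational : Carrier → Set
  Rational z = ∃ λ x → embed x ≡ z

  rational? : ∀ z → Dec (Rational z)
  rational? z = FF.search λ x → embed x ≟ z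

  2≤q : 2 ℕ.≤ q
  2≤q = Finₚ.injective⇒≤ {f = Inverse.to F↔Fin ∘ λ { 0F → F.0# ; 1F → F.1# }} λ
    { {0F} {0F} _ → refl ; {1F} {1F} _ → refl
    ; {0F} {1F} eq → contradiction (FF.to-injective eq) F.0≢1
    ; {1F} {0F} eq → contradiction (FF.to-injective eq) F.1≢0 }

  -- Otherwise choosing preimages would inject q² elements into q, contrary to q being at least 2.
  irrational : ∃ λ θ → ¬ Rational θ
  irrational with EE.search (λ z → ¬? (rational? z))
  ... | yes found = found
  ... | no none = contradiction 2≤q (ℕₚ.<⇒≱ (s≤s q≤1))
    where
    preimage : ∀ z → Rational z
    preimage z with rational? z
    ... | yes r = r
    ... | no ¬r = contradiction (z , ¬r) none

    section-injective : Injective (proj₁ ∘ preimage)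
    section-injective {z} {w} eq =
      trans (sym (proj₂ (preimage z))) (trans (cong embed eq) (proj₂ (preimage w)))

    q²≤q : q ^ 2 ℕ.≤ q
    q²≤q = Finₚ.injective⇒≤ {f = Inverse.to F↔Fin ∘ proj₁ ∘ preimage ∘ Inverse.from E↔Fin}
      (EE.from-injective ∘ section-injective ∘ FF.to-injective)

    q≤1 : q ℕ.≤ 1
    q≤1 = ℕₚ.*-cancelˡ-≤ q {{ℕ.>-nonZero (ℕₚ.≤-trans (s≤s z≤n) 2≤q)}}
      (subst₂ ℕ._≤_ (cong (q ℕ.*_) (ℕₚ.*-identityʳ q)) (sym (ℕₚ.*-identityʳ q)) q²≤q)

  module _ (ρ : Carrier) where

    -- Kept general in ρ, because σ replaces θ by the conjugate θ′ and the same computations are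
    -- needed for both.
    form : F.Carrier → F.Carrier → Carrier
    form x y = embed x + embed y * ρ

    form-+ : ∀ x y x′ y′ → form x y + form x′ y′ ≡ form (x F.+ x′) (y F.+ y′)
    form-+ x y x′ y′ = begin
      form x y + form x′ y′
        ≡⟨ equation 5 (λ x y x′ y′ r → x ⊕ y ⊗ r ⊕ (x′ ⊕ y′ ⊗ r) ⊜ x ⊕ x′ ⊕ (y ⊕ y′) ⊗ r)
             (embed x) (embed y) (embed x′) (embed y′) ρ ⟩
      embed x + embed x′ + (embed y + embed y′) * ρ
        ≡⟨ cong₂ (λ u v → u + v * ρ) (embed.+-homo x x′) (embed.+-homo y y′) ⟨
      form (x F.+ x′) (y F.+ y′) ∎
      where open ≡-Reasoning

    -- The coordinates of the product depend on s and t alone, hence are the same for both roots of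
    -- the equation. This makes σ multiplicative.
    form-* : ∀ {s t} → ρ * ρ ≡ embed s + embed t * ρ → ∀ x y x′ y′ → form x y * form x′ y′
      ≡ form (x F.* x′ F.+ s F.* (y F.* y′)) (x F.* y′ F.+ y F.* x′ F.+ t F.* (y F.* y′))
    form-* {s} {t} root x y x′ y′ = begin
      form x y * form x′ y′
        ≡⟨ by-multiple (embed y * embed y′)
             (equation 7 (λ x y x′ y′ s t r → (x ⊕ y ⊗ r) ⊗ (x′ ⊕ y′ ⊗ r)
                ⊕ ⊝ (x ⊗ x′ ⊕ s ⊗ (y ⊗ y′) ⊕ (x ⊗ y′ ⊕ y ⊗ x′ ⊕ t ⊗ (y ⊗ y′)) ⊗ r)
                ⊜ y ⊗ y′ ⊗ (r ⊗ r ⊕ ⊝ (s ⊕ t ⊗ r)))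
               (embed x) (embed y) (embed x′) (embed y′) (embed s) (embed t) ρ) root ⟩
      embed x * embed x′ + embed s * (embed y * embed y′)
        + (embed x * embed y′ + embed y * embed x′ + embed t * (embed y * embed y′)) * ρ
        ≡⟨ cong₂ (λ u v → u + v * ρ)
             (trans (embed.+-homo _ _) (cong₂ _+_ (embed.*-homo x x′) (*-* s y y′)))
             (trans (embed.+-homo _ _) (cong₂ _+_
               (trans (embed.+-homo _ _) (cong₂ _+_ (embed.*-homo x y′) (embed.*-homo y x′)))
               (*-* t y y′))) ⟨
      form (x F.* x′ F.+ s F.* (y F.* y′)) (x F.* y′ F.+ y F.* x′ F.+ t F.* (y F.* y′)) ∎
      where
      open ≡-Reasoning
      *-* : ∀ a b c → embed (a F.* (b F.* c)) ≡ embed a * (embed b * embed c)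
      *-* a b c = trans (embed.*-homo a _) (cong (embed a *_) (embed.*-homo b c))

    form-neg : ∀ x y → - form x y ≡ form (F.- x) (F.- y)
    form-neg x y = trans
      (equation 3 (λ x y r → ⊝ (x ⊕ y ⊗ r) ⊜ ⊝ x ⊕ ⊝ y ⊗ r) (embed x) (embed y) ρ)
      (sym (cong₂ (λ u v → u + v * ρ) (embed.-‿homo x) (embed.-‿homo y)))

    form-rational : ∀ x → form x F.0# ≡ embed x
    form-rational x = trans (cong (λ u → embed x + u * ρ) embed.0#-homo)
      (equation 2 (λ x r → x ⊕ 𝟘 ⊗ r ⊜ x) (embed x) ρ)

    form-root : form F.0# F.1# ≡ ρ
    form-root = trans (cong₂ (λ u v → u + v * ρ) embed.0#-homo embed.1#-homo)
      (equation 1 (λ r → 𝟘 ⊕ 𝟙 ⊗ r ⊜ r) ρ)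

    -- If y and y′ differed, ρ = (x′ - x) / (y - y′) would lie in the ground field.
    form-injective : ¬ Rational ρ → ∀ {x y x′ y′} → form x y ≡ form x′ y′ → x ≡ x′ × y ≡ y′
    form-injective ρ∉F {x} {y} {x′} {y′} eq with y F.≟ y′
    ... | yes refl = embed-injective (by-multiple 1#
          (equation 3 (λ x x′ z → x ⊕ ⊝ x′ ⊜ 𝟙 ⊗ (x ⊕ z ⊕ ⊝ (x′ ⊕ z))) (embed x) (embed x′) (embed y * ρ)) eq)
        , refl
    ... | no y≢y′ = contradiction (d F.* (x′ F.+ F.- x) , rational) ρ∉F
      where
      Δy = y F.+ F.- y′
      inv = F.inverse Δy (y≢y′ ∘ F.x-y≡0⇒x≡y)
      d = proj₁ inv

      embed-minus : ∀ a b → embed (a F.+ F.- b) ≡ embed a + - embed b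
      embed-minus a b = trans (embed.+-homo a _) (cong (embed a +_) (embed.-‿homo b))

      rational : embed (d F.* (x′ F.+ F.- x)) ≡ ρ
      rational = begin
        embed (d F.* (x′ F.+ F.- x))             ≡⟨ embed.*-homo d _ ⟩
        embed d * embed (x′ F.+ F.- x)           ≡⟨ cong (embed d *_) (embed-minus x′ x) ⟩
        embed d * (embed x′ + - embed x)         ≡⟨ by-multiple (- embed d)
          (equation 6 (λ d x y x′ y′ r → d ⊗ (x′ ⊕ ⊝ x) ⊕ ⊝ (d ⊗ (y ⊕ ⊝ y′) ⊗ r)
            ⊜ ⊝ d ⊗ (x ⊕ y ⊗ r ⊕ ⊝ (x′ ⊕ y′ ⊗ r))) (embed d) (embed x) (embed y) (embed x′) (embed y′) ρ) eq ⟩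
        embed d * (embed y + - embed y′) * ρ     ≡⟨ cong (λ u → embed d * u * ρ) (embed-minus y y′) ⟨
        embed d * embed Δy * ρ                   ≡⟨ cong (_* ρ) (embed.*-homo d Δy) ⟨
        embed (d F.* Δy) * ρ                     ≡⟨ cong (λ u → embed u * ρ) (trans (F.*-comm d Δy) (proj₂ inv)) ⟩
        embed F.1# * ρ                           ≡⟨ cong (_* ρ) embed.1#-homo ⟩
        1# * ρ                                   ≡⟨ *-identityˡ ρ ⟩
        ρ                                        ∎
        where open ≡-Reasoning

  -- {1 , θ} is a basis of E over F, and conjugation exchanges the two roots of the
  -- minimal polynomial of θ.
  abstract
    θ : Carrier
    θ = proj₁ irrational

    θ∉F : ¬ Rational θ
    θ∉F = proj₂ irrational

    -- The q² combinations are distinct, so they exhaust a field of q² elements.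
    coordinates : ∀ z → ∃₂ λ x y → embed x + embed y * θ ≡ z
    coordinates z = let (x , y) , eq = surjective z in x , y , eq
      where
      q²≡q*q : q ^ 2 ≡ q ℕ.* q
      q²≡q*q = cong (q ℕ.*_) (ℕₚ.*-identityʳ q)

      combine : F.Carrier × F.Carrier → Carrier
      combine (x , y) = embed x + embed y * θ

      combine-injective : Injective combine
      combine-injective eq = let x≡ , y≡ = form-injective θ θ∉F eq in cong₂ _,_ x≡ y≡

      surjective : Surjective combine
      surjective = injective⇒surjective (F↔Fin ×-order F↔Fin)
        (subst (λ n → Carrier ↔ Fin n) q²≡q*q E↔Fin) combine combine-injective

    s t : F.Carrier
    s = proj₁ (coordinates (θ * θ))
    t = proj₁ (proj₂ (coordinates (θ * θ)))

    θ-root : θ * θ ≡ embed s + embed t * θ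
    θ-root = sym (proj₂ (proj₂ (coordinates (θ * θ))))

  θ′ : Carrier
  θ′ = embed t + - θ

  θ′-root : θ′ * θ′ ≡ embed s + embed t * θ′
  θ′-root = by-multiple 1# (equation 3 (λ s t r →
    (t ⊕ ⊝ r) ⊗ (t ⊕ ⊝ r) ⊕ ⊝ (s ⊕ t ⊗ (t ⊕ ⊝ r)) ⊜ 𝟙 ⊗ (r ⊗ r ⊕ ⊝ (s ⊕ t ⊗ r))) (embed s) (embed t) θ) θ-root

  θ′∉F : ¬ Rational θ′
  θ′∉F (x , eq) = θ∉F (t F.+ F.- x , (begin
    embed (t F.+ F.- x)          ≡⟨ trans (embed.+-homo t _) (cong (embed t +_) (embed.-‿homo x)) ⟩
    embed t + - embed x          ≡⟨ cong (λ u → embed t + - u) eq ⟩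
    embed t + - (embed t + - θ)  ≡⟨ equation 2 (λ t r → t ⊕ ⊝ (t ⊕ ⊝ r) ⊜ r) (embed t) θ ⟩
    θ                            ∎))
    where open ≡-Reasoning

  private
    form₁ form₂ : F.Carrier → F.Carrier → Carrier
    form₁ = form θ
    form₂ = form θ′

  σ : Carrier → Carrier
  σ z = let x , y , _ = coordinates z in form₂ x y

  σ-form : ∀ x y → σ (form₁ x y) ≡ form₂ x y
  σ-form x y = let x′ , y′ , eq = coordinates (form₁ x y)
                   x≡ , y≡ = form-injective θ θ∉F {x′} {y′} {x} {y} eq
               in cong₂ form₂ x≡ y≡

  σ-at : ∀ {z x y} → form₁ x y ≡ z → σ z ≡ form₂ x y
  σ-at refl = σ-form _ _

  σ-embed : ∀ x → σ (embed x) ≡ embed x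
  σ-embed x = trans (σ-at {x = x} {F.0#} (form-rational θ x)) (form-rational θ′ x)

  σ-θ : σ θ ≡ θ′
  σ-θ = trans (σ-at (form-root θ)) (form-root θ′)

  σ-+ : ∀ z w → σ (z + w) ≡ σ z + σ w
  σ-+ z w = let x , y , z≡ = coordinates z ; x′ , y′ , w≡ = coordinates w in
    trans (σ-at (trans (sym (form-+ θ x y x′ y′)) (cong₂ _+_ z≡ w≡)))
          (sym (form-+ θ′ x y x′ y′))

  σ-* : ∀ z w → σ (z * w) ≡ σ z * σ w
  σ-* z w = let x , y , z≡ = coordinates z ; x′ , y′ , w≡ = coordinates w in
    trans (σ-at (trans (sym (form-* θ θ-root x y x′ y′)) (cong₂ _*_ z≡ w≡)))
          (sym (form-* θ′ θ′-root x y x′ y′))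

  σ-neg : ∀ z → σ (- z) ≡ - σ z
  σ-neg z = let x , y , z≡ = coordinates z in
    trans (σ-at (trans (sym (form-neg θ x y)) (cong -_ z≡))) (sym (form-neg θ′ x y))

  σ-injective : Injective σ
  σ-injective {z} {w} eq =
    let x , y , z≡ = coordinates z ; x′ , y′ , w≡ = coordinates w
        x≡ , y≡ = form-injective θ′ θ′∉F {x} {y} {x′} {y′} eq
    in trans (sym z≡) (trans (cong₂ form₁ x≡ y≡) w≡)

  σ-automorphism : IsAutomorphism σ
  σ-automorphism = record
    { isRingIsomorphism = record
      { isRingMonomorphism = record
        { isRingHomomorphism = record
          { isSemiringHomomorphism = record
            { isNearSemiringHomomorphism = record
              { +-isMonoidHomomorphism = record
                { isMagmaHomomorphism = record
                  { isRelHomomorphism = record { cong = cong σ } ; homo = σ-+ }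
                ; ε-homo = trans (cong σ (sym embed.0#-homo)) (trans (σ-embed F.0#) embed.0#-homo)
                }
              ; *-homo = σ-*
              }
            ; 1#-homo = trans (cong σ (sym embed.1#-homo)) (trans (σ-embed F.1#) embed.1#-homo)
            }
          ; -‿homo = σ-neg
          }
        ; injective = σ-injective
        }
      ; surjective = λ w → let z , eq = injective⇒surjective E↔Fin E↔Fin σ σ-injective w in
          z , λ { refl → eq }
      }
    ; fixes = σ-embed
    }

  module Odd (2≢0 : ¬ CharTwo F) where

    -- The difference θ - θ′ of the two roots, which conjugation negates.
    ω : Carrier
    ω = θ + θ + - embed t

    -- The discriminant t² + 4s of the polynomial X² - tX - s.
    δ : F.Carrier
    δ = (F.1# F.+ F.1# F.+ F.1# F.+ F.1#) F.* s F.+ t F.* t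

    embed-δ : embed δ ≡ (1# + 1# + 1# + 1#) * embed s + embed t * embed t
    embed-δ = trans (embed.+-homo _ _) (cong₂ _+_
      (trans (embed.*-homo _ s) (cong (_* embed s) embed-4)) (embed.*-homo t t))
      where
      embed-4 : embed (F.1# F.+ F.1# F.+ F.1# F.+ F.1#) ≡ 1# + 1# + 1# + 1#
      embed-4 = trans (embed.+-homo _ _) (cong₂ _+_ (trans (embed.+-homo _ _) (cong₂ _+_
        (trans (embed.+-homo _ _) (cong₂ _+_ embed.1#-homo embed.1#-homo)) embed.1#-homo)) embed.1#-homo)

    ω²≡δ : ω * ω ≡ embed δ
    ω²≡δ = trans (by-multiple (1# + 1# + 1# + 1#) (equation 3 (λ s t r →
      (r ⊕ r ⊕ ⊝ t) ⊗ (r ⊕ r ⊕ ⊝ t) ⊕ ⊝ ((𝟙 ⊕ 𝟙 ⊕ 𝟙 ⊕ 𝟙) ⊗ s ⊕ t ⊗ t)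
        ⊜ (𝟙 ⊕ 𝟙 ⊕ 𝟙 ⊕ 𝟙) ⊗ (r ⊗ r ⊕ ⊝ (s ⊕ t ⊗ r))) (embed s) (embed t) θ) θ-root) (sym embed-δ)

    σ-ω : σ ω ≡ - ω
    σ-ω = begin
      σ (θ + θ + - embed t)            ≡⟨ σ-+ _ _ ⟩
      σ (θ + θ) + σ (- embed t)        ≡⟨ cong₂ _+_ (σ-+ θ θ) (trans (σ-neg _) (cong -_ (σ-embed t))) ⟩
      σ θ + σ θ + - embed t            ≡⟨ cong (λ u → u + u + - embed t) σ-θ ⟩
      θ′ + θ′ + - embed t              ≡⟨ equation 2 (λ t r →
                                            t ⊕ ⊝ r ⊕ (t ⊕ ⊝ r) ⊕ ⊝ t ⊜ ⊝ (r ⊕ r ⊕ ⊝ t)) (embed t) θ ⟩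
      - ω                              ∎
      where open ≡-Reasoning

    ω∉F : ¬ Rational ω
    ω∉F (x , eq) = θ∉F (d F.* (x F.+ t) , (begin
      embed (d F.* (x F.+ t))          ≡⟨ trans (embed.*-homo d _) (cong (embed d *_) (embed.+-homo x t)) ⟩
      embed d * (embed x + embed t)    ≡⟨ cong (λ u → embed d * (u + embed t)) eq ⟩
      embed d * (ω + embed t)          ≡⟨ equation 3 (λ d t r → d ⊗ (r ⊕ r ⊕ ⊝ t ⊕ t) ⊜ (𝟙 ⊕ 𝟙) ⊗ d ⊗ r) (embed d) (embed t) θ ⟩
      (1# + 1#) * embed d * θ          ≡⟨ cong (λ u → u * embed d * θ) (trans (embed.+-homo _ _) (cong₂ _+_ embed.1#-homo embed.1#-homo)) ⟨
      embed (F.1# F.+ F.1#) * embed d * θ ≡⟨ cong (_* θ) (embed.*-homo _ d) ⟨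
      embed ((F.1# F.+ F.1#) F.* d) * θ ≡⟨ cong (λ u → embed u * θ) (proj₂ half) ⟩
      embed F.1# * θ                   ≡⟨ cong (_* θ) embed.1#-homo ⟩
      1# * θ                           ≡⟨ *-identityˡ θ ⟩
      θ                                ∎))
      where
      open ≡-Reasoning
      half = F.inverse (F.1# F.+ F.1#) 2≢0
      d = proj₁ half

    -- In the extension the only square roots of δ are ω and -ω, and neither lies in the ground
    -- field.
    δ-nonsquare : ∀ x → x F.* x ≢ δ
    δ-nonsquare x eq = Sum.[ (λ ω≡ → ω∉F (x , sym ω≡))
                           , (λ ω≡ → ω∉F (F.- x , trans (embed.-‿homo x) (sym ω≡))) ]
      (square-roots (trans ω²≡δ (trans (cong embed (sym eq)) (embed.*-homo x x))))

  module Even (1+1≡0 : CharTwo F) where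

    embed-1+1≡0 : CharTwo big
    embed-1+1≡0 = trans (sym (trans (embed.+-homo _ _) (cong₂ _+_ embed.1#-homo embed.1#-homo)))
      (trans (cong embed 1+1≡0) embed.0#-homo)

    private
      module C = CharacteristicTwo big embed-1+1≡0
      module FE = F.Even 1+1≡0
      module EEv = FiniteField.Even big E↔Fin embed-1+1≡0

    -- Otherwise θ would be a square root of s, but all of these are in F.
    t≢0 : t ≢ F.0#
    t≢0 t≡0 = let w , w²≡s = FE.square-root s in
      Sum.[ (λ θ≡ → θ∉F (w , sym θ≡)) , (λ θ≡ → θ∉F (F.- w , trans (embed.-‿homo w) (sym θ≡))) ]
      (square-roots (begin
        θ * θ                    ≡⟨ θ-root ⟩
        embed s + embed t * θ    ≡⟨ cong (λ u → embed s + u * θ) (trans (cong embed t≡0) embed.0#-homo) ⟩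
        embed s + 0# * θ         ≡⟨ equation 2 (λ s r → s ⊕ 𝟘 ⊗ r ⊜ s) (embed s) θ ⟩
        embed s                  ≡⟨ cong embed w²≡s ⟨
        embed (w F.* w)          ≡⟨ embed.*-homo w w ⟩
        embed w * embed w        ∎))
      where open ≡-Reasoning

    private
      d : F.Carrier
      d = proj₁ (F.inverse t t≢0)

      td≡1 : embed t * embed d ≡ 1#
      td≡1 = trans (sym (embed.*-homo t d)) (trans (cong embed (proj₂ (F.inverse t t≢0))) embed.1#-homo)

    -- Dividing θ² = s + tθ by t² yields an Artin-Schreier equation, ω² = ω + s / t², with roots ω
    -- and ω + 1.
    ω : Carrier
    ω = embed d * θ

    δ : F.Carrier
    δ = d F.* d F.* s

    ω²+ω≡δ : ω * ω + ω ≡ embed δ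
    ω²+ω≡δ = begin
      ω * ω + ω                                        ≡⟨ cong (_+ ω) (equation 2 (λ d r → d ⊗ r ⊗ (d ⊗ r) ⊜ d ⊗ d ⊗ (r ⊗ r)) (embed d) θ) ⟩
      embed d * embed d * (θ * θ) + ω                  ≡⟨ cong (λ u → embed d * embed d * u + ω) θ-root ⟩
      embed d * embed d * (embed s + embed t * θ) + ω  ≡⟨ equation 4 (λ d s t r → d ⊗ d ⊗ (s ⊕ t ⊗ r) ⊕ d ⊗ r
                                                             ⊜ d ⊗ d ⊗ s ⊕ t ⊗ d ⊗ (d ⊗ r) ⊕ d ⊗ r) (embed d) (embed s) (embed t) θ ⟩
      embed d * embed d * embed s + embed t * embed d * ω + ω ≡⟨ cong (λ u → embed d * embed d * embed s + u * ω + ω) td≡1 ⟩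
      embed d * embed d * embed s + 1# * ω + ω         ≡⟨ C.equation 2 (λ a r → a ⊕ C.𝟙 ⊗ r ⊕ r C.⊜ a) (embed d * embed d * embed s) ω ⟩
      embed d * embed d * embed s                      ≡⟨ trans (embed.*-homo _ s) (cong (_* embed s) (embed.*-homo d d)) ⟨
      embed δ                                          ∎
      where open ≡-Reasoning

    σ-ω : σ ω ≡ ω + 1#
    σ-ω = begin
      σ (embed d * θ)                     ≡⟨ σ-* _ _ ⟩
      σ (embed d) * σ θ                   ≡⟨ cong₂ _*_ (σ-embed d) σ-θ ⟩
      embed d * (embed t + - θ)           ≡⟨ C.equation 3 (λ d t r → d ⊗ (t ⊕ ⊝ r) C.⊜ d ⊗ r ⊕ t ⊗ d) (embed d) (embed t) θ ⟩
      ω + embed t * embed d               ≡⟨ cong (ω +_) td≡1 ⟩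
      ω + 1#                              ∎
      where open ≡-Reasoning

    ω∉F : ¬ Rational ω
    ω∉F (x , eq) = θ∉F (t F.* x , (begin
      embed (t F.* x)                     ≡⟨ embed.*-homo t x ⟩
      embed t * embed x                   ≡⟨ cong (embed t *_) eq ⟩
      embed t * (embed d * θ)             ≡⟨ *-assoc _ _ _ ⟨
      embed t * embed d * θ               ≡⟨ cong (_* θ) td≡1 ⟩
      1# * θ                              ≡⟨ *-identityˡ θ ⟩
      θ                                   ∎))
      where open ≡-Reasoning

    δ∉℘ : ∀ x → x F.* x F.+ x ≢ δ
    δ∉℘ x eq = Sum.[ (λ ω≡ → ω∉F (x , sym ω≡))
                   , (λ ω≡ → ω∉F (x F.+ F.1# , trans (embed.+-homo x _) (trans (cong (embed x +_) embed.1#-homo) (sym ω≡)))) ]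
      (EEv.℘-fibres (trans ω²+ω≡δ (trans (cong embed (sym eq))
        (trans (embed.+-homo _ x) (cong (_+ embed x) (embed.*-homo x x))))))

-- Odd characteristic

-- Polymorphic so that one type indexes forms by their parameter r, by a square root of r in either
-- field, or by a number in `Fin h`; `mapᵢ` passes between these.
PencilIndex : Set → Set → Set
PencilIndex C R = (C × R) ⊎ R ⊎ R

mapᵢ : ∀ {C C′ R R′} → (C → C′) → (R → R′) → PencilIndex C R → PencilIndex C′ R′
mapᵢ f g = Sum.map (λ (k , r) → f k , g r) (Sum.map g g)

parameter : ∀ {C R} → PencilIndex C R → R
parameter (inj₁ (_ , r)) = r
parameter (inj₂ (inj₁ r)) = r
parameter (inj₂ (inj₂ r)) = r

-- In odd characteristic we use the linear forms U = X₁ + X₂ and V = X₁ − X₂ in place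
-- of X₁ and X₂.
module OddForms (R : RawRing 0ℓ 0ℓ) where
  open RawRing R

  -- The solid coefficients of a X₀² + β X₀ (U − V) + m U² + n V².
  change : Vec Carrier 4 → Vec Carrier 4
  change (a ∷ β ∷ m ∷ n ∷ []) = a ∷ β + β ∷ m + n ∷ m + - n + (m + - n) ∷ []

  -- Inverse to `change` up to the factor 4, which is harmless for projective purposes and avoids
  -- dividing by two.
  unchange : Vec Carrier 4 → Vec Carrier 4
  unchange (a ∷ b ∷ c ∷ d ∷ []) =
    (1# + 1# + 1# + 1#) * a ∷ b + b ∷ c + c + d ∷ c + c + - d ∷ []

  -- (V + k r X₀)² − r (U + k X₀)², X₀² − r U² and X₀² − r V².
  pencil : PencilIndex Carrier Carrier → Vec Carrier 4
  pencil (inj₁ (k , r))  = k * k * (r * (r + - 1#)) ∷ - (k * r + k * r) ∷ - r ∷ 1# ∷ []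
  pencil (inj₂ (inj₁ r)) = 1# ∷ 0# ∷ - r ∷ 0# ∷ []
  pencil (inj₂ (inj₂ r)) = 1# ∷ 0# ∷ 0# ∷ - r ∷ []

  -- A linear factor of the above forms for r = τ².
  linear : PencilIndex Carrier Carrier → Vec Carrier 3
  linear (inj₁ (k , τ))  = k * (τ * τ) + τ * k ∷ 1# + τ ∷ - 1# + τ ∷ []
  linear (inj₂ (inj₁ τ)) = 1# ∷ τ ∷ τ ∷ []
  linear (inj₂ (inj₂ τ)) = 1# ∷ τ ∷ - τ ∷ []

module OddFactorization (K : Field) where
  open Field K
  open FieldProperties K
  open Projective K renaming (_⊗_ to infixl 7 _⊠_)
  open FormProperties K
  open IntegerCoefficients K
  open OddForms rawRing public
  private
    module X {n} = OddForms (exprRing n)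
    module Y {n} = Forms (exprRing n)

  -- Negating the root τ of r exchanges the factors of a difference of squares. Over the extension,
  -- with τ a multiple of ω by a ground field element, this is what σ does.
  conjugateᵢ : PencilIndex Carrier Carrier → PencilIndex Carrier Carrier
  conjugateᵢ = mapᵢ id -_

  pencil-splits : ∀ i → solid (change (pencil (mapᵢ id (λ τ → τ * τ) i)))
    ≡ formProduct (linear i) (linear (conjugateᵢ i))
  pencil-splits (inj₁ (k , τ)) = equations 2 (λ k τ → Y.solid (X.change (X.pencil (inj₁ (k , τ ⊗ τ))))
    ⊜ Y.product (X.linear (inj₁ (k , τ))) (X.linear (inj₁ (k , ⊝ τ)))) k τ
  pencil-splits (inj₂ (inj₁ τ)) = equations 1 (λ τ → Y.solid (X.change (X.pencil (inj₂ (inj₁ (τ ⊗ τ)))))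
    ⊜ Y.product (X.linear (inj₂ (inj₁ τ))) (X.linear (inj₂ (inj₁ (⊝ τ))))) τ
  pencil-splits (inj₂ (inj₂ τ)) = equations 1 (λ τ → Y.solid (X.change (X.pencil (inj₂ (inj₂ (τ ⊗ τ)))))
    ⊜ Y.product (X.linear (inj₂ (inj₂ τ))) (X.linear (inj₂ (inj₂ (⊝ τ))))) τ

  module _ (2≢0 : ¬ CharTwo K) where

    -- In each case one coordinate of the cross product of the two factors is 2τ or 4τ up to sign.
    linear-≁ : ∀ i → parameter i ≢ 0# → ¬ (linear i ∼ linear (conjugateᵢ i))
    linear-≁ i@(inj₁ (k , τ)) τ≢0 l∼m = *-nonzero (*-nonzero 2≢0 2≢0) (-‿nonzero τ≢0) (trans
      (equation 1 (λ τ → (𝟙 ⊕ 𝟙) ⊗ (𝟙 ⊕ 𝟙) ⊗ ⊝ τ ⊜ (𝟙 ⊕ τ) ⊗ (⊝ 𝟙 ⊕ ⊝ τ) ⊕ ⊝ ((⊝ 𝟙 ⊕ τ) ⊗ (𝟙 ⊕ ⊝ τ))) τ)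
      (cong head (cross-∼ {linear i} {linear (conjugateᵢ i)} l∼m)))
    linear-≁ i@(inj₂ (inj₁ τ)) τ≢0 l∼m = *-nonzero 2≢0 τ≢0 (trans
      (equation 1 (λ τ → (𝟙 ⊕ 𝟙) ⊗ τ ⊜ τ ⊗ 𝟙 ⊕ ⊝ (𝟙 ⊗ ⊝ τ)) τ)
      (cong (head ∘ tail) (cross-∼ {linear i} {linear (conjugateᵢ i)} l∼m)))
    linear-≁ i@(inj₂ (inj₂ τ)) τ≢0 l∼m = *-nonzero 2≢0 (-‿nonzero τ≢0) (trans
      (equation 1 (λ τ → (𝟙 ⊕ 𝟙) ⊗ ⊝ τ ⊜ 𝟙 ⊗ ⊝ τ ⊕ ⊝ (τ ⊗ 𝟙)) τ)
      (cong (head ∘ tail ∘ tail) (cross-∼ {linear i} {linear (conjugateᵢ i)} l∼m)))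

module OddClassification (F : Field) {q : ℕ} (F↔Fin : HasOrder F q)
  (2≢0 : ¬ CharTwo F) where
  open Field F
  open FieldProperties F
  open Projective F renaming (_⊗_ to infixl 7 _⊠_)
  open FormProperties F
  open Solid F
  open IntegerCoefficients F
  open Finite F↔Fin using (_≟_)
  open OddFactorization F
  open Decidable _≟_ using (zero-product)
  private
    module X {n} = OddForms (exprRing n)
    module Y {n} = Forms (exprRing n)

  change-· : ∀ c v → change (c · v) ≡ c · change v
  change-· c (v₀ ∷ v₁ ∷ v₂ ∷ v₃ ∷ []) = equations 5 (λ c v₀ v₁ v₂ v₃ →
    let v = v₀ ∷ v₁ ∷ v₂ ∷ v₃ ∷ [] in X.change (c Y.·ᵥ v) ⊜ c Y.·ᵥ X.change v) c v₀ v₁ v₂ v₃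

  4# : Carrier
  4# = 1# + 1# + 1# + 1#

  4≢0 : 4# ≢ 0#
  4≢0 eq = *-nonzero 2≢0 2≢0 (trans (equation 0 ((𝟙 ⊕ 𝟙) ⊗ (𝟙 ⊕ 𝟙) ⊜ 𝟙 ⊕ 𝟙 ⊕ 𝟙 ⊕ 𝟙)) eq)

  unchange-change : ∀ v → unchange (change v) ≡ 4# · v
  unchange-change (v₀ ∷ v₁ ∷ v₂ ∷ v₃ ∷ []) = equations 4 (λ v₀ v₁ v₂ v₃ →
    let v = v₀ ∷ v₁ ∷ v₂ ∷ v₃ ∷ [] in
    X.unchange (X.change v) ⊜ (𝟙 ⊕ 𝟙 ⊕ 𝟙 ⊕ 𝟙) Y.·ᵥ v) v₀ v₁ v₂ v₃

  change-unchange : ∀ w → change (unchange w) ≡ 4# · w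
  change-unchange (v₀ ∷ v₁ ∷ v₂ ∷ v₃ ∷ []) = equations 4 (λ v₀ v₁ v₂ v₃ →
    let v = v₀ ∷ v₁ ∷ v₂ ∷ v₃ ∷ [] in
    X.change (X.unchange v) ⊜ (𝟙 ⊕ 𝟙 ⊕ 𝟙 ⊕ 𝟙) Y.·ᵥ v) v₀ v₁ v₂ v₃

  ·-cancel : ∀ {n c} {u v : Vec Carrier n} → c ≢ 0# → c · u ≡ c · v → u ≡ v
  ·-cancel {u = []} {[]} c≢0 eq = refl
  ·-cancel {u = x ∷ u} {y ∷ v} c≢0 eq =
    cong₂ _∷_ (*-cancelˡ c≢0 (cong head eq)) (·-cancel c≢0 (cong tail eq))

  change-injective : ∀ {u v} → change u ≡ change v → u ≡ v
  change-injective {u} {v} eq = ·-cancel 4≢0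
    (trans (sym (unchange-change u)) (trans (cong unchange eq) (unchange-change v)))

  ∼-change : ∀ {u v} → change u ∼ change v → u ∼ v
  ∼-change {u} {v} (c , c≢0 , eq) = c , c≢0 , change-injective (trans eq (sym (change-· c v)))

  change-∼ : ∀ {u v} → u ∼ v → change u ∼ change v
  change-∼ {v = v} (c , c≢0 , refl) = c , c≢0 , change-· c v

  change≢0 : ∀ {v} → v ≢ 0ᵥ → change v ≢ 0ᵥ
  change≢0 {v} v≢0 eq = v≢0 (change-injective (trans eq
    (sym (equations 0 (X.change (replicate 4 𝟘) ⊜ replicate 4 𝟘)))))

  ∼-unchange : ∀ w → w ∼ change (unchange w)
  ∼-unchange w = ∼-sym {u = change (unchange w)} {w} (4# , 4≢0 , change-unchange w)

  -- X₀², U² and V².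
  square : Fin 3 → Vec Carrier 4
  square 0F = 1# ∷ 0# ∷ 0# ∷ 0# ∷ []
  square 1F = 0# ∷ 0# ∷ 1# ∷ 0# ∷ []
  square 2F = 0# ∷ 0# ∷ 0# ∷ 1# ∷ []

  -- X₀ (a X₀ + U − V).
  split : Carrier → Vec Carrier 4
  split a = a ∷ 1# ∷ 0# ∷ 0# ∷ []

  data Classified (v : Vec Carrier 4) : Set where
    isSquare : ∀ i → v ∼ square i → Classified v
    isSplit  : ∀ a → v ∼ split a → Classified v
    isPencil : ∀ i → parameter i ≢ 0# → v ∼ pencil i → Classified v

  -- The inner expression is the discriminant in the coordinates X₀, U, V; the outer 4 is the
  -- squared determinant of the substitution.
  discriminant-change : ∀ a β m n → discriminant (solid (change (a ∷ β ∷ m ∷ n ∷ [])))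
    ≡ 4# * (4# * a * m * n + - ((m + n) * (β * β)))
  discriminant-change = equation 4 λ a β m n →
    let 4ₑ = 𝟙 ⊕ 𝟙 ⊕ 𝟙 ⊕ 𝟙 in
    Y.discriminant (Y.solid (X.change (a ∷ β ∷ m ∷ n ∷ [])))
    ⊜ 4ₑ ⊗ (4ₑ ⊗ a ⊗ m ⊗ n ⊕ ⊝ ((m ⊕ n) ⊗ (β ⊗ β)))

  x²≡0⇒x≡0 : ∀ {x} → x * x ≡ 0# → x ≡ 0#
  x²≡0⇒x≡0 eq = Sum.reduce (zero-product eq)

  inverse≢0 : ∀ {c d} → c * d ≡ 1# → d ≢ 0#
  inverse≢0 {c} cd≡1 refl = 0≢1 (trans (sym (zeroʳ c)) cd≡1)

  classified-∼ : ∀ {u v} → u ∼ v → Classified v → Classified u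
  classified-∼ {u} {v} u∼v (isSquare i v∼)      = isSquare i (∼-trans {u = u} {v} {square i} u∼v v∼)
  classified-∼ {u} {v} u∼v (isSplit a v∼)       = isSplit a (∼-trans {u = u} {v} {split a} u∼v v∼)
  classified-∼ {u} {v} u∼v (isPencil i r≢0 v∼)  = isPencil i r≢0 (∼-trans {u = u} {v} {pencil i} u∼v v∼)

  Degenerate : (a β m n : Carrier) → Set
  Degenerate a β m n = 4# * a * m * n ≡ (m + n) * (β * β)

  -- For m ≠ 0, completing squares gives (V - (β/2) X₀)² + m (U + β/(2m) X₀)² plus a multiple of X₀²
  -- that degeneracy makes zero, so k = β/(2m) and r = -m. For m = 0 degeneracy forces β = 0.
  classify-V : ∀ a β m → Degenerate a β m 1# → Classified (a ∷ β ∷ m ∷ 1# ∷ [])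
  classify-V a β m deg with m ≟ 0#
  classify-V a β m deg | yes refl with x²≡0⇒x≡0 {β} (
    by-multiple (- 1#) (equation 2 (λ a b → b ⊗ b ⊕ ⊝ 𝟘
      ⊜ ⊝ 𝟙 ⊗ ((𝟙 ⊕ 𝟙 ⊕ 𝟙 ⊕ 𝟙) ⊗ a ⊗ 𝟘 ⊗ 𝟙 ⊕ ⊝ ((𝟘 ⊕ 𝟙) ⊗ (b ⊗ b)))) a β) deg) | a ≟ 0#
  ... | refl | yes refl = isSquare 2F ∼-refl
  ... | refl | no a≢0 = let d , ad≡1 = inverse a a≢0 in
    isPencil (inj₂ (inj₂ (- d))) (-‿nonzero (inverse≢0 ad≡1)) (a , a≢0 ,
      cong₂ _∷_ (*-one a) (cong₂ _∷_ (sym (zeroʳ a)) (cong₂ _∷_ (sym (zeroʳ a))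
        (cong (_∷ []) (sym (trans (cong (a *_) (sym (double-neg d))) ad≡1))))))
  classify-V a β m deg | no m≢0 = isPencil (inj₁ (k , - m)) (-‿nonzero m≢0) (1# , 1≢0 ,
      cong₂ _∷_ a≡ (cong₂ _∷_ (trans β≡ (equation 2 (λ m k → (𝟙 ⊕ 𝟙) ⊗ m ⊗ k
          ⊜ 𝟙 ⊗ ⊝ (k ⊗ ⊝ m ⊕ k ⊗ ⊝ m)) m k))
        (cong₂ _∷_ (equation 1 (λ m → m ⊜ 𝟙 ⊗ ⊝ ⊝ m) m) (cong (_∷ []) (*-one 1#)))))
    where
    2m≢0 : (1# + 1#) * m ≢ 0#
    2m≢0 = *-nonzero 2≢0 m≢0

    d = proj₁ (inverse _ 2m≢0)
    k = d * β

    β≡ : β ≡ (1# + 1#) * m * k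
    β≡ = scale (proj₂ (inverse _ 2m≢0))

    a≡ : a ≡ 1# * (k * k * (- m * (- m + - 1#)))
    a≡ = *-cancelˡ (*-nonzero 4≢0 m≢0) (by-multiple 1# (equation 3 (λ a m k →
        let 4ₑ = 𝟙 ⊕ 𝟙 ⊕ 𝟙 ⊕ 𝟙 ; b = (𝟙 ⊕ 𝟙) ⊗ m ⊗ k in
        4ₑ ⊗ m ⊗ a ⊕ ⊝ (4ₑ ⊗ m ⊗ (𝟙 ⊗ (k ⊗ k ⊗ (⊝ m ⊗ (⊝ m ⊕ ⊝ 𝟙)))))
        ⊜ 𝟙 ⊗ (4ₑ ⊗ a ⊗ m ⊗ 𝟙 ⊕ ⊝ ((m ⊕ 𝟙) ⊗ (b ⊗ b)))) a m k)
      (subst (λ b → Degenerate a b m 1#) β≡ deg))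

  -- Degeneracy now reads m β² = 0, so the U² term or the mixed term is absent.
  classify-noV : ∀ a β m → Degenerate a β m 0# → a ∷ β ∷ m ∷ 0# ∷ [] ≢ 0ᵥ → Classified (a ∷ β ∷ m ∷ 0# ∷ [])
  classify-noV a β m deg v≢0 with m ≟ 0# | β ≟ 0# | a ≟ 0#
  ... | yes refl | yes refl | yes refl = contradiction refl v≢0
  ... | yes refl | yes refl | no a≢0 = isSquare 0F (a , a≢0 ,
    cong₂ _∷_ (*-one a) (sym (·-zeroᵥ {3} a)))
  ... | yes refl | no β≢0   | _ = let d , βd≡1 = inverse β β≢0 in
    isSplit (d * a) (β , β≢0 , cong₂ _∷_ (scale βd≡1) (cong₂ _∷_ (*-one β) (sym (·-zeroᵥ {2} β))))
  ... | no m≢0   | no β≢0   | _ = contradiction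
    (by-multiple (- 1#) (equation 3 (λ a b m → m ⊗ (b ⊗ b) ⊕ ⊝ 𝟘
      ⊜ ⊝ 𝟙 ⊗ ((𝟙 ⊕ 𝟙 ⊕ 𝟙 ⊕ 𝟙) ⊗ a ⊗ m ⊗ 𝟘 ⊕ ⊝ ((m ⊕ 𝟘) ⊗ (b ⊗ b)))) a β m) deg)
    (*-nonzero m≢0 (*-nonzero β≢0 β≢0))
  ... | no m≢0   | yes refl | yes refl = isSquare 1F (m , m≢0 ,
    cong₂ _∷_ (sym (zeroʳ m)) (cong₂ _∷_ (sym (zeroʳ m)) (cong₂ _∷_ (*-one m) (sym (·-zeroᵥ {1} m)))))
  ... | no m≢0   | yes refl | no a≢0 = let d , ad≡1 = inverse a a≢0 in
    isPencil (inj₂ (inj₁ (- (d * m)))) (-‿nonzero (*-nonzero (inverse≢0 ad≡1) m≢0)) (a , a≢0 ,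
      cong₂ _∷_ (*-one a) (cong₂ _∷_ (sym (zeroʳ a)) (cong₂ _∷_
        (trans (scale ad≡1) (cong (a *_) (double-neg (d * m)))) (sym (·-zeroᵥ {1} a)))))

  singular⇒degenerate : ∀ a β m n → discriminant (solid (change (a ∷ β ∷ m ∷ n ∷ []))) ≡ 0# → Degenerate a β m n
  singular⇒degenerate a β m n sing = x-y≡0⇒x≡y
    (*-zero-cancelˡ 4≢0 (trans (sym (discriminant-change a β m n)) sing))

  classify : ∀ v → v ≢ 0ᵥ → discriminant (solid (change v)) ≡ 0# → Classified v
  classify (a ∷ β ∷ m ∷ n ∷ []) v≢0 sing with n ≟ 0#
  ... | yes refl = classify-noV a β m (singular⇒degenerate a β m 0# sing) v≢0
  ... | no n≢0 = classified-∼ {a ∷ β ∷ m ∷ n ∷ []} {v′} v∼v′ (classify-V (d * a) (d * β) (d * m)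
      (singular⇒degenerate (d * a) (d * β) (d * m) 1# sing′))
    where
    d = proj₁ (inverse n n≢0)
    nd≡1 = proj₂ (inverse n n≢0)

    v′ : Vec Carrier 4
    v′ = d * a ∷ d * β ∷ d * m ∷ 1# ∷ []

    v∼v′ : (a ∷ β ∷ m ∷ n ∷ []) ∼ v′
    v∼v′ = n , n≢0 , cong₂ _∷_ (scale nd≡1) (cong₂ _∷_ (scale nd≡1)
      (cong₂ _∷_ (scale nd≡1) (cong (_∷ []) (*-one n))))

    sing′ : discriminant (solid (change v′)) ≡ 0#
    sing′ = let v = a ∷ β ∷ m ∷ n ∷ []
                c , _ , eq = solid-∼ {change v′} {change v} (change-∼ {v′} {v} (∼-sym {u = v} {v′} v∼v′))
      in trans (cong discriminant eq) (trans (discriminant-· c (solid (change v)))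
           (trans (cong (c * c * c *_) sing) (zeroʳ _)))

  pencil≢0 : ∀ i → pencil i ≢ 0ᵥ
  pencil≢0 (inj₁ _)        eq = 1≢0 (cong (λ v → lookup v 3F) eq)
  pencil≢0 (inj₂ (inj₁ _)) eq = 1≢0 (cong head eq)
  pencil≢0 (inj₂ (inj₂ _)) eq = 1≢0 (cong head eq)

  private
    zero≢multiple : ∀ {c x} → c ≢ 0# → x ≢ 0# → 0# ≢ c * x
    zero≢multiple c≢0 x≢0 eq = *-nonzero c≢0 x≢0 (sym eq)

    nonzero≢multiple : ∀ {c x} → x ≢ 0# → x ≢ c * 0#
    nonzero≢multiple {c} x≢0 eq = x≢0 (trans eq (zeroʳ c))

    normalized : ∀ {c} → 1# ≡ c * 1# → c ≡ 1#
    normalized {c} eq = trans (*-one c) (sym eq)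

    1*x : ∀ {c x y} → c ≡ 1# → x ≡ c * y → x ≡ y
    1*x {y = y} refl eq = trans eq (*-identityˡ y)

  pencil-injective : ∀ {i j} → parameter i ≢ 0# → parameter j ≢ 0# → pencil i ∼ pencil j → i ≡ j
  pencil-injective {inj₁ (k , r)} {inj₁ (l , s)} r≢0 s≢0 (c , c≢0 , eq) = cong inj₁ (cong₂ _,_ k≡l r≡s)
    where
    c≡1 = normalized (cong (λ v → lookup v 3F) eq)

    r≡s : r ≡ s
    r≡s = neg-injective (1*x c≡1 (cong (λ v → lookup v 2F) eq))

    k≡l : k ≡ l
    k≡l = *-cancelˡ (*-nonzero 2≢0 r≢0) (begin
      (1# + 1#) * r * k     ≡⟨ equation 2 (λ k r → (𝟙 ⊕ 𝟙) ⊗ r ⊗ k ⊜ ⊝ ⊝ (k ⊗ r ⊕ k ⊗ r)) k r ⟩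
      - - (k * r + k * r)   ≡⟨ cong -_ (1*x c≡1 (cong (λ v → lookup v 1F) eq)) ⟩
      - - (l * s + l * s)   ≡⟨ cong (λ t → - - (l * t + l * t)) r≡s ⟨
      - - (l * r + l * r)   ≡⟨ equation 2 (λ k r → (𝟙 ⊕ 𝟙) ⊗ r ⊗ k ⊜ ⊝ ⊝ (k ⊗ r ⊕ k ⊗ r)) l r ⟨
      (1# + 1#) * r * l     ∎)
      where open ≡-Reasoning
  pencil-injective {inj₁ _} {inj₂ (inj₁ s)} r≢0 s≢0 (c , c≢0 , eq) =
    contradiction (cong (λ v → lookup v 3F) eq) (nonzero≢multiple 1≢0)
  pencil-injective {inj₁ _} {inj₂ (inj₂ s)} r≢0 s≢0 (c , c≢0 , eq) =
    contradiction (cong (λ v → lookup v 2F) eq) (nonzero≢multiple (-‿nonzero r≢0))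
  pencil-injective {inj₂ (inj₁ _)} {inj₁ _} r≢0 s≢0 (c , c≢0 , eq) =
    contradiction (cong (λ v → lookup v 3F) eq) (zero≢multiple c≢0 1≢0)
  pencil-injective {inj₂ (inj₁ r)} {inj₂ (inj₁ s)} r≢0 s≢0 (c , c≢0 , eq) =
    cong (inj₂ ∘ inj₁) (neg-injective (1*x (normalized (cong head eq)) (cong (λ v → lookup v 2F) eq)))
  pencil-injective {inj₂ (inj₁ r)} {inj₂ (inj₂ s)} r≢0 s≢0 (c , c≢0 , eq) =
    contradiction (cong (λ v → lookup v 3F) eq) (zero≢multiple c≢0 (-‿nonzero s≢0))
  pencil-injective {inj₂ (inj₂ _)} {inj₁ _} r≢0 s≢0 (c , c≢0 , eq) =
    contradiction (cong (λ v → lookup v 2F) eq) (zero≢multiple c≢0 (-‿nonzero s≢0))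
  pencil-injective {inj₂ (inj₂ r)} {inj₂ (inj₁ s)} r≢0 s≢0 (c , c≢0 , eq) =
    contradiction (cong (λ v → lookup v 2F) eq) (zero≢multiple c≢0 (-‿nonzero s≢0))
  pencil-injective {inj₂ (inj₂ r)} {inj₂ (inj₂ s)} r≢0 s≢0 (c , c≢0 , eq) =
    cong (inj₂ ∘ inj₂) (neg-injective (1*x (normalized (cong head eq)) (cong (λ v → lookup v 3F) eq)))

  pencil≁split : ∀ i a → parameter i ≢ 0# → ¬ (pencil i ∼ split a)
  pencil≁split (inj₁ _)        a r≢0 (c , c≢0 , eq) = nonzero≢multiple 1≢0 (cong (λ v → lookup v 3F) eq)
  pencil≁split (inj₂ (inj₁ r)) a r≢0 (c , c≢0 , eq) = nonzero≢multiple (-‿nonzero r≢0) (cong (λ v → lookup v 2F) eq)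
  pencil≁split (inj₂ (inj₂ r)) a r≢0 (c , c≢0 , eq) = nonzero≢multiple (-‿nonzero r≢0) (cong (λ v → lookup v 3F) eq)

  split-injective : ∀ {a b} → split a ∼ split b → a ≡ b
  split-injective (c , c≢0 , eq) = 1*x (normalized (cong (λ v → lookup v 1F) eq)) (cong head eq)

  square-injective : ∀ {i j} → square i ∼ square j → i ≡ j
  square-injective {0F} {0F} _ = refl
  square-injective {1F} {1F} _ = refl
  square-injective {2F} {2F} _ = refl
  square-injective {0F} {1F} (c , c≢0 , eq) = contradiction (cong (λ v → lookup v 0F) eq) (nonzero≢multiple 1≢0)
  square-injective {0F} {2F} (c , c≢0 , eq) = contradiction (cong (λ v → lookup v 0F) eq) (nonzero≢multiple 1≢0)
  square-injective {1F} {0F} (c , c≢0 , eq) = contradiction (cong (λ v → lookup v 2F) eq) (nonzero≢multiple 1≢0)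
  square-injective {1F} {2F} (c , c≢0 , eq) = contradiction (cong (λ v → lookup v 2F) eq) (nonzero≢multiple 1≢0)
  square-injective {2F} {0F} (c , c≢0 , eq) = contradiction (cong (λ v → lookup v 3F) eq) (nonzero≢multiple 1≢0)
  square-injective {2F} {1F} (c , c≢0 , eq) = contradiction (cong (λ v → lookup v 3F) eq) (nonzero≢multiple 1≢0)

mapᵢ-∘ : ∀ {C C′ C″ R R′ R″} {f : C → C′} {f′ : C′ → C″} {g : R → R′} {g′ : R′ → R″} →
  ∀ i → mapᵢ f′ g′ (mapᵢ f g i) ≡ mapᵢ (f′ ∘ f) (g′ ∘ g) i
mapᵢ-∘ (inj₁ _)        = refl
mapᵢ-∘ (inj₂ (inj₁ _)) = refl
mapᵢ-∘ (inj₂ (inj₂ _)) = refl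

mapᵢ-cong : ∀ {C C′ R R′} {f f′ : C → C′} {g g′ : R → R′} →
  (∀ x → f x ≡ f′ x) → (∀ r → g r ≡ g′ r) → ∀ i → mapᵢ f g i ≡ mapᵢ f′ g′ i
mapᵢ-cong f≡ g≡ (inj₁ (x , r))  = cong₂ (λ x r → inj₁ (x , r)) (f≡ x) (g≡ r)
mapᵢ-cong f≡ g≡ (inj₂ (inj₁ r)) = cong (inj₂ ∘ inj₁) (g≡ r)
mapᵢ-cong f≡ g≡ (inj₂ (inj₂ r)) = cong (inj₂ ∘ inj₂) (g≡ r)

mapᵢ-injective : ∀ {C R R′} {g : R → R′} → Injective g → Injective (mapᵢ {C} id g)
mapᵢ-injective {g = g} g-inj {i} {j} = go i j
  where
  go : ∀ i j → mapᵢ id g i ≡ mapᵢ id g j → i ≡ j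
  go (inj₁ (x , r)) (inj₁ (y , s)) eq =
    cong inj₁ (cong₂ _,_ (cong proj₁ (inj₁⁻¹ eq)) (g-inj (cong proj₂ (inj₁⁻¹ eq))))
    where
    inj₁⁻¹ : ∀ {A B : Set} {x y : A} → inj₁ {B = B} x ≡ inj₁ y → x ≡ y
    inj₁⁻¹ refl = refl
  go (inj₂ (inj₁ r)) (inj₂ (inj₁ s)) eq = cong (inj₂ ∘ inj₁) (g-inj (unwrap eq))
    where
    unwrap : ∀ {A B C : Set} {x y : B} → inj₂ {A = A} (inj₁ {B = C} x) ≡ inj₂ (inj₁ y) → x ≡ y
    unwrap refl = refl
  go (inj₂ (inj₂ r)) (inj₂ (inj₂ s)) eq = cong (inj₂ ∘ inj₂) (g-inj (unwrap eq))
    where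
    unwrap : ∀ {A B C : Set} {x y : C} → inj₂ {A = A} (inj₂ {A = B} x) ≡ inj₂ (inj₂ y) → x ≡ y
    unwrap refl = refl
  go (inj₁ _)        (inj₂ _)        ()
  go (inj₂ _)        (inj₁ _)        ()
  go (inj₂ (inj₁ _)) (inj₂ (inj₂ _)) ()
  go (inj₂ (inj₂ _)) (inj₂ (inj₁ _)) ()

parameter-mapᵢ : ∀ {C C′ R R′} {f : C → C′} {g : R → R′} {P : R′ → Set} →
  (∀ r → P (g r)) → ∀ i → P (parameter (mapᵢ f g i))
parameter-mapᵢ Pg (inj₁ (_ , r))  = Pg r
parameter-mapᵢ Pg (inj₂ (inj₁ r)) = Pg r
parameter-mapᵢ Pg (inj₂ (inj₂ r)) = Pg r

module OddDistribution {q : ℕ} (F : Field) (F↔Fin : HasOrder F q)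
  (E : Extension F) (E↔Fin : HasOrder (Extension.big E) (q ^ 2))
  (2≢0 : ¬ CharTwo F) where

  open Field F
  open Extension E
  open OrbitDistribution F E renaming (_⊗_ to infixl 7 _⊠_)
  open FieldProperties F
  open FormProperties F
  open Solid F
  open OddClassification F F↔Fin 2≢0
  open OddFactorization F
  open IntegerCoefficients F
  open FiniteField.Odd F F↔Fin 2≢0 using (h; pos; pos≢0; pos²-injective; δ≢0; square-classes; q≡2h+1)
  open Finite F↔Fin using (_≟_)
  open QuadraticExtension F F↔Fin E E↔Fin using (σ; σ-automorphism; σ-embed; σ-*)
  open QuadraticExtension.Odd F F↔Fin E E↔Fin 2≢0
  open Distribution F F↔Fin E (Finite._≟_ E↔Fin)
  open Classes F E _≟_ (Finite._≟_ E↔Fin) using (embedᵥ; embed-nonzero; Singular; singular-∼; module embed)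
  private
    module X {n} = OddForms (exprRing n)
    module Y {n} = Forms (exprRing n)
    module K where
      open Field big public
      open FieldProperties big public
      open Projective big public
      open FormProperties big using (solid) public
      open OddFactorization big public
      open IntegerCoefficients big public using (equation)

  -- By `square-classes` these run through all nonzero elements, so the nonzero parameters of the
  -- pencils fall into two equally large halves, one for each kind of line pair.
  sq nsq : Fin h → Carrier
  sq j = pos j * pos j
  nsq j = δ * (pos j * pos j)

  sq≢0 : ∀ j → sq j ≢ 0#
  sq≢0 j = *-nonzero (pos≢0 j) (pos≢0 j)

  nsq≢0 : ∀ j → nsq j ≢ 0#
  nsq≢0 j = *-nonzero (δ≢0 δ-nonsquare) (sq≢0 j)

  Index : Set
  Index = PencilIndex Carrier (Fin h)

  double-lines : Family H₁ (Fin 3)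
  double-lines = record
    { vec         = change ∘ square
    ; vec≢0       = λ i → change≢0 (square≢0 i)
    ; member      = member
    ; independent = λ {i} {j} v∼ → square-injective (∼-change {square i} {square j} v∼)
    }
    where
    square≢0 : ∀ i → square i ≢ 0ᵥ
    square≢0 0F eq = 1≢0 (cong (λ v → lookup v 0F) eq)
    square≢0 1F eq = 1≢0 (cong (λ v → lookup v 2F) eq)
    square≢0 2F eq = 1≢0 (cong (λ v → lookup v 3F) eq)

    member : ∀ i → ∃ λ l → solid (change (square i)) ∼ formProduct l l
    member 0F = (1# ∷ 0# ∷ 0# ∷ []) , subst (solid (change (square 0F)) ∼_)
      (equations 0 (Y.solid (X.change (𝟙 ∷ 𝟘 ∷ 𝟘 ∷ 𝟘 ∷ [])) ⊜ Y.product (𝟙 ∷ 𝟘 ∷ 𝟘 ∷ []) (𝟙 ∷ 𝟘 ∷ 𝟘 ∷ []))) ∼-refl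
    member 1F = (0# ∷ 1# ∷ 1# ∷ []) , subst (solid (change (square 1F)) ∼_)
      (equations 0 (Y.solid (X.change (𝟘 ∷ 𝟘 ∷ 𝟙 ∷ 𝟘 ∷ [])) ⊜ Y.product (𝟘 ∷ 𝟙 ∷ 𝟙 ∷ []) (𝟘 ∷ 𝟙 ∷ 𝟙 ∷ []))) ∼-refl
    member 2F = (0# ∷ 1# ∷ - 1# ∷ []) , subst (solid (change (square 2F)) ∼_)
      (equations 0 (Y.solid (X.change (𝟘 ∷ 𝟘 ∷ 𝟘 ∷ 𝟙 ∷ [])) ⊜ Y.product (𝟘 ∷ 𝟙 ∷ ⊝ 𝟙 ∷ []) (𝟘 ∷ 𝟙 ∷ ⊝ 𝟙 ∷ []))) ∼-refl

  real-pairs : Family H₂ᵣ (Index ⊎ Carrier)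
  real-pairs = record
    { vec         = change ∘ vec
    ; vec≢0       = λ i → change≢0 (vec≢0 i)
    ; member      = member
    ; independent = λ {i} {j} v∼ → independent i j (∼-change {vec i} {vec j} v∼)
    }
    where
    vec : Index ⊎ Carrier → Vec Carrier 4
    vec = Sum.[ pencil ∘ mapᵢ id sq , split ]

    vec≢0 : ∀ i → vec i ≢ 0ᵥ
    vec≢0 (inj₁ i) = pencil≢0 (mapᵢ id sq i)
    vec≢0 (inj₂ a) eq = 1≢0 (cong (λ v → lookup v 1F) eq)

    sq-parameter≢0 : ∀ i → parameter (mapᵢ {Carrier} id sq i) ≢ 0#
    sq-parameter≢0 = parameter-mapᵢ {P = _≢ 0#} sq≢0

    independent : ∀ i j → vec i ∼ vec j → i ≡ j
    independent (inj₁ i) (inj₁ j) v∼ = cong inj₁ (mapᵢ-injective pos²-injective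
      (pencil-injective {mapᵢ id sq i} {mapᵢ id sq j} (sq-parameter≢0 i) (sq-parameter≢0 j) v∼))
    independent (inj₁ i) (inj₂ a) v∼ = contradiction v∼ (pencil≁split (mapᵢ id sq i) a (sq-parameter≢0 i))
    independent (inj₂ a) (inj₁ i) v∼ = contradiction (∼-sym {u = split a} {pencil (mapᵢ id sq i)} v∼)
      (pencil≁split (mapᵢ id sq i) a (sq-parameter≢0 i))
    independent (inj₂ a) (inj₂ b) v∼ = cong inj₂ (split-injective v∼)

    member : ∀ i → ∃₂ λ l m → ¬ (l ∼ m) × solid (change (vec i)) ≡ formProduct l m
    member (inj₁ i) = linear j , linear (conjugateᵢ j)
      , linear-≁ 2≢0 j (parameter-mapᵢ {P = _≢ 0#} pos≢0 i)
      , trans (cong (solid ∘ change ∘ pencil) (sym (mapᵢ-∘ i))) (pencil-splits j)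
      where
      j = mapᵢ id pos i
    member (inj₂ a) = l , m
      , (λ l∼m → -‿nonzero 2≢0 (trans (equation 1 (λ a → ⊝ (𝟙 ⊕ 𝟙) ⊜ 𝟘 ⊗ a ⊕ ⊝ (𝟙 ⊗ (𝟙 ⊕ 𝟙))) a)
          (cong (λ v → lookup v 1F) (cross-∼ {l} {m} l∼m))))
      , equations 1 (λ a → Y.solid (X.change (a ∷ 𝟙 ∷ 𝟘 ∷ 𝟘 ∷ []))
          ⊜ Y.product (𝟙 ∷ 𝟘 ∷ 𝟘 ∷ []) (a ∷ 𝟘 ∷ 𝟙 ⊕ 𝟙 ∷ [])) a
      where
      l m : LinearForm
      l = 1# ∷ 0# ∷ 0# ∷ []
      -- The 2 arises from U - V = 2 X₂.
      m = a ∷ 0# ∷ 1# + 1# ∷ []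

  ω≢0 : ω ≢ K.0#
  ω≢0 ω≡0 = ω∉F (0# , trans embed.0#-homo (sym ω≡0))

  imaginary-pairs : Family H₂ᵢ Index
  imaginary-pairs = record
    { vec         = λ i → change (vec i)
    ; vec≢0       = λ i → change≢0 (pencil≢0 (mapᵢ id nsq i))
    ; member      = λ i → solid (change (vec i)) , ∼-refl , member i
    ; independent = λ {i} {j} v∼ → mapᵢ-injective (λ eq → pos²-injective (*-cancelˡ (δ≢0 δ-nonsquare) eq))
        (pencil-injective {mapᵢ id nsq i} {mapᵢ id nsq j} (nsq-parameter≢0 i) (nsq-parameter≢0 j)
          (∼-change {vec i} {vec j} v∼))
    }
    where
    vec : Index → Vec Carrier 4
    vec i = pencil (mapᵢ id nsq i)

    nsq-parameter≢0 : ∀ i → parameter (mapᵢ {Carrier} id nsq i) ≢ 0#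
    nsq-parameter≢0 = parameter-mapᵢ {P = _≢ 0#} nsq≢0

    -- A square root of the nonsquare `nsq j` in the extension. Conjugation negates ω and therefore
    -- this root, which makes the two factors conjugate.
    root : Fin h → K.Carrier
    root j = embed (pos j) K.* ω

    root² : ∀ j → embed (nsq j) ≡ root j K.* root j
    root² j = begin
      embed (δ * (pos j * pos j))                       ≡⟨ trans (embed.*-homo δ _) (cong (embed δ K.*_) (embed.*-homo _ _)) ⟩
      embed δ K.* (embed (pos j) K.* embed (pos j))     ≡⟨ cong (K._* (embed (pos j) K.* embed (pos j))) ω²≡δ ⟨
      ω K.* ω K.* (embed (pos j) K.* embed (pos j))     ≡⟨ K.equation 2 (λ w p → w ⊗ w ⊗ (p ⊗ p) ⊜ p ⊗ w ⊗ (p ⊗ w)) ω (embed (pos j)) ⟩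
      root j K.* root j                                 ∎
      where open ≡-Reasoning

    σ-root : ∀ j → σ (root j) ≡ K.- root j
    σ-root j = trans (σ-* _ ω) (trans (cong₂ K._*_ (σ-embed (pos j)) σ-ω)
      (K.equation 2 (λ p w → p ⊗ ⊝ w ⊜ ⊝ (p ⊗ w)) (embed (pos j)) ω))

    2≢0ᴱ : K.1# K.+ K.1# ≢ K.0#
    2≢0ᴱ eq = embed-nonzero 2≢0 (trans (embed.+-homo _ _) (trans (cong₂ K._+_ embed.1#-homo embed.1#-homo) eq))

    embed-pencil : ∀ i → embedᵥ (solid (change (pencil i))) ≡ K.solid (K.change (K.pencil (mapᵢ embed embed i)))
    embed-pencil (inj₁ (k , r)) = naturalᵥ (close 2 λ k r → Y.solid (X.change (X.pencil (inj₁ (k , r))))) (k ∷ r ∷ [])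
      where open Naturality F big isRingHomomorphism
    embed-pencil (inj₂ (inj₁ r)) = naturalᵥ (close 1 λ r → Y.solid (X.change (X.pencil (inj₂ (inj₁ r))))) (r ∷ [])
      where open Naturality F big isRingHomomorphism
    embed-pencil (inj₂ (inj₂ r)) = naturalᵥ (close 1 λ r → Y.solid (X.change (X.pencil (inj₂ (inj₂ r))))) (r ∷ [])
      where open Naturality F big isRingHomomorphism

    σ-linear : ∀ i → map σ (K.linear i) ≡ K.linear (mapᵢ σ σ i)
    σ-linear = λ
      { (inj₁ (k , r))  → naturalᵥ (close 2 λ k r → X.linear (inj₁ (k , r))) (k ∷ r ∷ [])
      ; (inj₂ (inj₁ r)) → naturalᵥ (close 1 λ r → X.linear (inj₂ (inj₁ r))) (r ∷ [])
      ; (inj₂ (inj₂ r)) → naturalᵥ (close 1 λ r → X.linear (inj₂ (inj₂ r))) (r ∷ [])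
      }
      where
      open Naturality big big (RingMorphisms.IsRingIsomorphism.isRingHomomorphism
        (IsAutomorphism.isRingIsomorphism σ-automorphism))

    member : ∀ i → ∃₂ λ l m → ¬ (l K.∼ m) × Conjugate l m × embedᵥ (solid (change (vec i))) ≡ K.formProduct l m
    member i = K.linear j , K.linear (K.conjugateᵢ j)
      , K.linear-≁ 2≢0ᴱ j (parameter-mapᵢ {P = _≢ K.0#} (λ r → K.*-nonzero (embed-nonzero (pos≢0 r)) ω≢0) i)
      , (σ , σ-automorphism , sym (trans (σ-linear j) (cong K.linear (begin
          mapᵢ σ σ j                          ≡⟨ mapᵢ-∘ i ⟩
          mapᵢ (σ ∘ embed) (σ ∘ root) i       ≡⟨ mapᵢ-cong σ-embed σ-root i ⟩
          mapᵢ embed (K.-_ ∘ root) i          ≡⟨ mapᵢ-∘ i ⟨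
          K.conjugateᵢ j                      ∎))))
      , trans (embed-pencil (mapᵢ id nsq i)) (trans (cong (K.solid ∘ K.change ∘ K.pencil) (begin
          mapᵢ embed embed (mapᵢ id nsq i)    ≡⟨ mapᵢ-∘ i ⟩
          mapᵢ embed (embed ∘ nsq) i          ≡⟨ mapᵢ-cong (λ _ → refl) root² i ⟩
          mapᵢ embed (λ r → root r K.* root r) i ≡⟨ mapᵢ-∘ i ⟨
          mapᵢ id (λ τ → τ K.* τ) j           ∎)) (K.pencil-splits j))
      where
      open ≡-Reasoning
      j : PencilIndex K.Carrier K.Carrier
      j = mapᵢ embed root i

  class-index : ∀ i → parameter i ≢ 0# →
    (∃ λ (j : Index) → i ≡ mapᵢ id sq j) ⊎ (∃ λ (j : Index) → i ≡ mapᵢ id nsq j)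
  class-index (inj₁ (k , r)) r≢0 = let j , eq = square-classes δ-nonsquare r r≢0 in
    Sum.map (λ eq → inj₁ (k , j) , cong (λ r → inj₁ (k , r)) eq) (λ eq → inj₁ (k , j) , cong (λ r → inj₁ (k , r)) eq) eq
  class-index (inj₂ (inj₁ r)) r≢0 = let j , eq = square-classes δ-nonsquare r r≢0 in
    Sum.map (λ eq → inj₂ (inj₁ j) , cong (inj₂ ∘ inj₁) eq) (λ eq → inj₂ (inj₁ j) , cong (inj₂ ∘ inj₁) eq) eq
  class-index (inj₂ (inj₂ r)) r≢0 = let j , eq = square-classes δ-nonsquare r r≢0 in
    Sum.map (λ eq → inj₂ (inj₂ j) , cong (inj₂ ∘ inj₂) eq) (λ eq → inj₂ (inj₂ j) , cong (inj₂ ∘ inj₂) eq) eq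

  open Family

  cover : ∀ w → w ≢ 0ᵥ → Singular (solid w) → (∃ λ i → w ∼ vec double-lines i)
    ⊎ (∃ λ i → w ∼ vec real-pairs i) ⊎ (∃ λ i → w ∼ vec imaginary-pairs i)
  cover w w≢0 sing = place (classify v v≢0 (singular-∼ {solid (change v)} {solid w}
    (solid-∼ {change v} {w} (∼-sym {u = w} {change v} w∼)) sing))
    where
    v = unchange w

    w∼ : w ∼ change v
    w∼ = ∼-unchange w

    v≢0 : v ≢ 0ᵥ
    v≢0 v≡0 = ∼-nonzero w∼ w≢0 (trans (cong change v≡0) (equations 0 (X.change (replicate 4 𝟘) ⊜ replicate 4 𝟘)))

    via : ∀ u → v ∼ u → w ∼ change u
    via u v∼u = ∼-trans {u = w} {change v} {change u} w∼ (change-∼ {v} {u} v∼u)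

    place : Classified v → _
    place (isSquare i v∼) = inj₁ (i , via (square i) v∼)
    place (isSplit a v∼)  = inj₂ (inj₁ (inj₂ a , via (split a) v∼))
    place (isPencil i r≢0 v∼) = inj₂ (Sum.map
      (λ (j , eq) → inj₁ j , subst (λ i → w ∼ change (pencil i)) eq w∼pencil)
      (λ (j , eq) → j , subst (λ i → w ∼ change (pencil i)) eq w∼pencil)
      (class-index i r≢0))
      where
      w∼pencil : w ∼ change (pencil i)
      w∼pencil = via (pencil i) v∼

  -- With h = (q - 1)/2 the three kinds of pencil give (q + 2) h forms of either type; the real
  -- pairs gain the q products with factor X₀.
  n₂ n₃ : ℕ
  n₃ = q ℕ.* h ℕ.+ (h ℕ.+ h)
  n₂ = n₃ ℕ.+ q

  index-order : Index ↔ Fin n₃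
  index-order = (F↔Fin ×-order ↔-refl) ⊎-order ↔-refl ⊎-order ↔-refl

  private
    -- Disposes of the truncated subtraction and the integer division together; the remaining
    -- equations are polynomial in h.
    halve-number : ∀ {m n} → m ≡ 2 ℕ.+ n ℕ.* 2 → (m ∸ 2) / 2 ≡ n
    halve-number {n = n} refl = m*n/n≡m n 2

    total : 3 ℕ.+ (n₂ ℕ.+ n₃) ≡ (q ℕ.+ 1) ^ 2
    total = subst (λ q → 3 ℕ.+ (q ℕ.* h ℕ.+ (h ℕ.+ h) ℕ.+ q ℕ.+ (q ℕ.* h ℕ.+ (h ℕ.+ h))) ≡ (q ℕ.+ 1) ^ 2)
      (sym q≡2h+1) (solve 1 (λ h → let q = h :+ (h :+ con 1) in
        con 3 :+ (q :* h :+ (h :+ h) :+ q :+ (q :* h :+ (h :+ h))) := (q :+ con 1) :^ 2) refl h)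
      where open +-*-Solver

    n₂-formula : (q ^ 2 ℕ.+ 3 ℕ.* q ∸ 2) / 2 ≡ n₂
    n₂-formula = halve-number (subst (λ q → q ^ 2 ℕ.+ 3 ℕ.* q ≡ 2 ℕ.+ (q ℕ.* h ℕ.+ (h ℕ.+ h) ℕ.+ q) ℕ.* 2)
      (sym q≡2h+1) (solve 1 (λ h → let q = h :+ (h :+ con 1) in
        q :^ 2 :+ con 3 :* q := con 2 :+ (q :* h :+ (h :+ h) :+ q) :* con 2) refl h))
      where open +-*-Solver

    n₃-formula : (q ^ 2 ℕ.+ q ∸ 2) / 2 ≡ n₃
    n₃-formula = halve-number (subst (λ q → q ^ 2 ℕ.+ q ≡ 2 ℕ.+ (q ℕ.* h ℕ.+ (h ℕ.+ h)) ℕ.* 2)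
      (sym q≡2h+1) (solve 1 (λ h → let q = h :+ (h :+ con 1) in
        q :^ 2 :+ q := con 2 :+ (q :* h :+ (h :+ h)) :* con 2) refl h))
      where open +-*-Solver

  odd-distribution : ∀ L → L ∈ o₁₃,₁ →
    OD₄ L (3 ∷ (q ^ 2 ℕ.+ 3 ℕ.* q ∸ 2) / 2 ∷ (q ^ 2 ℕ.+ q ∸ 2) / 2 ∷ q ^ 3 ∸ q ∷ [])
  odd-distribution L L∈ = subst₂ (λ m n → OD₄ L (3 ∷ m ∷ n ∷ q ^ 3 ∸ q ∷ [])) (sym n₂-formula) (sym n₃-formula)
    (Classification.distribution double-lines real-pairs imaginary-pairs cover
      ↔-refl (index-order ⊎-order F↔Fin) index-order total L L∈)

-- Even characteristic

module EvenForms (R : RawRing 0ℓ 0ℓ) where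
  open RawRing R

  -- With Y = b X₀ + X₁ and Z = X₂, the solid coefficients of u Y² + Y Z + u Z²
  -- (in characteristic two) ...
  node : Carrier → Carrier → Vec Carrier 6
  node b u = u * (b * b) ∷ 0# ∷ b ∷ u ∷ 1# ∷ u ∷ []

  -- ... and its factor v Y + (v + 1) Z for u = v² + v.
  linear : Carrier → Carrier → Vec Carrier 3
  linear b v = v * b ∷ v ∷ v + 1# ∷ []

module EvenFactorization (K : Field) (1+1≡0 : CharTwo K) where
  open Field K
  open FieldProperties K
  open Projective K renaming (_⊗_ to infixl 7 _⊠_)
  open FormProperties K
  open CharacteristicTwo K 1+1≡0
  open EvenForms rawRing public
  private
    module X {n} = EvenForms (exprRing n)
    module Y {n} = Forms (exprRing n)

  node-splits : ∀ b v → node b (v * v + v) ≡ formProduct (linear b v) (linear b (v + 1#))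
  node-splits = equations 2 λ b v →
    X.node b (v ⊗ v ⊕ v) ⊜ Y.product (X.linear b v) (X.linear b (v ⊕ 𝟙))

  -- The first coordinate of the cross product is v² - (v + 1)² = 1, whatever v is.
  linear-≁ : ∀ b v → ¬ (linear b v ∼ linear b (v + 1#))
  linear-≁ b v l∼m = 1≢0 (trans
    (equation 1 (λ v → 𝟙 ⊜ v ⊗ (v ⊕ 𝟙 ⊕ 𝟙) ⊕ ⊝ ((v ⊕ 𝟙) ⊗ (v ⊕ 𝟙))) v)
    (cong head (cross-∼ {linear b v} {linear b (v + 1#)} l∼m)))

module EvenDistribution {q : ℕ} (F : Field) (F↔Fin : HasOrder F q)
  (E : Extension F) (E↔Fin : HasOrder (Extension.big E) (q ^ 2))
  (1+1≡0 : CharTwo F) where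

  open Field F
  open Extension E
  open OrbitDistribution F E renaming (_⊗_ to infixl 7 _⊠_)
  open FieldProperties F
  open FormProperties F
  open Solid F
  open EvenFactorization F 1+1≡0
  open CharacteristicTwo F 1+1≡0
  open FiniteField.Even F F↔Fin 1+1≡0 using (h; half; ℘; ℘-half-injective; ℘-classes; square-root; q≡2h)
  open Finite F↔Fin using (_≟_)
  open FieldProperties.Decidable F _≟_ using (zero-product)
  open QuadraticExtension F F↔Fin E E↔Fin using (σ; σ-automorphism; σ-embed; σ-+)
  open QuadraticExtension.Even F F↔Fin E E↔Fin 1+1≡0
  open Distribution F F↔Fin E (Finite._≟_ E↔Fin)
  open Classes F E _≟_ (Finite._≟_ E↔Fin) using (embedᵥ; Singular; module embed)
  private
    module X {n} = EvenForms (exprRing n)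
    module Y {n} = Forms (exprRing n)
    module Z = IntegerCoefficients F
    -- `natural` concerns expressions with integer coefficients, so the forms are instantiated for
    -- these as well as for coefficients in the two-element field.
    module XZ {n} = EvenForms (Z.exprRing n)
    module K where
      open Field big public
      open FieldProperties big public
      open Projective big public
      open EvenFactorization big embed-1+1≡0 public
      open IntegerCoefficients big public using (equation)

    1≢c*0 : ∀ {c} → 1# ≢ c * 0#
    1≢c*0 {c} eq = 1≢0 (trans eq (zeroʳ c))

    0≢c*1 : ∀ {c} → c ≢ 0# → 0# ≢ c * 1#
    0≢c*1 c≢0 eq = *-nonzero c≢0 1≢0 (sym eq)

    unscale : ∀ {c x y} → 1# ≡ c * 1# → x ≡ c * y → x ≡ y
    unscale {c} {x} {y} 1≡c x≡cy = trans x≡cy (trans (cong (_* y) (trans (*-one c) (sym 1≡c))) (*-identityˡ y))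

  -- Chosen so that `solid (nodeᵥ b u)` computes to `node b u`.
  nodeᵥ : Carrier → Carrier → Vec Carrier 4
  nodeᵥ b u = u * (b * b) ∷ b ∷ u ∷ 1# ∷ []

  -- X₀ (a X₀ + X₂).
  split : Carrier → Vec Carrier 4
  split a = a ∷ 1# ∷ 0# ∷ 0# ∷ []

  -- X₀² + c (X₁² + X₂²) and X₁² + X₂².
  square : Carrier ⊎ Fin 1 → Vec Carrier 4
  square (inj₁ c) = 1# ∷ 0# ∷ c ∷ 0# ∷ []
  square (inj₂ _) = 0# ∷ 0# ∷ 1# ∷ 0# ∷ []

  nodeᵥ≢0 : ∀ b u → nodeᵥ b u ≢ 0ᵥ
  nodeᵥ≢0 b u eq = 1≢0 (cong (λ v → lookup v 3F) eq)

  nodeᵥ-injective : ∀ {b u b′ u′} → nodeᵥ b u ∼ nodeᵥ b′ u′ → b ≡ b′ × u ≡ u′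
  nodeᵥ-injective (c , _ , eq) =
    let 1≡c = cong (λ v → lookup v 3F) eq in
    unscale 1≡c (cong (λ v → lookup v 1F) eq) , unscale 1≡c (cong (λ v → lookup v 2F) eq)

  double-lines : Family H₁ (Carrier ⊎ Fin 1)
  double-lines = record
    { vec         = square
    ; vec≢0       = square≢0
    ; member      = member
    ; independent = λ {i} {j} → independent i j
    }
    where
    square≢0 : ∀ i → square i ≢ 0ᵥ
    square≢0 (inj₁ _) eq = 1≢0 (cong head eq)
    square≢0 (inj₂ _) eq = 1≢0 (cong (λ v → lookup v 2F) eq)

    member : ∀ i → ∃ λ l → solid (square i) ∼ formProduct l l
    -- With γ² = c the form is (X₀ + γ X₁ + γ X₂)², the mixed terms being doubled.
    member (inj₁ c) = let γ , γ²≡c = square-root c in (1# ∷ γ ∷ γ ∷ []) ,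
      subst (solid (square (inj₁ c)) ∼_)
        (trans (cong (λ c → solid (square (inj₁ c))) (sym γ²≡c))
          (equations 1 (λ γ → (𝟙 ∷ 𝟘 ∷ 𝟘 ∷ γ ⊗ γ ∷ 𝟘 ∷ γ ⊗ γ ∷ []) ⊜ Y.product (𝟙 ∷ γ ∷ γ ∷ []) (𝟙 ∷ γ ∷ γ ∷ [])) γ))
        ∼-refl
    member (inj₂ i) = (0# ∷ 1# ∷ 1# ∷ []) , subst (solid (square (inj₂ i)) ∼_)
      (equations 0 ((𝟘 ∷ 𝟘 ∷ 𝟘 ∷ 𝟙 ∷ 𝟘 ∷ 𝟙 ∷ []) ⊜ Y.product (𝟘 ∷ 𝟙 ∷ 𝟙 ∷ []) (𝟘 ∷ 𝟙 ∷ 𝟙 ∷ []))) ∼-refl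

    independent : ∀ i j → square i ∼ square j → i ≡ j
    independent (inj₁ c)  (inj₁ d)  (_ , _ , eq)   = cong inj₁ (unscale (cong head eq) (cong (λ v → lookup v 2F) eq))
    independent (inj₂ 0F) (inj₂ 0F) _              = refl
    independent (inj₁ _)  (inj₂ _)  (_ , _ , eq)   = contradiction (cong head eq) 1≢c*0
    independent (inj₂ _)  (inj₁ _)  (_ , c≢0 , eq) = contradiction (cong head eq) (0≢c*1 c≢0)

  real-pairs : Family H₂ᵣ (Carrier × Fin h ⊎ Carrier)
  real-pairs = record
    { vec         = vec
    ; vec≢0       = vec≢0
    ; member      = member
    ; independent = λ {i} {j} → independent i j
    }
    where
    vec : Carrier × Fin h ⊎ Carrier → Vec Carrier 4
    vec = Sum.[ (λ (b , j) → nodeᵥ b (℘ (half j))) , split ]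

    vec≢0 : ∀ i → vec i ≢ 0ᵥ
    vec≢0 (inj₁ (b , j)) = nodeᵥ≢0 b (℘ (half j))
    vec≢0 (inj₂ a) eq    = 1≢0 (cong (λ v → lookup v 1F) eq)

    member : ∀ i → ∃₂ λ l m → ¬ (l ∼ m) × solid (vec i) ≡ formProduct l m
    member (inj₁ (b , j)) = linear b (half j) , linear b (half j + 1#)
      , linear-≁ b (half j) , node-splits b (half j)
    member (inj₂ a) = l , m
      , (λ l∼m → 1≢0 (trans (equation 1 (λ a → 𝟙 ⊜ 𝟘 ⊗ a ⊕ ⊝ (𝟙 ⊗ 𝟙)) a)
          (cong (λ v → lookup v 1F) (cross-∼ {l} {m} l∼m))))
      , equations 1 (λ a → (a ∷ 𝟘 ∷ 𝟙 ∷ 𝟘 ∷ 𝟘 ∷ 𝟘 ∷ []) ⊜ Y.product (𝟙 ∷ 𝟘 ∷ 𝟘 ∷ []) (a ∷ 𝟘 ∷ 𝟙 ∷ [])) a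
      where
      l m : LinearForm
      l = 1# ∷ 0# ∷ 0# ∷ []
      m = a ∷ 0# ∷ 1# ∷ []

    independent : ∀ i j → vec i ∼ vec j → i ≡ j
    independent (inj₁ (b , i)) (inj₁ (c , j)) v∼ =
      let b≡c , u≡ = nodeᵥ-injective {b} {℘ (half i)} {c} {℘ (half j)} v∼ in
      cong₂ (λ b i → inj₁ (b , i)) b≡c (℘-half-injective u≡)
    independent (inj₁ _) (inj₂ _) (_ , _ , eq)   = contradiction (cong (λ v → lookup v 3F) eq) 1≢c*0
    independent (inj₂ _) (inj₁ _) (_ , c≢0 , eq) = contradiction (cong (λ v → lookup v 3F) eq) (0≢c*1 c≢0)
    independent (inj₂ a) (inj₂ b) (_ , _ , eq)   =
      cong inj₂ (unscale (cong (λ v → lookup v 1F) eq) (cong head eq))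

  imaginary-pairs : Family H₂ᵢ (Carrier × Fin h)
  imaginary-pairs = record
    { vec         = λ (b , j) → nodeᵥ b (u j)
    ; vec≢0       = λ (b , j) → nodeᵥ≢0 b (u j)
    ; member      = λ (b , j) → solid (nodeᵥ b (u j)) , ∼-refl , member b j
    ; independent = λ {(b , i)} {(c , j)} v∼ →
        let b≡c , u≡ = nodeᵥ-injective {b} {u i} {c} {u j} v∼ in
        cong₂ _,_ b≡c (u-injective u≡)
    }
    where
    u : Fin h → Carrier
    u j = ℘ (half j) + δ

    u-injective : Injective u
    u-injective {i} {j} eq = ℘-half-injective (by-multiple 1# (equation 3 (λ x y d →
      x ⊕ ⊝ y ⊜ 𝟙 ⊗ (x ⊕ d ⊕ ⊝ (y ⊕ d))) (℘ (half i)) (℘ (half j)) δ) eq)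

    -- By additivity `℘` takes this to `℘ (half j) + δ`. Conjugation adds 1 to ω, hence to v, and so
    -- exchanges the two factors.
    v : Fin h → K.Carrier
    v j = embed (half j) K.+ ω

    embed-u : ∀ j → embed (u j) ≡ v j K.* v j K.+ v j
    embed-u j = begin
      embed (u j)                                    ≡⟨ trans (embed.+-homo _ δ) (cong (K._+ embed δ)
                                                          (trans (embed.+-homo _ _) (cong (K._+ x) (embed.*-homo _ _)))) ⟩
      x K.* x K.+ x K.+ embed δ                      ≡⟨ cong (x K.* x K.+ x K.+_) ω²+ω≡δ ⟨
      x K.* x K.+ x K.+ (ω K.* ω K.+ ω)              ≡⟨ C.equation 2 (λ x w → x ⊗ x ⊕ x ⊕ (w ⊗ w ⊕ w)
                                                          C.⊜ (x ⊕ w) ⊗ (x ⊕ w) ⊕ (x ⊕ w)) x ω ⟩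
      v j K.* v j K.+ v j                            ∎
      where
      open ≡-Reasoning
      module C = CharacteristicTwo big embed-1+1≡0
      x = embed (half j)

    σ-v : ∀ j → σ (v j) ≡ v j K.+ K.1#
    σ-v j = trans (σ-+ _ ω) (trans (cong₂ K._+_ (σ-embed (half j)) σ-ω)
      (K.equation 2 (λ x w → x ⊕ (w ⊕ Z.𝟙) Z.⊜ x ⊕ w ⊕ Z.𝟙) (embed (half j)) ω))

    σ-linear : ∀ b x → map σ (K.linear b x) ≡ K.linear (σ b) (σ x)
    σ-linear b x = naturalᵥ (Z.close 2 λ b x → XZ.linear b x) (b ∷ x ∷ [])
      where
      open Naturality big big (RingMorphisms.IsRingIsomorphism.isRingHomomorphism
        (IsAutomorphism.isRingIsomorphism σ-automorphism))

    member : ∀ b j → ∃₂ λ l m → ¬ (l K.∼ m) × Conjugate l m × embedᵥ (solid (nodeᵥ b (u j))) ≡ K.formProduct l m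
    member b j = K.linear (embed b) (v j) , K.linear (embed b) (v j K.+ K.1#)
      , K.linear-≁ (embed b) (v j)
      , (σ , σ-automorphism , sym (trans (σ-linear (embed b) (v j)) (cong₂ K.linear (σ-embed b) (σ-v j))))
      , trans (naturalᵥ (Z.close 2 λ b u → XZ.node b u) (b ∷ u j ∷ []))
          (trans (cong (K.node (embed b)) (embed-u j)) (K.node-splits (embed b) (v j)))
      where open Naturality F big isRingHomomorphism

  open Family

  Covered : Vec Carrier 4 → Set
  Covered w = (∃ λ i → w ∼ vec double-lines i) ⊎ (∃ λ i → w ∼ vec real-pairs i) ⊎ (∃ λ i → w ∼ vec imaginary-pairs i)

  node-covered : ∀ w b u → w ∼ nodeᵥ b u → Covered w
  node-covered w b u w∼ = let j , u≡ = ℘-classes δ∉℘ u in inj₂ (Sum.map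
    (λ u≡ → inj₁ (b , j) , subst (λ u → w ∼ nodeᵥ b u) u≡ w∼)
    (λ u≡ → (b , j) , subst (λ u → w ∼ nodeᵥ b u) u≡ w∼) u≡)

  -- The discriminant reduces to the equation a d² = c b². Scaling d to 1 leaves a = c b², the
  -- condition for a `nodeᵥ`; for d = 0, either b = 0 and the form is a square, or c = 0 and X₀ is a
  -- factor.
  cover : ∀ w → w ≢ 0ᵥ → Singular (solid w) → Covered w
  cover w@(a ∷ b ∷ c ∷ d ∷ []) w≢0 sing = go (d ≟ 0#) (b ≟ 0#) (a ≟ 0#)
    where
    degenerate : a * (d * d) ≡ c * (b * b)
    degenerate = by-multiple 1# (equation 4 (λ a b c d → a ⊗ (d ⊗ d) ⊕ ⊝ (c ⊗ (b ⊗ b))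
      ⊜ 𝟙 ⊗ (Y.discriminant (a ∷ 𝟘 ∷ b ∷ c ∷ d ∷ c ∷ []) ⊕ ⊝ 𝟘)) a b c d) sing

    c≡0 : d ≡ 0# → b ≢ 0# → c ≡ 0#
    c≡0 refl b≢0 = *-zero-cancelˡ (*-nonzero b≢0 b≢0) (trans (*-comm _ c) (trans (sym degenerate)
      (equation 1 (λ a → a ⊗ (𝟘 ⊗ 𝟘) ⊜ 𝟘) a)))

    go : Dec (d ≡ 0#) → Dec (b ≡ 0#) → Dec (a ≡ 0#) → Covered w
    go (no d≢0) _ _ = node-covered w (e * b) (e * c) (d , d≢0 ,
      cong₂ _∷_ a≡ (cong₂ _∷_ (scale de≡1) (cong₂ _∷_ (scale de≡1) (cong (_∷ []) (*-one d)))))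
      where
      e = proj₁ (inverse d d≢0)
      de≡1 = proj₂ (inverse d d≢0)

      a≡ : a ≡ d * (e * c * (e * b * (e * b)))
      a≡ = begin
        a                                  ≡⟨ equation 1 (λ a → a ⊜ a ⊗ (𝟙 ⊗ 𝟙)) a ⟩
        a * (1# * 1#)                      ≡⟨ cong (λ x → a * (x * x)) de≡1 ⟨
        a * (d * e * (d * e))              ≡⟨ equation 3 (λ a d e → a ⊗ (d ⊗ e ⊗ (d ⊗ e)) ⊜ a ⊗ (d ⊗ d) ⊗ (e ⊗ e)) a d e ⟩
        a * (d * d) * (e * e)              ≡⟨ cong (_* (e * e)) degenerate ⟩
        c * (b * b) * (e * e)              ≡⟨ equation 3 (λ b c e → c ⊗ (b ⊗ b) ⊗ (e ⊗ e) ⊜ 𝟙 ⊗ (c ⊗ (e ⊗ b ⊗ (e ⊗ b)))) b c e ⟩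
        1# * (c * (e * b * (e * b)))       ≡⟨ cong (_* (c * (e * b * (e * b)))) de≡1 ⟨
        d * e * (c * (e * b * (e * b)))    ≡⟨ equation 4 (λ b c d e → d ⊗ e ⊗ (c ⊗ (e ⊗ b ⊗ (e ⊗ b)))
                                                ⊜ d ⊗ (e ⊗ c ⊗ (e ⊗ b ⊗ (e ⊗ b)))) b c d e ⟩
        d * (e * c * (e * b * (e * b)))    ∎
        where open ≡-Reasoning
    go (yes d≡0) (no b≢0) _ = let e , be≡1 = inverse b b≢0 in
      inj₂ (inj₁ (inj₂ (e * a) , b , b≢0 ,
        cong₂ _∷_ (scale be≡1) (cong₂ _∷_ (*-one b)
          (cong₂ _∷_ (trans (c≡0 d≡0 b≢0) (sym (zeroʳ b))) (cong (_∷ []) (trans d≡0 (sym (zeroʳ b))))))))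
    go (yes d≡0) (yes b≡0) (no a≢0) = let e , ae≡1 = inverse a a≢0 in
      inj₁ (inj₁ (e * c) , a , a≢0 ,
        cong₂ _∷_ (*-one a) (cong₂ _∷_ (trans b≡0 (sym (zeroʳ a)))
          (cong₂ _∷_ (scale ae≡1) (cong (_∷ []) (trans d≡0 (sym (zeroʳ a)))))))
    go (yes d≡0) (yes b≡0) (yes a≡0) = inj₁ (inj₂ 0F , c , c≢0 ,
        cong₂ _∷_ (trans a≡0 (sym (zeroʳ c))) (cong₂ _∷_ (trans b≡0 (sym (zeroʳ c)))
          (cong₂ _∷_ (*-one c) (cong (_∷ []) (trans d≡0 (sym (zeroʳ c)))))))
      where
      c≢0 : c ≢ 0#
      c≢0 c≡0 = w≢0 (cong₂ _∷_ a≡0 (cong₂ _∷_ b≡0 (cong₂ _∷_ c≡0 (cong (_∷ []) d≡0))))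

  private
    total : q ℕ.+ 1 ℕ.+ (q ℕ.* h ℕ.+ q ℕ.+ q ℕ.* h) ≡ (q ℕ.+ 1) ^ 2
    total = subst (λ q → q ℕ.+ 1 ℕ.+ (q ℕ.* h ℕ.+ q ℕ.+ q ℕ.* h) ≡ (q ℕ.+ 1) ^ 2)
      (sym q≡2h) (solve 1 (λ h → let q = h :+ h in
        q :+ con 1 :+ (q :* h :+ q :+ q :* h) := (q :+ con 1) :^ 2) refl h)
      where open +-*-Solver

    half-formula : q ^ 2 / 2 ≡ q ℕ.* h
    half-formula = trans (cong (_/ 2) (subst (λ q → q ^ 2 ≡ q ℕ.* h ℕ.* 2)
      (sym q≡2h) (solve 1 (λ h → let q = h :+ h in q :^ 2 := q :* h :* con 2) refl h)))
      (m*n/n≡m (q ℕ.* h) 2)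
      where open +-*-Solver

  even-distribution : ∀ L → L ∈ o₁₃,₁ →
    OD₄ L (q ℕ.+ 1 ∷ q ^ 2 / 2 ℕ.+ q ∷ q ^ 2 / 2 ∷ q ^ 3 ∸ q ∷ [])
  even-distribution L L∈ = subst (λ n → OD₄ L (q ℕ.+ 1 ∷ n ℕ.+ q ∷ n ∷ q ^ 3 ∸ q ∷ [])) (sym half-formula)
    (Classification.distribution double-lines real-pairs imaginary-pairs cover
      (F↔Fin ⊎-order ↔-refl) ((F↔Fin ×-order ↔-refl) ⊎-order F↔Fin) (F↔Fin ×-order ↔-refl) total L L∈)

-- Parity of the order and the theorem

2∣h+h : ∀ h → 2 ∣ h ℕ.+ h
2∣h+h h = divides h (trans (cong (h ℕ.+_) (sym (ℕₚ.+-identityʳ h))) (ℕₚ.*-comm 2 h))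

2∤h+[h+1] : ∀ h → ¬ 2 ∣ h ℕ.+ (h ℕ.+ 1)
2∤h+[h+1] h 2∣ with ∣1⇒≡1 (∣m+n∣m⇒∣n (subst (2 ∣_) (sym (ℕₚ.+-assoc h h 1)) 2∣) (2∣h+h h))
... | ()

open import Data.Nat using (_+_; _*_)

lemma4p11 : (q : ℕ) → PrimePower q →
    (F : Field) → HasOrder F q →
    (E : Extension F) → HasOrder (Extension.big E) (q ^ 2) →
    let open OrbitDistribution F E in
    (L : Line) → L ∈ o₁₃,₁ →
    (¬ (2 ∣ q) → OD₄ L (3 ∷ (q ^ 2 + 3 * q ∸ 2) / 2 ∷ (q ^ 2 + q ∸ 2) / 2 ∷ q ^ 3 ∸ q ∷ []))
    × (2 ∣ q → OD₄ L (q + 1 ∷ q ^ 2 / 2 + q ∷ q ^ 2 / 2 ∷ q ^ 3 ∸ q ∷ []))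
lemma4p11 q _ F F↔Fin E E↔Fin L L∈ = odd , even
  where
  open Field F using (1#; 0#) renaming (_+_ to _⊞_)
  open Finite F↔Fin using (_≟_)

  -- The case distinction on q becomes one on 1 + 1 = 0, since the field has 2h elements in
  -- characteristic two and 2h + 1 otherwise.
  odd : ¬ (2 ∣ q) → _
  odd 2∤q = OddDistribution.odd-distribution F F↔Fin E E↔Fin
    (λ 1+1≡0 → 2∤q (subst (2 ∣_) (sym (FiniteField.Even.q≡2h F F↔Fin 1+1≡0)) (2∣h+h (FiniteField.Even.h F F↔Fin 1+1≡0)))) L L∈

  even : 2 ∣ q → _
  even 2∣q with 1# ⊞ 1# ≟ 0#
  ... | yes 1+1≡0 = EvenDistribution.even-distribution F F↔Fin E E↔Fin 1+1≡0 L L∈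
  ... | no 2≢0    = contradiction (subst (2 ∣_) (FiniteField.Odd.q≡2h+1 F F↔Fin 2≢0) 2∣q) 
                      (2∤h+[h+1] (FiniteField.Odd.h F F↔Fin 2≢0))
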